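{- Let $t\ge2$, $\omega$ a primitive $t$-th root of unity, and $\lambda\in\mathcal P_t$. Let $(\lambda^{(0)},\dots,\lambda^{(t-1)})$, $n_i(\lambda)$, $\sigma_\lambda$ be the $t$-quotient, residue counts and sorting permutation computed from $\beta(\lambda,t)$. Then the odd orthogonal character $\mathrm{oo}_\lambda(1,\omega,\dots,\omega^{t-1})$ is nonzero if and only if the $t$-core of $\lambda$ is self-conjugate. In that case, if the $t$-core has rank $r$, \[ \mathrm{oo}_\lambda(1,\omega,\dots,\omega^{t-1})=(-1)^{\epsilon}\operatorname{sgn}(\sigma_\lambda)\prod_{i=0}^{\lfloor(t-2)/2\rfloor}\big(\lambda^{(i)}_1+\lambda^{(t-1-i)}_1-\lambda^{(i)}_2-\lambda^{(t-1-i)}_2+1\big)\times\begin{cases}2\lambda^{((t-1)/2)}_1+1 & t\text{ odd},\\1 & t\text{ even},\end{cases} \] where $\epsilon=-\sum_{i=\lfloor(t+1)/2\rfloor}^{t-1}\binom{n_i(\lambda)+1}{2}+\begin{cases}0 & t\text{ even},\\ r & t\text{ odd},\end{cases}$ and $\mu_k$ denotes the $k$-th part of $\mu$ (zero if $k>\ell(\mu)$).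
   Context: Partitions $\lambda=(\lambda_1\ge\dots\ge0)$, $\ell$ = number of nonzero parts, $\mathcal P_m$ = partitions with $\ell\le m$. Beta-set $\beta(\lambda,m)=(\lambda_j+m-j)_{1\le j\le m}$; $n_i(\lambda)$ = number of its entries congruent to $i$ mod $t$. $t$-core: list the integers $tj+i$ ($0\le i\le t-1$, $0\le j\le n_i-1$) decreasingly as $b_1>\dots>b_m$; the $t$-core has parts $b_j-m+j$. $t$-quotient: writing entries congruent to $i$ decreasingly as $tc^{(i)}_1+i>\dots>tc^{(i)}_{n_i}+i$, $\lambda^{(i)}$ has parts $c^{(i)}_j-n_i+j$. $\sigma_\lambda\in S_m$: $(\beta_{\sigma_\lambda(1)},\dots,\beta_{\sigma_\lambda(m)})$ lists entries $\equiv0$ mod $t$ decreasingly, then $\equiv1$, ..., then $\equiv t-1$. Rank of $\nu$: largest $k$ with $\nu_k\ge k$; self-conjugate means equal to its conjugate. $h_k$ complete homogeneous symmetric polynomial ($h_0=1$, $h_k=0$ for $k<0$). For $k$ variables $W$, $\overline W=(1/w_1,\dots,1/w_k)$ and $\lambda\in\mathcal P_k$: $\mathrm{oo}_\lambda(W)=\det(h_{\lambda_i-i+j}(W,\overline W,1)-h_{\lambda_i-i-j}(W,\overline W,1))_{1\le i,j\le k}$. -}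

module Defs where

open import Level using (Level)
open import Data.Nat as ℕ using (ℕ; zero; suc; _∸_; _≤?_; _<?_; _≟_)
open import Data.Nat.DivMod using (_%_; _/_)
open import Data.Integer as ℤ using (ℤ; +_; -[1+_])
open import Data.Fin as Fin using (Fin; toℕ; punchIn)
open import Data.List using (List; []; _∷_; _++_; map; filter; length; concat; concatMap; foldr; upTo; allFin; zip; reverse)
open import Data.Product using (_×_; _,_; proj₁; proj₂)
open import Data.Bool using (if_then_else_)
open import Relation.Nullary.Decidable using (does)
open import Algebra.Bundles using (CommutativeRing)

-- residue and quotient of x modulo t (t ≥ 1; the value for t = 0 is irrelevant)
res : ℕ → ℕ → ℕ
res zero    x = x
res (suc k) x = x % suc k

quo : ℕ → ℕ → ℕ
quo zero    x = 0
quo (suc k) x = x / suc k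

-- 1-indexed k-th part of a partition given as a list of parts (0 if absent)
part : List ℕ → ℕ → ℕ
part []       _             = 0
part (x ∷ xs) zero          = 0
part (x ∷ xs) (suc zero)    = x
part (x ∷ xs) (suc (suc k)) = part xs (suc k)

conjPart : List ℕ → ℕ → ℕ
conjPart μ k = length (filter (k ≤?_) μ)

SelfConj : List ℕ → Set
SelfConj μ = ∀ k → part μ (suc k) Relation.Binary.PropositionalEquality.≡ conjPart μ (suc k)
  where import Relation.Binary.PropositionalEquality

rank : List ℕ → ℕ
rank μ = foldr ℕ._⊔_ 0 (filter (λ k → k ≤? part μ k) (map suc (upTo (length μ))))

beta : (m : ℕ) → (Fin m → ℕ) → List ℕ
beta m lam = map (λ j → lam j ℕ.+ (m ∸ suc (toℕ j))) (allFin m)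

resClass : ℕ → ℕ → List ℕ → List ℕ
resClass t i = filter (λ x → res t x ≟ i)

nres : (t : ℕ) → (Fin t → ℕ) → ℕ → ℕ
nres t lam i = length (resClass t i (beta t lam))

insertDec : ℕ → List ℕ → List ℕ
insertDec x []       = x ∷ []
insertDec x (y ∷ ys) = if does (y <? x) then x ∷ y ∷ ys else y ∷ insertDec x ys

sortDec : List ℕ → List ℕ
sortDec = foldr insertDec []

indexed : List ℕ → List (ℕ × ℕ)
indexed xs = zip (map suc (upTo (length xs))) xs

core : (t : ℕ) → (Fin t → ℕ) → List ℕ
core t lam =
  map (λ jb → proj₂ jb ℕ.+ proj₁ jb ∸ t)
      (indexed (sortDec (concatMap (λ i → map (λ j → t ℕ.* j ℕ.+ i) (upTo (nres t lam i))) (upTo t))))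

quotientPart : (t : ℕ) → (Fin t → ℕ) → ℕ → List ℕ
quotientPart t lam i =
  map (λ jx → quo t (proj₂ jx) ℕ.+ proj₁ jx ∸ length xs) (indexed xs)
  where xs = resClass t i (beta t lam)

-- σ_λ as the list (σ(1), …, σ(m)): positions of the entries of β,
-- taking residue 0 entries decreasingly, then residue 1, …, residue t-1
sigma : (t : ℕ) → (Fin t → ℕ) → List ℕ
sigma t lam =
  map proj₁ (concatMap (λ i → filter (λ p → res t (proj₂ p) ≟ i) (indexed (beta t lam))) (upTo t))

inversions : List ℕ → ℕ
inversions []       = 0
inversions (x ∷ xs) = length (filter (_<? x) xs) ℕ.+ inversions xs

signℕ : ℕ → ℤ
signℕ n = if does (res 2 n ≟ 0) then + 1 else ℤ.- (+ 1)

signℤ : ℤ → ℤ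
signℤ e = signℕ ℤ.∣ e ∣

sgn : List ℕ → ℤ
sgn σ = signℕ (inversions σ)

sumℤ : List ℤ → ℤ
sumℤ = foldr ℤ._+_ (+ 0)

prodℤ : List ℤ → ℤ
prodℤ = foldr ℤ._*_ (+ 1)

choose2 : ℕ → ℕ
choose2 n = (n ℕ.* (n ∸ 1)) / 2

rhs74 : (t : ℕ) → (Fin t → ℕ) → ℤ
rhs74 t lam = signℤ ε ℤ.* sgn (sigma t lam) ℤ.* prodℤ (map factor (upTo (suc ((t ∸ 2) / 2)))) ℤ.* oddFactor
  where
    q1 q2 : ℕ → ℤ
    q1 i = + part (quotientPart t lam i) 1
    q2 i = + part (quotientPart t lam i) 2
    factor : ℕ → ℤ
    factor i = q1 i ℤ.+ q1 (t ∸ 1 ∸ i) ℤ.- q2 i ℤ.- q2 (t ∸ 1 ∸ i) ℤ.+ + 1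
    tOdd : Data.Bool.Bool
    tOdd = does (res 2 t ≟ 1)
    oddFactor : ℤ
    oddFactor = if tOdd then + 2 ℤ.* q1 ((t ∸ 1) / 2) ℤ.+ + 1 else + 1
    ε : ℤ
    ε = ℤ.- sumℤ (map (λ i → + choose2 (nres t lam i ℕ.+ 1))
                      (map (λ k → (suc t / 2) ℕ.+ k) (upTo (t ∸ suc t / 2))))
        ℤ.+ (if tOdd then + rank (core t lam) else + 0)
    import Data.Bool

module RingDefs {c ℓ : Level} (R : CommutativeRing c ℓ) where
  open CommutativeRing R

  pow : Carrier → ℕ → Carrier
  pow x zero    = 1#
  pow x (suc n) = x * pow x n

  fromℕ : ℕ → Carrier
  fromℕ zero    = 0#
  fromℕ (suc n) = 1# + fromℕ n

  fromℤ : ℤ → Carrier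
  fromℤ (+ n)     = fromℕ n
  fromℤ -[1+ n ]  = - fromℕ (suc n)

  sumR : List Carrier → Carrier
  sumR = foldr _+_ 0#

  -- complete homogeneous symmetric polynomial h_k evaluated at a list of values
  h : ℕ → List Carrier → Carrier
  h zero    []       = 1#
  h (suc k) []       = 0#
  h k       (x ∷ xs) = sumR (map (λ a → pow x a * h (k ∸ a) xs) (upTo (suc k)))

  hℤ : ℤ → List Carrier → Carrier
  hℤ (+ k)    xs = h k xs
  hℤ -[1+ _ ] xs = 0#

  det : (n : ℕ) → (Fin n → Fin n → Carrier) → Carrier
  det zero    M = 1#
  det (suc n) M = sumR (map term (allFin (suc n)))
    where
      term : Fin (suc n) → Carrier
      term j = fromℤ (signℕ (toℕ j)) * (M Fin.zero j * det n (λ r s → M (Fin.suc r) (punchIn j s)))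

  -- the variables (W, W̄, 1) for W = (1, ω, …, ω^{t-1}); the inverse of
  -- ω^j is written ω^{t-j} (valid since ω^t = 1)
  vars : ℕ → Carrier → List Carrier
  vars t ω = map (pow ω) (upTo t) ++ map (λ j → pow ω (t ∸ j)) (upTo t) ++ (1# ∷ [])

  ooAtRoots : (t : ℕ) → (Fin t → ℕ) → Carrier → Carrier
  ooAtRoots t lam ω = det t entry
    where
      entry : Fin t → Fin t → Carrier
      entry i j = hℤ (+ lam i ℤ.- + suc (toℕ i) ℤ.+ + suc (toℕ j)) (vars t ω)
                - hℤ (+ lam i ℤ.- + suc (toℕ i) ℤ.- + suc (toℕ j)) (vars t ω)

  IntegralDomain : Set (c Level.⊔ ℓ)
  IntegralDomain = ∀ x y → x * y ≈ 0# → (x ≈ 0#) ⊎ (y ≈ 0#)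
    where open import Data.Sum using (_⊎_)

  CharZero : Set ℓ
  CharZero = ∀ n → ¬ (fromℕ (suc n) ≈ 0#)
    where open import Relation.Nullary using (¬_)

  PrimitiveRoot : ℕ → Carrier → Set ℓ
  PrimitiveRoot t ω = (pow ω t ≈ 1#) × (∀ k → 0 ℕ.< k → k ℕ.< t → ¬ (pow ω k ≈ 1#))
    where open import Relation.Nullary using (¬_)

IsPartition : (t : ℕ) → (Fin t → ℕ) → Set
IsPartition t lam = ∀ i j → i Fin.≤ j → lam j ℕ.≤ lam i

{-# OPTIONS --safe #-}
-- A beta number β_i = r + c t, 0 ≤ r < t, turns row i of the Jacobi–Trudi determinant into
-- (c+1) u_{t-1-r} + c u_r, where u_s is the indicator row of the columns j ≥ s (0-indexed): this comes from
-- ∏_j (1 − ω^j q) = 1 − q^t, which gives h_k(1,ω,…; inverses; 1) = C(⌊k/t⌋+2, 2).  Since the u_s are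
-- unitriangular, the determinant is the value of an alternating form normalised by (u_0,…,u_{t-1}) ↦ 1
-- at rows lying in the planes ⟨u_r, u_{t-1-r}⟩.  If n_r + n_{t-1-r} > 2 for some r, three rows lie in one
-- plane and the form vanishes; otherwise every plane contains exactly two rows (and the middle line one),
-- and the value is a product of 2×2 determinants.  The condition n_r + n_{t-1-r} = 2 for all r says that
-- the bead set of the core is exchanged with its complement by x ↦ 2t−1−x, i.e. the core is self-conjugate.
module Submission where

open import Defs
open import Level using (Level)
open import Data.Nat as ℕ using (ℕ; zero; suc; _≤_)
import Data.Nat.Properties as ℕₚ
import Data.Nat.Solver
open import Data.Nat.DivMod using (_%_; _/_; m%n<n; m≡m%n+[m/n]*n)
open import Data.Nat.ListAction using (sum)
open import Data.Integer as ℤ using (ℤ; +_; -[1+_])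
import Data.Integer.Properties as ℤₚ
import Data.Integer.Solver
open import Data.Fin as Fin using (Fin; toℕ; punchIn)
import Data.Fin.Properties as Finₚ
open import Data.Maybe using (Maybe; just; nothing)
open import Data.List using (List; []; _∷_; _++_; _∷ʳ_; [_]; map; length; foldr; applyUpTo; upTo; filter; concat; concatMap; tabulate)
import Data.List.Properties as Listₚ
open import Data.List.Relation.Unary.All as All using (All; []; _∷_)
import Data.List.Relation.Unary.All.Properties as Allₚ
open import Data.List.Relation.Unary.AllPairs as AllPairs using (AllPairs; []; _∷_)
import Data.List.Relation.Unary.AllPairs.Properties as AllPairsₚ
open import Data.List.Relation.Binary.Permutation.Propositional as Perm using (_↭_; ↭-refl; ↭-sym; ↭-trans; ↭-reflexive)
import Data.List.Relation.Binary.Permutation.Propositional.Properties as Permₚ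
open import Data.Product using (_×_; _,_; proj₁; proj₂; ∃; ∃₂)
open import Data.Sum using (_⊎_; inj₁; inj₂)
open import Data.Bool using (true; false; if_then_else_)
open import Function using (_∘_; id)
open import Function.Bundles using (_⇔_; mk⇔; module Equivalence)
open import Relation.Nullary using (Dec; yes; no; ¬_; contradiction)
open import Relation.Nullary.Decidable using (does; dec-true; dec-false; _⊎-dec_)
open import Relation.Unary using (Pred; Decidable)
open import Relation.Binary.Definitions using (tri<; tri≈; tri>)
open import Relation.Binary.PropositionalEquality as ≡ using (_≡_; _≢_)
open import Algebra.Bundles using (CommutativeRing)
import Algebra.Solver.Ring
import Algebra.Solver.Ring.AlmostCommutativeRing as ACR

-- The sign in the formula arises locally. Sorting the rows by residue costs sgn σ_λ. In the basis
-- (u_i, u_(t-1-i)) a row of residue i has coordinates (c, c+1) and a row of residue t-1-i has (c+1,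
-- c), so for i < t-1-i the 2×2 determinants have signs +, -, - when the larger residue occurs 0, 1,
-- 2 times; this is the sign of the binomial coefficient in ε. If both rows of a plane have the same
-- residue, one of them must be carried across the rows between the two residues. The number of
-- these rows has the parity of t, and the number of residues occurring twice is then the rank of
-- the core, whence the term r for odd t. On the side of partitions, truncated subtraction makes
-- parts awkward to compare, so everything is expressed through the number `N x` of beads at or
-- above x: a cell of the diagram is a lower bound on such a count, and conjugation exchanges the
-- two coordinates of the cell.

module NatSolver = Data.Nat.Solver.+-*-Solver
module IntSolver = Data.Integer.Solver.+-*-Solver

-- Signs and inversions.

signℕ-suc : ∀ n → signℕ (suc n) ≡ ℤ.- signℕ n
signℕ-suc zero          = ≡.refl
signℕ-suc (suc zero)    = ≡.refl
signℕ-suc (suc (suc n)) = signℕ-suc n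

signℕ-+ : ∀ m n → signℕ (m ℕ.+ n) ≡ signℕ m ℤ.* signℕ n
signℕ-+ zero    n = ≡.sym (ℤₚ.*-identityˡ (signℕ n))
signℕ-+ (suc m) n = begin
  signℕ (suc (m ℕ.+ n))        ≡⟨ signℕ-suc (m ℕ.+ n) ⟩
  ℤ.- signℕ (m ℕ.+ n)          ≡⟨ ≡.cong ℤ.-_ (signℕ-+ m n) ⟩
  ℤ.- (signℕ m ℤ.* signℕ n)    ≡⟨ ℤₚ.neg-distribˡ-* (signℕ m) (signℕ n) ⟩
  (ℤ.- signℕ m) ℤ.* signℕ n    ≡⟨ ≡.cong (ℤ._* signℕ n) (≡.sym (signℕ-suc m)) ⟩
  signℕ (suc m) ℤ.* signℕ n    ∎
  where open ≡.≡-Reasoning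

inv? : ℕ → ℕ → ℕ
inv? x y = if does (y ℕ.<? x) then 1 else 0

count-<-∷ : ∀ x y ys → length (filter (ℕ._<? x) (y ∷ ys)) ≡ inv? x y ℕ.+ length (filter (ℕ._<? x) ys)
count-<-∷ x y ys with does (y ℕ.<? x)
... | true  = ≡.refl
... | false = ≡.refl

signℕ-inv? : ∀ x y → x ≢ y → signℕ (inv? x y) ≡ ℤ.- signℕ (inv? y x)
signℕ-inv? x y x≢y with ℕₚ.<-cmp x y
... | tri< x<y _ y≮x rewrite dec-true (x ℕ.<? y) x<y | dec-false (y ℕ.<? x) y≮x = ≡.refl
... | tri≈ _ x≡y _   = contradiction x≡y x≢y
... | tri> x≮y _ y<x rewrite dec-false (x ℕ.<? y) x≮y | dec-true (y ℕ.<? x) y<x = ≡.refl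

AllPairs-resp-↭ : ∀ {a} {A : Set a} {r} {_∼_ : A → A → Set r} → (∀ {x y} → x ∼ y → y ∼ x) →
                  ∀ {xs ys} → xs ↭ ys → AllPairs _∼_ xs → AllPairs _∼_ ys
AllPairs-resp-↭ s Perm.refl         ps                        = ps
AllPairs-resp-↭ s (Perm.prep x p)   (q ∷ ps)                  = Permₚ.All-resp-↭ p q ∷ AllPairs-resp-↭ s p ps
AllPairs-resp-↭ s (Perm.swap x y p) ((q ∷ q₁) ∷ (q₂ ∷ ps))    =
  (s q ∷ Permₚ.All-resp-↭ p q₂) ∷ Permₚ.All-resp-↭ p q₁ ∷ AllPairs-resp-↭ s p ps
AllPairs-resp-↭ s (Perm.trans p q)  ps                        = AllPairs-resp-↭ s q (AllPairs-resp-↭ s p ps)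

module Combinatorics where

  open import Data.Nat using (_<_; _+_; _*_; _∸_; _≤?_; _≟_; _<?_; _⊔_; z≤n; s≤s; z<s; s<s; s≤s⁻¹; NonZero)
  open import Data.Nat.Properties
  open import Data.Nat.DivMod using ([m+kn]%n≡m%n; m<n⇒m%n≡m; m/n≡1+[m∸n]/n)
  open import Data.List using (zip)
  open import Data.List.Relation.Unary.Any using (here; there)
  open import Data.List.Membership.Propositional using (_∈_)
  open import Data.List.Membership.Propositional.Properties using (∈-filter⁺; ∈-map⁺; ∈-upTo⁺)
  open Perm using (prep; swap)
  open Permₚ using (All-resp-↭; filter-↭; ↭-length; shift; ++⁺ʳ)
  open Equivalence using (to; from)
  open import Relation.Binary.PropositionalEquality hiding ([_])

  -- Counting in lists and sums over initial segments.

  count : ∀ {a p} {A : Set a} {P : Pred A p} → Decidable P → List A → ℕ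
  count P? xs = length (filter P? xs)

  module _ {a p} {A : Set a} {P : Pred A p} (P? : Decidable P) where

    count-accept : ∀ {x} xs → P x → count P? (x ∷ xs) ≡ suc (count P? xs)
    count-accept xs px = cong length (Listₚ.filter-accept P? px)

    count-reject : ∀ {x} xs → ¬ P x → count P? (x ∷ xs) ≡ count P? xs
    count-reject xs ¬px = cong length (Listₚ.filter-reject P? ¬px)

    count-none : ∀ {xs} → All (¬_ ∘ P) xs → count P? xs ≡ 0
    count-none ps = cong length (Listₚ.filter-none P? ps)

    count-++ : ∀ xs ys → count P? (xs ++ ys) ≡ count P? xs + count P? ys
    count-++ xs ys = trans (cong length (Listₚ.filter-++ P? xs ys)) (Listₚ.length-++ (filter P? xs))

    count-concat : ∀ (f : ℕ → List A) n → count P? (concat (applyUpTo f n)) ≡ sum (applyUpTo (λ i → count P? (f i)) n)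
    count-concat f zero    = refl
    count-concat f (suc n) = trans (count-++ (f 0) _) (cong (λ z → count P? (f 0) + z) (count-concat (f ∘ suc) n))

  length-concat : ∀ {A : Set} (f : ℕ → List A) k → length (concat (applyUpTo f k)) ≡ sum (applyUpTo (length ∘ f) k)
  length-concat f zero    = refl
  length-concat f (suc k) = trans (Listₚ.length-++ (f 0)) (cong (λ z → length (f 0) + z) (length-concat (f ∘ suc) k))

  sum-zero : ∀ (g : ℕ → ℕ) n → (∀ i → i < n → g i ≡ 0) → sum (applyUpTo g n) ≡ 0
  sum-zero g zero    z = refl
  sum-zero g (suc n) z = cong₂ _+_ (z 0 z<s) (sum-zero (g ∘ suc) n (λ i i<n → z (suc i) (s<s i<n)))

  sum-single : ∀ (g : ℕ → ℕ) n k → k < n → (∀ i → i < n → i ≢ k → g i ≡ 0) → sum (applyUpTo g n) ≡ g k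
  sum-single g (suc n) zero    _         z = trans
    (cong (λ z → g 0 + z) (sum-zero (g ∘ suc) n (λ i i<n → z (suc i) (s<s i<n) (λ ())))) (+-identityʳ (g 0))
  sum-single g (suc n) (suc k) (s<s k<n) z = cong₂ _+_ (z 0 z<s (λ ()))
    (sum-single (g ∘ suc) n k k<n (λ i i<n i≢k → z (suc i) (s<s i<n) (i≢k ∘ suc-injective)))

  sum-cong : ∀ {f g : ℕ → ℕ} n → (∀ i → i < n → f i ≡ g i) → sum (applyUpTo f n) ≡ sum (applyUpTo g n)
  sum-cong zero    eq = refl
  sum-cong (suc n) eq = cong₂ _+_ (eq 0 z<s) (sum-cong n (λ i i<n → eq (suc i) (s<s i<n)))

  count-≤-split : ∀ x xs → count (x ≤?_) xs ≡ count (x ≟_) xs + count (suc x ≤?_) xs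
  count-≤-split x []       = refl
  count-≤-split x (y ∷ xs) with <-cmp x y
  ... | tri< x<y x≢y _ = begin
    count (x ≤?_) (y ∷ xs)                               ≡⟨ count-accept (x ≤?_) xs (<⇒≤ x<y) ⟩
    suc (count (x ≤?_) xs)                               ≡⟨ cong suc (count-≤-split x xs) ⟩
    suc (count (x ≟_) xs + count (suc x ≤?_) xs)         ≡⟨ sym (+-suc _ _) ⟩
    count (x ≟_) xs + suc (count (suc x ≤?_) xs)         ≡⟨ sym (cong₂ _+_ (count-reject (x ≟_) xs x≢y) (count-accept (suc x ≤?_) xs x<y)) ⟩
    count (x ≟_) (y ∷ xs) + count (suc x ≤?_) (y ∷ xs)   ∎
    where open ≡-Reasoning
  ... | tri≈ x≮y x≡y _ = begin
    count (x ≤?_) (y ∷ xs)                               ≡⟨ count-accept (x ≤?_) xs (≤-reflexive x≡y) ⟩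
    suc (count (x ≤?_) xs)                               ≡⟨ cong suc (count-≤-split x xs) ⟩
    suc (count (x ≟_) xs + count (suc x ≤?_) xs)         ≡⟨ sym (cong₂ _+_ (count-accept (x ≟_) xs x≡y) (count-reject (suc x ≤?_) xs x≮y)) ⟩
    count (x ≟_) (y ∷ xs) + count (suc x ≤?_) (y ∷ xs)   ∎
    where open ≡-Reasoning
  ... | tri> x≮y x≢y y<x = begin
    count (x ≤?_) (y ∷ xs)                               ≡⟨ count-reject (x ≤?_) xs (<⇒≱ y<x) ⟩
    count (x ≤?_) xs                                     ≡⟨ count-≤-split x xs ⟩
    count (x ≟_) xs + count (suc x ≤?_) xs               ≡⟨ sym (cong₂ _+_ (count-reject (x ≟_) xs x≢y) (count-reject (suc x ≤?_) xs x≮y)) ⟩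
    count (x ≟_) (y ∷ xs) + count (suc x ≤?_) (y ∷ xs)   ∎
    where open ≡-Reasoning

  -- Decreasing lists, sorting and conjugate partitions.

  Decreasing StrictlyDecreasing : List ℕ → Set
  Decreasing         = AllPairs (λ x y → y ≤ x)
  StrictlyDecreasing = AllPairs (λ x y → y < x)

  insertDec-↭ : ∀ x xs → insertDec x xs ↭ x ∷ xs
  insertDec-↭ x []       = ↭-refl
  insertDec-↭ x (y ∷ ys) with does (y <? x)
  ... | true  = ↭-refl
  ... | false = ↭-trans (prep y (insertDec-↭ x ys)) (swap y x ↭-refl)

  sortDec-↭ : ∀ xs → sortDec xs ↭ xs
  sortDec-↭ []       = ↭-refl
  sortDec-↭ (x ∷ xs) = ↭-trans (insertDec-↭ x (sortDec xs)) (prep x (sortDec-↭ xs))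

  insertDec-decreasing : ∀ x {xs} → Decreasing xs → Decreasing (insertDec x xs)
  insertDec-decreasing x []                   = [] ∷ []
  insertDec-decreasing x {y ∷ ys} (y≥ ∷ ds) with y <? x
  ... | yes y<x rewrite dec-true (y <? x) y<x = (<⇒≤ y<x ∷ All.map (λ z≤y → ≤-trans z≤y (<⇒≤ y<x)) y≥) ∷ y≥ ∷ ds
  ... | no  y≮x rewrite dec-false (y <? x) y≮x = All-resp-↭ (↭-sym (insertDec-↭ x ys)) (≮⇒≥ y≮x ∷ y≥) ∷ insertDec-decreasing x ds

  sortDec-decreasing : ∀ xs → Decreasing (sortDec xs)
  sortDec-decreasing []       = []
  sortDec-decreasing (x ∷ xs) = insertDec-decreasing x (sortDec-decreasing xs)

  count-≟-∷ : ∀ x y xs → count (x ≟_) xs ≤ count (x ≟_) (y ∷ xs)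
  count-≟-∷ x y xs with x ≟ y
  ... | yes x≡y = ≤-trans (n≤1+n _) (≤-reflexive (sym (count-accept (x ≟_) xs x≡y)))
  ... | no  x≢y = ≤-reflexive (sym (count-reject (x ≟_) xs x≢y))

  count-≟-∈ : ∀ {x xs} → x ∈ xs → 1 ≤ count (x ≟_) xs
  count-≟-∈ {x} {y ∷ xs} (here x≡y) = ≤-trans (s≤s z≤n) (≤-reflexive (sym (count-accept (x ≟_) xs x≡y)))
  count-≟-∈ {x} {y ∷ xs} (there p)  = ≤-trans (count-≟-∈ p) (count-≟-∷ x y xs)

  strictlyDecreasing : ∀ {xs} → Decreasing xs → (∀ x → count (x ≟_) xs ≤ 1) → StrictlyDecreasing xs
  strictlyDecreasing []                  c≤1 = []
  strictlyDecreasing {x ∷ xs} (d ∷ ds) c≤1 =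
    All.tabulate (λ {y} y∈xs → ≤∧≢⇒< (All.lookup d y∈xs) (λ { refl → contradiction (c≤1 y)
      (<⇒≱ (≤-trans (s≤s (count-≟-∈ y∈xs)) (≤-reflexive (sym (count-accept (y ≟_) xs refl))))) }))
    ∷ strictlyDecreasing ds (λ y → ≤-trans (count-≟-∷ y x xs) (c≤1 y))

  part-≤ : ∀ {x xs} → All (_≤ x) xs → ∀ j → part xs j ≤ x
  part-≤ []       j             = z≤n
  part-≤ (p ∷ ps) zero          = z≤n
  part-≤ (p ∷ ps) (suc zero)    = p
  part-≤ (p ∷ ps) (suc (suc j)) = part-≤ ps (suc j)

  -- Both sides say that the cell in row `j` and column `k`, counted from 0, belongs to the diagram.
  -- As a Galois connection, conjugation becomes an exchange of indices and parts never have to be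
  -- computed.
  conj-galois : ∀ {μ} → Decreasing μ → ∀ j k → (suc k ≤ part μ (suc j)) ⇔ (suc j ≤ conjPart μ (suc k))
  conj-galois []                   j       k = mk⇔ (λ ()) (λ ())
  conj-galois {x ∷ xs} (d ∷ ds) j k with suc k ≤? x
  ... | no k≰x = mk⇔ (λ p → contradiction (≤-trans p (part-≤ (≤-refl ∷ d) (suc j))) k≰x)
                      (λ p → contradiction (≤-trans p (≤-reflexive (count-none (suc k ≤?_)
                               (k≰x ∷ All.map (λ y≤x k≤y → k≰x (≤-trans k≤y y≤x)) d)))) λ ())
  conj-galois {x ∷ xs} (d ∷ ds) zero    k | yes k≤x =
    mk⇔ (λ _ → ≤-trans (s≤s z≤n) (≤-reflexive (sym (count-accept (suc k ≤?_) xs k≤x)))) (λ _ → k≤x)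
  conj-galois {x ∷ xs} (d ∷ ds) (suc j) k | yes k≤x =
    mk⇔ (λ p → ≤-trans (s≤s (to (conj-galois ds j k) p)) (≤-reflexive (sym (count-accept (suc k ≤?_) xs k≤x))))
        (λ p → from (conj-galois ds j k) (s≤s⁻¹ (≤-trans p (≤-reflexive (count-accept (suc k ≤?_) xs k≤x)))))

  -- Beta-sets: conjugation and rank through bead counts.

  indexedFrom : ℕ → List ℕ → List (ℕ × ℕ)
  indexedFrom s []       = []
  indexedFrom s (x ∷ xs) = (s , x) ∷ indexedFrom (suc s) xs

  indexed-from : ∀ xs → indexed xs ≡ indexedFrom 1 xs
  indexed-from xs = trans (cong (λ l → zip l xs) (Listₚ.map-upTo suc (length xs))) (zip-from 1 suc (λ _ → refl) xs)
    where
    zip-from : ∀ s (f : ℕ → ℕ) → (∀ i → f i ≡ s + i) → ∀ xs → zip (applyUpTo f (length xs)) xs ≡ indexedFrom s xs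
    zip-from s f eq []       = refl
    zip-from s f eq (x ∷ xs) = cong₂ _∷_ (cong (_, x) (trans (eq 0) (+-identityʳ s)))
      (zip-from (suc s) (f ∘ suc) (λ i → trans (eq (suc i)) (+-suc s i)) xs)

  -- The partition with beta-set x₁ > … > x_m, when s = 1 and m is the length.
  shifted : ℕ → ℕ → List ℕ → List ℕ
  shifted m s xs = map (λ jb → proj₂ jb + proj₁ jb ∸ m) (indexedFrom s xs)

  -- Passing to the next bead lowers the value by at least one while the position grows by one, so
  -- the shifted values do not increase; truncation is monotone.
  shifted-≤ : ∀ m s {x xs} → All (_< x) xs → StrictlyDecreasing xs → All (_≤ x + s ∸ m) (shifted m (suc s) xs)
  shifted-≤ m s []                 []       = []
  shifted-≤ m s {x} {y ∷ ys} (y<x ∷ _) (d ∷ ds) =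
    y≤ ∷ All.map (λ z≤ → ≤-trans z≤ y≤) (shifted-≤ m (suc s) d ds)
    where
    y≤ : y + suc s ∸ m ≤ x + s ∸ m
    y≤ = ∸-monoˡ-≤ m (≤-trans (≤-reflexive (+-suc y s)) (+-monoˡ-≤ s y<x))

  shifted-decreasing : ∀ m s {xs} → StrictlyDecreasing xs → Decreasing (shifted m s xs)
  shifted-decreasing m s []       = []
  shifted-decreasing m s (d ∷ ds) = shifted-≤ m s d ds ∷ shifted-decreasing m (suc s) ds

  part-shifted : ∀ m s xs j → j < length xs → part (shifted m s xs) (suc j) ≡ part xs (suc j) + (s + j) ∸ m
  part-shifted m s (x ∷ xs) zero    _         = cong (λ k → x + k ∸ m) (sym (+-identityʳ s))
  part-shifted m s (x ∷ xs) (suc j) (s<s j<l) =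
    trans (part-shifted m (suc s) xs j j<l) (cong (λ k → part xs (suc j) + k ∸ m) (sym (+-suc s j)))

  part-beyond : ∀ xs j → length xs ≤ j → part xs (suc j) ≡ 0
  part-beyond []       j       _         = refl
  part-beyond (x ∷ xs) (suc j) (s≤s l≤j) = part-beyond xs j l≤j

  length-shifted : ∀ m s xs → length (shifted m s xs) ≡ length xs
  length-shifted m s []       = refl
  length-shifted m s (x ∷ xs) = cong suc (length-shifted m (suc s) xs)

  count-≤-length : ∀ {p} {P : Pred ℕ p} (P? : Decidable P) xs → count P? xs ≤ length xs
  count-≤-length P? xs = Listₚ.length-filter P? xs

  module BetaSet (m : ℕ) (b : List ℕ) (b-dec : StrictlyDecreasing b) (len : length b ≡ m) where

    -- All facts about `μ` are read off this counting function: it depends only on the multiset of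
    -- beads, so it can be computed without sorting them.
    N : ℕ → ℕ
    N x = count (x ≤?_) b

    μ : List ℕ
    μ = shifted m 1 b

    private
      weaken : ∀ {xs} → StrictlyDecreasing xs → Decreasing xs
      weaken []       = []
      weaken (d ∷ ds) = All.map <⇒≤ d ∷ weaken ds

      m<x+k⇒ : ∀ {k j x} → j < m → (suc k ≤ x + suc j ∸ m) ⇔ (suc k + m ∸ suc j ≤ x)
      m<x+k⇒ {k} {j} {x} j<m = mk⇔
        (λ p → ≤-trans (∸-monoˡ-≤ (suc j) (m≤n∸o⇒m+o≤n p)) (≤-reflexive (m+n∸n≡m x (suc j))))
        (λ p → m+n≤o⇒m≤o∸n (suc k) (≤-trans (m≤n+m∸n (suc k + m) (suc j)) (≤-trans (+-monoʳ-≤ (suc j) p) (≤-reflexive (+-comm (suc j) x)))))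
        where
        m≤n∸o⇒m+o≤n : ∀ {y} → suc k ≤ y ∸ m → suc k + m ≤ y
        m≤n∸o⇒m+o≤n {y} p = ≤-trans (+-monoˡ-≤ m p) (≤-reflexive (m∸n+n≡m (<⇒≤ (m<n∸o⇒ p))))
          where
          m<n∸o⇒ : suc k ≤ y ∸ m → m < y
          m<n∸o⇒ p = m∸n≢0⇒n<m (λ eq → contradiction (≤-trans p (≤-reflexive eq)) λ ())

    -- A part is its bead lowered by `m ∸ suc j`, so it reaches `suc k` when the bead reaches
    -- `suc k + m ∸ suc j`; since the beads decrease, this happens when at least `suc j` beads do.
    μ-galois : ∀ j k → (suc k ≤ part μ (suc j)) ⇔ (suc j ≤ N (suc k + m ∸ suc j))
    μ-galois j k with j <? length b
    ... | no j≮l = mk⇔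
          (λ p → contradiction (≤-trans p (≤-reflexive (part-beyond μ j (≤-trans (≤-reflexive (length-shifted m 1 b)) (≮⇒≥ j≮l))))) λ ())
          (λ p → contradiction (≤-trans p (count-≤-length _ b)) j≮l)
    ... | yes j<l with suc k + m ∸ suc j in eq
    -- `conj-galois` needs a positive threshold, which `j < m` provides.
    ...   | zero  = contradiction (sym eq) (<⇒≢ (m<n⇒0<n∸m (≤-trans (subst (j <_) len j<l) (m≤n+m m k))))
    ...   | suc x = mk⇔ fwd bwd
      where
      part≡ : part μ (suc j) ≡ part b (suc j) + suc j ∸ m
      part≡ = part-shifted m 1 b j j<l
      j<m : j < m
      j<m = subst (j <_) len j<l
      fwd : suc k ≤ part μ (suc j) → suc j ≤ N (suc x)
      fwd p = to (conj-galois (weaken b-dec) j x)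
        (subst (_≤ part b (suc j)) eq (to (m<x+k⇒ j<m) (≤-trans p (≤-reflexive part≡))))
      bwd : suc j ≤ N (suc x) → suc k ≤ part μ (suc j)
      bwd p = ≤-trans (from (m<x+k⇒ j<m)
        (subst (_≤ part b (suc j)) (sym eq) (from (conj-galois (weaken b-dec) j x) p))) (≤-reflexive (sym part≡))

    μ-decreasing : Decreasing μ
    μ-decreasing = shifted-decreasing m 1 b-dec

    -- Invariance of the diagram under transposition, with cells expressed through `N`. One
    -- implication suffices, as `j` and `k` range over all pairs.
    Symmetric : Set
    Symmetric = ∀ j k → suc j ≤ N (suc k + m ∸ suc j) → suc k ≤ N (suc j + m ∸ suc k)

    selfConj⇒symmetric : SelfConj μ → Symmetric
    selfConj⇒symmetric sc j k p = to (μ-galois k j)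
      (≤-trans (to (conj-galois μ-decreasing j k) (from (μ-galois j k) p)) (≤-reflexive (sym (sc k))))

    symmetric⇒selfConj : Symmetric → SelfConj μ
    symmetric⇒selfConj sym′ k = ≤-antisym (lower _ _ fwd) (lower _ _ bwd)
      where
      lower : ∀ x y → (∀ j → suc j ≤ x → suc j ≤ y) → x ≤ y
      lower zero    y f = z≤n
      lower (suc x) y f = f x ≤-refl
      fwd : ∀ j → suc j ≤ part μ (suc k) → suc j ≤ conjPart μ (suc k)
      fwd j p = to (conj-galois μ-decreasing j k) (from (μ-galois j k) (sym′ k j (to (μ-galois k j) p)))
      bwd : ∀ j → suc j ≤ conjPart μ (suc k) → suc j ≤ part μ (suc k)
      bwd j p = from (μ-galois k j) (sym′ j k (to (μ-galois j k) (from (conj-galois μ-decreasing j k) p)))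

    -- Equivalently, x ↦ 2m − 1 − x exchanges the beta-set with its complement (all negative
    -- integers being counted in the beta-set).
    Reflected : Set
    Reflected = ∀ d → d ≤ m → N (m + d) + d ≡ N (m ∸ d)

    N≤m : ∀ x → N x ≤ m
    N≤m x = subst (N x ≤_) len (count-≤-length (x ≤?_) b)

    N-antitone : ∀ x d → N (x + d) ≤ N x
    N-antitone x zero    = ≤-reflexive (cong N (+-identityʳ x))
    N-antitone x (suc d) = ≤-trans (≤-trans (≤-reflexive (cong N (+-suc x d)))
      (≤-trans (m≤n+m (N (suc (x + d))) (count ((x + d) ≟_) b)) (≤-reflexive (sym (count-≤-split (x + d) b))))) (N-antitone x d)

    -- For cells whose coordinates differ by `d`, the two thresholds are `m + d` and `m ∸ d`, mirror
    -- images about `m`, and the required counts differ by exactly `d`.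
    reflected⇒symmetric : Reflected → Symmetric
    reflected⇒symmetric r j k p with ≤-total j k
    ... | inj₁ j≤k = go (k ∸ j) (m+[n∸m]≡n j≤k)
      where
      go : ∀ d → j + d ≡ k → suc k ≤ N (suc j + m ∸ suc k)
      go d refl = result
        where
        eq₁ : j + d + m ∸ j ≡ m + d
        eq₁ = trans (cong (_∸ j) (+-assoc j d m)) (trans (m+n∸m≡n j (d + m)) (+-comm d m))
        eq₂ : j + m ∸ (j + d) ≡ m ∸ d
        eq₂ = [m+n]∸[m+o]≡n∸o j m d
        p′ : suc j ≤ N (m + d)
        p′ = subst (λ x → suc j ≤ N x) eq₁ p
        result : suc (j + d) ≤ N (j + m ∸ (j + d))
        result rewrite eq₂ with d ≤? m
        ... | yes d≤m = ≤-trans (+-monoˡ-≤ d p′) (≤-reflexive (r d d≤m))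
        -- `Reflected` at the distance `m` leaves no bead at `m + m` or above, because `N` never
        -- exceeds `m`; hence there is no such cell.
        ... | no  d≰m = contradiction (≤-trans p′ (≤-trans N[m+d]≤ (≤-reflexive N2m))) λ ()
          where
          N2m : N (m + m) ≡ 0
          N2m = n≤0⇒n≡0 (+-cancelʳ-≤ m (N (m + m)) 0 (≤-trans (≤-reflexive (r m ≤-refl)) (N≤m (m ∸ m))))
          N[m+d]≤ : N (m + d) ≤ N (m + m)
          N[m+d]≤ = subst (λ x → N x ≤ N (m + m)) (trans (+-assoc m m (d ∸ m)) (cong (λ z → m + z) (m+[n∸m]≡n (<⇒≤ (≰⇒> d≰m))))) (N-antitone (m + m) (d ∸ m))
    ... | inj₂ k≤j = go (j ∸ k) (m+[n∸m]≡n k≤j)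
      where
      go : ∀ d → k + d ≡ j → suc k ≤ N (suc j + m ∸ suc k)
      go d refl = subst (λ x → suc k ≤ N x) (sym eq₁) result
        where
        eq₁ : k + d + m ∸ k ≡ m + d
        eq₁ = trans (cong (_∸ k) (+-assoc k d m)) (trans (m+n∸m≡n k (d + m)) (+-comm d m))
        p′ : suc (k + d) ≤ N (m ∸ d)
        p′ = subst (λ x → suc (k + d) ≤ N x) ([m+n]∸[m+o]≡n∸o k m d) p
        result : suc k ≤ N (m + d)
        result with d ≤? m
        ... | yes d≤m = +-cancelʳ-≤ d (suc k) (N (m + d)) (≤-trans p′ (≤-reflexive (sym (r d d≤m))))
        ... | no  d≰m = contradiction (≤-trans (≤-trans (m≤n+m d k) (≤-trans (n≤1+n _) p′)) (N≤m (m ∸ d))) d≰m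

    module _ (c≤1 : ∀ x → count (x ≟_) b ≤ 1) where

      -- Distinct beads below `x` number at most `x`, so the others, counted by `N x`, are at least
      -- `m ∸ x`.
      N+x≥m : ∀ x → m ≤ N x + x
      N+x≥m zero    = ≤-reflexive (trans (sym len) (trans (cong length (sym (Listₚ.filter-all (0 ≤?_) (All.universal (λ _ → z≤n) b)))) (sym (+-identityʳ (N 0)))))
      N+x≥m (suc x) = ≤-trans (N+x≥m x) (≤-trans (+-monoˡ-≤ x (≤-trans (≤-reflexive (count-≤-split x b)) (+-monoˡ-≤ (N (suc x)) (c≤1 x))))
        (≤-reflexive (sym (+-suc (N (suc x)) x))))

      -- Both counts are compared unit by unit: the cell `(a , a + d)` yields one inequality and its
      -- transpose the other. Distinctness of the beads enters through `d≤N`, which settles the case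
      -- 0 of `upper` and makes the subtraction in `lower` exact.
      symmetric⇒reflected : Symmetric → Reflected
      symmetric⇒reflected s d d≤m = ≤-antisym
        (upper (N (m + d)) ≤-refl)
        (≤-trans (≤-reflexive (sym (m∸n+n≡m d≤N))) (+-monoˡ-≤ d (lower (N (m ∸ d) ∸ d) ≤-refl)))
        where
        d≤N : d ≤ N (m ∸ d)
        d≤N = +-cancelʳ-≤ (m ∸ d) d (N (m ∸ d)) (≤-trans (≤-reflexive (m+[n∸m]≡n d≤m)) (N+x≥m (m ∸ d)))
        upper : ∀ a → a ≤ N (m + d) → a + d ≤ N (m ∸ d)
        upper zero    _ = d≤N
        upper (suc a) p = subst (λ x → suc (a + d) ≤ N x) ([m+n]∸[m+o]≡n∸o a m d)
          (s a (a + d) (subst (λ x → suc a ≤ N x) (sym (trans (cong (_∸ a) (+-assoc a d m)) (trans (m+n∸m≡n a (d + m)) (+-comm d m)))) p))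
        lower : ∀ a → a ≤ N (m ∸ d) ∸ d → a ≤ N (m + d)
        lower zero    _ = z≤n
        lower (suc a) p = subst (λ x → suc a ≤ N x) (trans (cong (_∸ a) (+-assoc a d m)) (trans (m+n∸m≡n a (d + m)) (+-comm d m)))
          (s (a + d) a (subst (λ x → suc (a + d) ≤ N x) (sym ([m+n]∸[m+o]≡n∸o a m d))
            (≤-trans (+-monoˡ-≤ d p) (≤-reflexive (m∸n+n≡m d≤N)))))

    -- On the diagonal the threshold in `μ-galois` is `m` for every cell, so the side of the Durfee
    -- square is the number of beads at or above `m`.
    rank≡N : rank μ ≡ N m
    rank≡N = ≤-antisym (foldr-⊔-≤ (filter rank? range) (All.map (λ {k} → below k) (Allₚ.all-filter rank? range))) (above (N m) (N≤m m) ≤-refl)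
      where
      rank? : ∀ k → Dec (k ≤ part μ k)
      rank? k = k ≤? part μ k
      range : List ℕ
      range = map suc (upTo (length μ))
      foldr-⊔-≤ : ∀ {r} xs → All (_≤ r) xs → foldr _⊔_ 0 xs ≤ r
      foldr-⊔-≤ []       []       = z≤n
      foldr-⊔-≤ (x ∷ xs) (p ∷ ps) = ⊔-lub p (foldr-⊔-≤ xs ps)
      ∈⇒≤ : ∀ {x xs} → x ∈ xs → x ≤ foldr _⊔_ 0 xs
      ∈⇒≤ {x} {y ∷ xs} (here refl) = m≤m⊔n x _
      ∈⇒≤ {x} {y ∷ xs} (there p)   = ≤-trans (∈⇒≤ p) (m≤n⊔m y _)
      diagonal : ∀ k → (suc k ≤ part μ (suc k)) ⇔ (suc k ≤ N m)
      diagonal k = subst (λ x → (suc k ≤ part μ (suc k)) ⇔ (suc k ≤ N x)) (m+n∸m≡n k m) (μ-galois k k)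
      below : ∀ k → k ≤ part μ k → k ≤ N m
      below zero    _ = z≤n
      below (suc k) p = to (diagonal k) p
      above : ∀ r → r ≤ m → r ≤ N m → r ≤ foldr _⊔_ 0 (filter rank? range)
      above zero    _   _ = z≤n
      above (suc r) r<m p = ∈⇒≤ (∈-filter⁺ rank? (∈-map⁺ suc (∈-upTo⁺ (subst (r <_) (sym (trans (length-shifted m 1 b) len)) r<m)))
        (from (diagonal r) p))

  -- The beads of the core.

  ∸-suc : ∀ {d t} → d < t → t ∸ d ≡ suc (t ∸ suc d)
  ∸-suc = +-∸-assoc 1

  -- ind j n = [j < n]
  ind : ℕ → ℕ → ℕ
  ind _       zero    = 0
  ind zero    (suc _) = 1
  ind (suc j) (suc n) = ind j n

  ind≤1 : ∀ j n → ind j n ≤ 1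
  ind≤1 j       zero    = z≤n
  ind≤1 zero    (suc _) = ≤-refl
  ind≤1 (suc j) (suc n) = ind≤1 j n

  pair⇒ind : ∀ a b → a + b ≡ 2 → ind 1 a + ind 0 b ≡ 1
  pair⇒ind 0 2 refl = refl
  pair⇒ind 1 1 refl = refl
  pair⇒ind 2 0 refl = refl

  -- For opposite runners with `a` and `b` beads, the first two hypotheses say that of each two
  -- mirror positions, one on level 1 and one on level 0, exactly one is occupied; the last two
  -- exclude a third bead.
  ind⇒pair : ∀ a b → ind 1 a + ind 0 b ≡ 1 → ind 1 b + ind 0 a ≡ 1 → ind 2 a ≡ 0 → ind 2 b ≡ 0 → a + b ≡ 2
  ind⇒pair 0 2 _ _ _ _ = refl
  ind⇒pair 1 1 _ _ _ _ = refl
  ind⇒pair 2 0 _ _ _ _ = refl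
  ind⇒pair 0 0 () _ _ _
  ind⇒pair 0 1 _ () _ _
  ind⇒pair 0 (suc (suc (suc b))) _ _ _ ()
  ind⇒pair 1 0 () _ _ _
  ind⇒pair 1 (suc (suc b)) _ () _ _
  ind⇒pair 2 (suc b) () _ _ _
  ind⇒pair (suc (suc (suc a))) b _ _ () _

  count-applyUpTo : ∀ (g : ℕ → ℕ) → (∀ {i j} → g i ≡ g j → i ≡ j) → ∀ j n → count (g j ≟_) (applyUpTo g n) ≡ ind j n
  count-applyUpTo g inj j       zero    = refl
  count-applyUpTo g inj zero    (suc n) = trans (count-accept (g 0 ≟_) (applyUpTo (g ∘ suc) n) refl)
    (cong suc (count-none (g 0 ≟_) (Allₚ.applyUpTo⁺₂ (g ∘ suc) n (λ i eq → 0≢1+n (inj eq)))))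
  count-applyUpTo g inj (suc j) (suc n) = trans (count-reject (g (suc j) ≟_) (applyUpTo (g ∘ suc) n) (λ eq → 1+n≢0 (inj eq)))
    (count-applyUpTo (g ∘ suc) (suc-injective ∘ inj) j n)

  applyUpTo-cong : ∀ {a} {A : Set a} {f g : ℕ → A} → (∀ i → f i ≡ g i) → ∀ n → applyUpTo f n ≡ applyUpTo g n
  applyUpTo-cong eq zero    = refl
  applyUpTo-cong eq (suc n) = cong₂ _∷_ (eq 0) (applyUpTo-cong (eq ∘ suc) n)

  module Core (t : ℕ) .{{_ : NonZero t}} (n : ℕ → ℕ) (sum-n : sum (applyUpTo n t) ≡ t) where

    beads : List ℕ
    beads = concatMap (λ i → map (λ j → t * j + i) (upTo (n i))) (upTo t)

    private
      block : ℕ → List ℕ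
      block i = applyUpTo (λ j → t * j + i) (n i)

      beads≡ : beads ≡ concat (applyUpTo block t)
      beads≡ = cong concat (trans (Listₚ.map-upTo _ t) (applyUpTo-cong (λ i → Listₚ.map-upTo (λ j → t * j + i) (n i)) t))

      [tj+i]%t : ∀ j {i} → i < t → (t * j + i) % t ≡ i
      [tj+i]%t j {i} i<t = trans (cong (_% t) (trans (+-comm (t * j) i) (cong (λ z → i + z) (*-comm t j))))
        (trans ([m+kn]%n≡m%n i j t) (m<n⇒m%n≡m i<t))

      count-bead : ∀ j i → i < t → count ((t * j + i) ≟_) beads ≡ ind j (n i)
      count-bead j i i<t = begin
        count (x ≟_) beads                                     ≡⟨ cong (count (x ≟_)) beads≡ ⟩
        count (x ≟_) (concat (applyUpTo block t))              ≡⟨ count-concat (x ≟_) block t ⟩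
        sum (applyUpTo (λ i → count (x ≟_) (block i)) t)       ≡⟨ sum-single (λ i → count (x ≟_) (block i)) t i i<t other ⟩
        count (x ≟_) (block i)                                 ≡⟨ count-applyUpTo (λ j → t * j + i) (λ eq → *-cancelˡ-≡ _ _ t (+-cancelʳ-≡ i _ _ eq)) j (n i) ⟩
        ind j (n i)                                            ∎
        where
        open ≡-Reasoning
        x : ℕ
        x = t * j + i
        other : ∀ i′ → i′ < t → i′ ≢ i → count (x ≟_) (block i′) ≡ 0
        other i′ i′<t i′≢i = count-none (x ≟_) (Allₚ.applyUpTo⁺₂ _ (n i′) (λ j′ eq →
          i′≢i (trans (sym ([tj+i]%t j′ i′<t)) (trans (cong (_% t) (sym eq)) ([tj+i]%t j i<t)))))

      count-bead≤1 : ∀ x → count (x ≟_) beads ≤ 1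
      count-bead≤1 x = subst (λ y → count (y ≟_) beads ≤ 1) (sym eq)
        (≤-trans (≤-reflexive (count-bead (x / t) (x % t) (m%n<n x t))) (ind≤1 (x / t) (n (x % t))))
        where
        eq : x ≡ t * (x / t) + x % t
        eq = trans (m≡m%n+[m/n]*n x t) (trans (+-comm (x % t) _) (cong (_+ x % t) (*-comm (x / t) t)))

      length-beads : length beads ≡ t
      length-beads = trans (cong length beads≡) (trans (length-concat block t)
        (trans (sum-cong t (λ i _ → Listₚ.length-applyUpTo (λ j → t * j + i) (n i))) sum-n))

      count-sort : ∀ {P : ℕ → Set} (P? : Decidable P) → count P? (sortDec beads) ≡ count P? beads
      count-sort P? = ↭-length (filter-↭ P? (sortDec-↭ beads))

      sort≤1 : ∀ x → count (x ≟_) (sortDec beads) ≤ 1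
      sort≤1 x = ≤-trans (≤-reflexive (count-sort (x ≟_))) (count-bead≤1 x)

    open BetaSet t (sortDec beads) (strictlyDecreasing (sortDec-decreasing beads) sort≤1)
                 (trans (↭-length (sortDec-↭ beads)) length-beads)

    coreOf : List ℕ
    coreOf = map (λ jb → proj₂ jb + proj₁ jb ∸ t) (indexed (sortDec beads))

    private
      coreOf≡μ : coreOf ≡ μ
      coreOf≡μ = cong (map _) (indexed-from (sortDec beads))

      N-step : ∀ j i → i < t → N (t * j + i) ≡ ind j (n i) + N (suc (t * j + i))
      N-step j i i<t = trans (count-≤-split (t * j + i) (sortDec beads))
        (cong (_+ N (suc (t * j + i))) (trans (count-sort ((t * j + i) ≟_)) (count-bead j i i<t)))

      N-upper : ∀ d → d < t → N (t + d) ≡ ind 1 (n d) + N (t + suc d)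
      N-upper d d<t = subst (λ k → N (k + d) ≡ ind 1 (n d) + N (t + suc d)) (*-identityʳ t)
        (trans (N-step 1 d d<t) (cong (λ k → ind 1 (n d) + N k) (trans (cong (λ k → suc (k + d)) (*-identityʳ t)) (sym (+-suc t d)))))

      N-lower : ∀ d → d < t → N (t ∸ suc d) ≡ ind 0 (n (t ∸ suc d)) + N (t ∸ d)
      N-lower d d<t = subst (λ k → N (k + (t ∸ suc d)) ≡ ind 0 (n (t ∸ suc d)) + N (t ∸ d)) (*-zeroʳ t)
        (trans (N-step 0 (t ∸ suc d) (∸-monoʳ-< z<s d<t))
          (cong (λ k → ind 0 (n (t ∸ suc d)) + N k) (trans (cong (λ k → suc (k + (t ∸ suc d))) (*-zeroʳ t)) (sym (∸-suc d<t)))))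

    -- `d` and `t ∸ suc d` are exchanged by the reflection; at the middle runner of an odd `t` the
    -- equation forces a single bead.
    Paired : Set
    Paired = ∀ d → d < t → n d + n (t ∸ suc d) ≡ 2

    private
      -- Isolates the occupation of the mirror positions `t + d` and `t ∸ suc d` as one summand, so
      -- that one direction of the equivalence substitutes its value 1 and the other recovers it by
      -- cancellation.
      exchange : ∀ d → d < t →
        (ind 1 (n d) + ind 0 (n (t ∸ suc d))) + (N (t + suc d) + d) ≡ ind 0 (n (t ∸ suc d)) + (N (t + d) + d)
      exchange d d<t = begin
        (ind 1 (n d) + c′) + (N (t + suc d) + d)    ≡⟨ cong (_+ (N (t + suc d) + d)) (+-comm (ind 1 (n d)) c′) ⟩
        (c′ + ind 1 (n d)) + (N (t + suc d) + d)    ≡⟨ +-assoc c′ _ _ ⟩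
        c′ + (ind 1 (n d) + (N (t + suc d) + d))    ≡⟨ cong (λ z → c′ + z) (sym (+-assoc (ind 1 (n d)) _ d)) ⟩
        c′ + ((ind 1 (n d) + N (t + suc d)) + d)    ≡⟨ cong (λ k → c′ + (k + d)) (sym (N-upper d d<t)) ⟩
        c′ + (N (t + d) + d)                        ∎
        where
        open ≡-Reasoning
        c′ : ℕ
        c′ = ind 0 (n (t ∸ suc d))

      -- Induction on `d`: one step removes the position `t + d` from the left count, adds
      -- `t ∸ suc d` to the right one and adds 1 on the left. The balance persists when exactly one
      -- of the two positions is occupied.
      paired⇒reflected : Paired → Reflected
      paired⇒reflected pr zero    _   = trans (+-identityʳ (N (t + 0))) (cong N (+-identityʳ t))
      paired⇒reflected pr (suc d) d<t = begin
        N (t + suc d) + suc d                                                ≡⟨ +-suc (N (t + suc d)) d ⟩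
        1 + (N (t + suc d) + d)                                              ≡⟨ cong (_+ (N (t + suc d) + d)) (sym (pair⇒ind (n d) _ (pr d d<t))) ⟩
        (ind 1 (n d) + ind 0 (n (t ∸ suc d))) + (N (t + suc d) + d)          ≡⟨ exchange d d<t ⟩
        ind 0 (n (t ∸ suc d)) + (N (t + d) + d)                              ≡⟨ cong (λ z → ind 0 (n (t ∸ suc d)) + z) (paired⇒reflected pr d (<⇒≤ d<t)) ⟩
        ind 0 (n (t ∸ suc d)) + N (t ∸ d)                                    ≡⟨ sym (N-lower d d<t) ⟩
        N (t ∸ suc d)                                                        ∎
        where open ≡-Reasoning

      reflected⇒paired : Reflected → Paired
      reflected⇒paired r d d<t = ind⇒pair (n d) (n (t ∸ suc d)) (ones d d<t)
        (subst (λ k → ind 1 (n (t ∸ suc d)) + ind 0 (n k) ≡ 1)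
               (trans (cong (t ∸_) (sym (∸-suc d<t))) (m∸[m∸n]≡n (<⇒≤ d<t))) (ones (t ∸ suc d) d′<t))
        (twos d d<t) (twos (t ∸ suc d) d′<t)
        where
        d′<t : t ∸ suc d < t
        d′<t = ∸-monoʳ-< z<s d<t
        ones : ∀ d → d < t → ind 1 (n d) + ind 0 (n (t ∸ suc d)) ≡ 1
        ones d d<t = +-cancelʳ-≡ (N (t + suc d) + d) _ _ (begin
          (ind 1 (n d) + ind 0 (n (t ∸ suc d))) + (N (t + suc d) + d)    ≡⟨ exchange d d<t ⟩
          ind 0 (n (t ∸ suc d)) + (N (t + d) + d)                        ≡⟨ cong (λ z → ind 0 (n (t ∸ suc d)) + z) (r d (<⇒≤ d<t)) ⟩
          ind 0 (n (t ∸ suc d)) + N (t ∸ d)                              ≡⟨ sym (N-lower d d<t) ⟩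
          N (t ∸ suc d)                                                  ≡⟨ sym (r (suc d) d<t) ⟩
          N (t + suc d) + suc d                                          ≡⟨ +-suc (N (t + suc d)) d ⟩
          1 + (N (t + suc d) + d)                                        ∎)
          where open ≡-Reasoning
        -- Reflection at the distance `t` compares with at most `t` beads in all, so nothing lies at
        -- 2t or beyond and no runner has a third bead.
        N[2t] : N (t + t) ≡ 0
        N[2t] = n≤0⇒n≡0 (+-cancelʳ-≤ t (N (t + t)) 0 (≤-trans (≤-reflexive (r t ≤-refl)) (N≤m (t ∸ t))))
        twos : ∀ d → d < t → ind 2 (n d) ≡ 0
        twos d d<t = m+n≡0⇒m≡0 (ind 2 (n d)) (trans (sym (N-step 2 d d<t))
          (n≤0⇒n≡0 (≤-trans (≤-trans (≤-reflexive (cong (λ k → N (k + d)) (trans (*-comm t 2) (cong (λ z → t + z) (+-identityʳ t))))) (N-antitone (t + t) d)) (≤-reflexive N[2t]))))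

    selfConj⇔paired : SelfConj coreOf ⇔ Paired
    selfConj⇔paired = mk⇔
      (λ sc → reflected⇒paired (symmetric⇒reflected sort≤1 (selfConj⇒symmetric (subst SelfConj coreOf≡μ sc))))
      (λ pr → subst SelfConj (sym coreOf≡μ) (symmetric⇒selfConj (reflected⇒symmetric (paired⇒reflected pr))))

    -- Exactly the lowest bead of a runner lies below `t`, so a nonempty runner contributes all but
    -- one of its beads; truncation covers the empty runner.
    rank-coreOf : rank coreOf ≡ sum (applyUpTo (λ i → n i ∸ 1) t)
    rank-coreOf = begin
      rank coreOf                                           ≡⟨ cong rank coreOf≡μ ⟩
      rank μ                                                ≡⟨ rank≡N ⟩
      N t                                                   ≡⟨ count-sort (t ≤?_) ⟩
      count (t ≤?_) beads                                   ≡⟨ cong (count (t ≤?_)) beads≡ ⟩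
      count (t ≤?_) (concat (applyUpTo block t))            ≡⟨ count-concat (t ≤?_) block t ⟩
      sum (applyUpTo (λ i → count (t ≤?_) (block i)) t)     ≡⟨ sum-cong t (λ i i<t → above i i<t (n i)) ⟩
      sum (applyUpTo (λ i → n i ∸ 1) t)                     ∎
      where
      open ≡-Reasoning
      above : ∀ i → i < t → ∀ k → count (t ≤?_) (applyUpTo (λ j → t * j + i) k) ≡ k ∸ 1
      above i i<t zero    = refl
      above i i<t (suc k) = trans
        (count-reject (t ≤?_) (applyUpTo (λ j → t * suc j + i) k) (<⇒≱ (≤-trans (≤-reflexive (cong (λ z → suc (z + i)) (*-zeroʳ t))) i<t)))
        (trans (cong length (Listₚ.filter-all (t ≤?_) (Allₚ.applyUpTo⁺₂ (λ j → t * suc j + i) k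
                 (λ j → ≤-trans (m≤m*n t (suc j)) (m≤m+n (t * suc j) i)))))
               (Listₚ.length-applyUpTo (λ j → t * suc j + i) k))

  -- Distribution of a list into residue classes.

  filter-split : ∀ {A : Set} {P : A → Set} (P? : Decidable P) xs → ∃ λ rest → xs ↭ filter P? xs ++ rest
  filter-split P? []       = [] , ↭-refl
  filter-split P? (x ∷ xs) with rest , p ← filter-split P? xs | does (P? x)
  ... | true  = rest , prep x p
  ... | false = x ∷ rest , ↭-trans (prep x p) (↭-sym (shift x (filter P? xs) rest))

  module _ {A : Set} (key : A → ℕ) where

    bucket : ℕ → List A → List A
    bucket i = filter (λ x → key x ≟ i)

    private
      below : ℕ → List A → List A
      below k = filter (λ x → key x <? k)

      below-suc : ∀ k xs → below (suc k) xs ↭ below k xs ++ bucket k xs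
      below-suc k []       = ↭-refl
      below-suc k (x ∷ xs) with <-cmp (key x) k
      ... | tri< lt ne _
        rewrite Listₚ.filter-accept (λ x → key x <? suc k) {x} {xs} (m<n⇒m<1+n lt)
              | Listₚ.filter-accept (λ x → key x <? k) {x} {xs} lt
              | Listₚ.filter-reject (λ x → key x ≟ k) {x} {xs} ne = prep x (below-suc k xs)
      ... | tri≈ nlt eq _
        rewrite Listₚ.filter-accept (λ x → key x <? suc k) {x} {xs} (s≤s (≤-reflexive eq))
              | Listₚ.filter-reject (λ x → key x <? k) {x} {xs} nlt
              | Listₚ.filter-accept (λ x → key x ≟ k) {x} {xs} eq =
                ↭-trans (prep x (below-suc k xs)) (↭-sym (shift x (below k xs) (bucket k xs)))
      ... | tri> nlt ne gt
        rewrite Listₚ.filter-reject (λ x → key x <? suc k) {x} {xs} (<⇒≱ (s≤s gt))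
              | Listₚ.filter-reject (λ x → key x <? k) {x} {xs} nlt
              | Listₚ.filter-reject (λ x → key x ≟ k) {x} {xs} ne = below-suc k xs

      below-buckets : ∀ xs k → below k xs ↭ concat (applyUpTo (λ i → bucket i xs) k)
      below-buckets xs zero    = ↭-reflexive (Listₚ.filter-none (λ x → key x <? 0) (All.universal (λ _ ()) xs))
      below-buckets xs (suc k) = ↭-trans (below-suc k xs) (↭-trans (++⁺ʳ (bucket k xs) (below-buckets xs k)) (↭-reflexive (begin
        concat (applyUpTo bs k) ++ bs k               ≡⟨ cong (concat (applyUpTo bs k) ++_) (sym (Listₚ.++-identityʳ (bs k))) ⟩
        concat (applyUpTo bs k) ++ concat [ bs k ]    ≡⟨ Listₚ.concat-++ (applyUpTo bs k) [ bs k ] ⟩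
        concat (applyUpTo bs k ++ [ bs k ])           ≡⟨ cong concat (Listₚ.applyUpTo-∷ʳ bs k) ⟩
        concat (applyUpTo bs (suc k))                 ∎)))
        where
        open ≡-Reasoning
        bs : ℕ → List A
        bs i = bucket i xs

    buckets-↭ : ∀ t xs → All (λ x → key x < t) xs → xs ↭ concat (applyUpTo (λ i → bucket i xs) t)
    buckets-↭ t xs ps = ↭-trans (↭-reflexive (sym (Listₚ.filter-all (λ x → key x <? t) ps))) (below-buckets xs t)

  count-⊎ : ∀ (key : ℕ → ℕ) i j → i ≢ j → ∀ xs →
    count (λ x → (key x ≟ i) ⊎-dec (key x ≟ j)) xs ≡ count (λ x → key x ≟ i) xs + count (λ x → key x ≟ j) xs
  count-⊎ key i j i≢j []       = refl
  count-⊎ key i j i≢j (x ∷ xs) with key x ≟ i | key x ≟ j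
  ... | yes p | yes q = contradiction (trans (sym p) q) i≢j
  ... | yes p | no q  = trans (count-accept (λ x → (key x ≟ i) ⊎-dec (key x ≟ j)) xs (inj₁ p)) (trans (cong suc (count-⊎ key i j i≢j xs))
    (sym (cong₂ _+_ (count-accept (λ x → key x ≟ i) xs p) (count-reject (λ x → key x ≟ j) xs q))))
  ... | no p  | yes q = trans (count-accept (λ x → (key x ≟ i) ⊎-dec (key x ≟ j)) xs (inj₂ q)) (trans (cong suc (count-⊎ key i j i≢j xs))
    (trans (sym (+-suc _ _)) (sym (cong₂ _+_ (count-reject (λ x → key x ≟ i) xs p) (count-accept (λ x → key x ≟ j) xs q)))))
  ... | no p  | no q  = trans (count-reject (λ x → (key x ≟ i) ⊎-dec (key x ≟ j)) xs (λ { (inj₁ r) → p r ; (inj₂ r) → q r }))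
    (trans (count-⊎ key i j i≢j xs)
    (sym (cong₂ _+_ (count-reject (λ x → key x ≟ i) xs p) (count-reject (λ x → key x ≟ j) xs q))))

  map-proj₂-indexedFrom : ∀ s xs → map proj₂ (indexedFrom s xs) ≡ xs
  map-proj₂-indexedFrom s []       = refl
  map-proj₂-indexedFrom s (x ∷ xs) = cong (x ∷_) (map-proj₂-indexedFrom (suc s) xs)

  map-proj₂-indexed : ∀ xs → map proj₂ (indexed xs) ≡ xs
  map-proj₂-indexed xs = trans (cong (map proj₂) (indexed-from xs)) (map-proj₂-indexedFrom 1 xs)

  indexedFrom-increasing : ∀ s xs → AllPairs (λ x y → proj₁ x < proj₁ y) (indexedFrom s xs)
  indexedFrom-increasing s []       = []
  indexedFrom-increasing s (x ∷ xs) = from-≥ (suc s) xs ≤-refl ∷ indexedFrom-increasing (suc s) xs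
    where
    from-≥ : ∀ s′ xs → s < s′ → All (λ y → s < proj₁ y) (indexedFrom s′ xs)
    from-≥ s′ []       p = []
    from-≥ s′ (x ∷ xs) p = p ∷ from-≥ (suc s′) xs (m<n⇒m<1+n p)

  indexed-increasing : ∀ xs → AllPairs (λ x y → proj₁ x < proj₁ y) (indexed xs)
  indexed-increasing xs = subst (AllPairs _) (sym (indexed-from xs)) (indexedFrom-increasing 1 xs)

  inversions-increasing : ∀ {xs} → AllPairs _<_ xs → inversions xs ≡ 0
  inversions-increasing []                = refl
  inversions-increasing {x ∷ _} (p ∷ ps) =
    cong₂ _+_ (count-none (_<? x) (All.map (λ x<y y<x → <-asym x<y y<x) p)) (inversions-increasing ps)

  tabulate-toℕ : ∀ {a} {A : Set a} (g : ℕ → A) n → tabulate (λ (j : Fin n) → g (toℕ j)) ≡ applyUpTo g n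
  tabulate-toℕ g zero    = refl
  tabulate-toℕ g (suc n) = cong (g 0 ∷_) (tabulate-toℕ (g ∘ suc) n)

  betaEntry : ∀ t → (Fin t → ℕ) → Fin t → ℕ
  betaEntry t lam j = lam j + (t ∸ suc (toℕ j))

  beta≡tabulate : ∀ t lam → beta t lam ≡ tabulate (betaEntry t lam)
  beta≡tabulate t lam = Listₚ.map-tabulate id (betaEntry t lam)

  length-beta : ∀ t lam → length (beta t lam) ≡ t
  length-beta t lam = trans (cong length (beta≡tabulate t lam)) (Listₚ.length-tabulate (betaEntry t lam))

  beta-decreasing : ∀ t lam → IsPartition t lam → StrictlyDecreasing (beta t lam)
  beta-decreasing t lam part = subst StrictlyDecreasing (sym (beta≡tabulate t lam)) (go t (betaEntry t lam)
    (λ {i} {j} i<j → +-mono-≤-< (part i j (<⇒≤ i<j)) (∸-monoʳ-< (s≤s i<j) (Finₚ.toℕ<n j))))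
    where
    go : ∀ n (f : Fin n → ℕ) → (∀ {i j} → toℕ i < toℕ j → f j < f i) → StrictlyDecreasing (tabulate f)
    go zero    f mono = []
    go (suc n) f mono = Allₚ.tabulate⁺ (λ j → mono z<s) ∷ go n (f ∘ Fin.suc) (λ p → mono (s<s p))

  -- Sums and signs folded along the reflection of the residues.

  sum-+ : ∀ (f g : ℕ → ℕ) n → sum (applyUpTo (λ i → f i + g i) n) ≡ sum (applyUpTo f n) + sum (applyUpTo g n)
  sum-+ f g zero    = refl
  sum-+ f g (suc n) = trans (cong (λ z → f 0 + g 0 + z) (sum-+ (f ∘ suc) (g ∘ suc) n))
    (interchange (f 0) (g 0) _ _)
    where
    open import Algebra.Properties.CommutativeSemigroup +-commutativeSemigroup using (interchange)

  sum-*ˡ : ∀ k (f : ℕ → ℕ) n → sum (applyUpTo (λ i → k * f i) n) ≡ k * sum (applyUpTo f n)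
  sum-*ˡ k f zero    = sym (*-zeroʳ k)
  sum-*ˡ k f (suc n) = trans (cong (λ z → k * f 0 + z) (sum-*ˡ k (f ∘ suc) n)) (sym (*-distribˡ-+ k (f 0) _))

  sum-∷ʳ : ∀ (f : ℕ → ℕ) n → sum (applyUpTo f (suc n)) ≡ f n + sum (applyUpTo f n)
  sum-∷ʳ f zero    = refl
  sum-∷ʳ f (suc n) = begin
    f 0 + sum (applyUpTo (f ∘ suc) (suc n))        ≡⟨ cong (λ z → f 0 + z) (sum-∷ʳ (f ∘ suc) n) ⟩
    f 0 + (f (suc n) + sum (applyUpTo (f ∘ suc) n)) ≡⟨ x∙yz≈y∙xz (f 0) (f (suc n)) _ ⟩
    f (suc n) + (f 0 + sum (applyUpTo (f ∘ suc) n)) ∎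
    where
    open ≡-Reasoning
    open import Algebra.Properties.CommutativeSemigroup +-commutativeSemigroup using (x∙yz≈y∙xz)

  sum-reverse : ∀ (f : ℕ → ℕ) n → sum (applyUpTo f n) ≡ sum (applyUpTo (λ i → f (n ∸ suc i)) n)
  sum-reverse f zero    = refl
  sum-reverse f (suc n) = trans (sum-∷ʳ f n) (cong (λ z → f n + z) (sum-reverse f n))

  -- A total of `n` times the bound leaves no slack. Applied to `n i + n (t ∸ suc i)`, it turns the
  -- bound 2 on all planes into equalities.
  sum-saturated : ∀ k (f : ℕ → ℕ) n → (∀ i → i < n → f i ≤ k) → sum (applyUpTo f n) ≡ n * k → ∀ i → i < n → f i ≡ k
  sum-saturated k f (suc n) ub eq = λ { zero _ → f0≡k ; (suc i) (s<s i<n) → sum-saturated k (f ∘ suc) n ub′ rest≡ i i<n }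
    where
    ub′ : ∀ i → i < n → f (suc i) ≤ k
    ub′ i i<n = ub (suc i) (s<s i<n)
    bound : ∀ (f : ℕ → ℕ) n → (∀ i → i < n → f i ≤ k) → sum (applyUpTo f n) ≤ n * k
    bound f zero    ub = z≤n
    bound f (suc n) ub = +-mono-≤ (ub 0 z<s) (bound (f ∘ suc) n (λ i i<n → ub (suc i) (s<s i<n)))
    f0≡k : f 0 ≡ k
    f0≡k = ≤-antisym (ub 0 z<s) (+-cancelʳ-≤ (n * k) k (f 0)
      (≤-trans (≤-reflexive (sym eq)) (+-monoʳ-≤ (f 0) (bound (f ∘ suc) n ub′))))
    rest≡ : sum (applyUpTo (f ∘ suc) n) ≡ n * k
    rest≡ = +-cancelˡ-≡ k _ _ (trans (cong (_+ sum (applyUpTo (f ∘ suc) n)) (sym f0≡k)) eq)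

  -- win o p = 2p + o; in the end t = win o p with o ≤ 1 the parity of t.
  win : ℕ → ℕ → ℕ
  win o zero    = o
  win o (suc p) = suc (suc (win o p))

  win-suc : ∀ o p → win (suc o) p ≡ suc (win o p)
  win-suc o zero    = refl
  win-suc o (suc p) = cong (suc ∘ suc) (win-suc o p)

  win≡ : ∀ o p → win o p ≡ p + o + p
  win≡ o zero    = sym (+-identityʳ o)
  win≡ o (suc p) = cong suc (trans (cong suc (win≡ o p)) (sym (+-suc (p + o) p)))

  signℕ-win : ∀ o p → signℕ (win o p) ≡ signℕ o
  signℕ-win o zero    = refl
  signℕ-win o (suc p) = signℕ-win o p

  res2-win : ∀ o p → res 2 (win o p) ≡ res 2 o
  res2-win o zero    = refl
  res2-win o (suc p) = res2-win o p

  win/2 : ∀ o p → o ≤ 1 → win o p / 2 ≡ p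
  win/2 .0 zero    z≤n       = refl
  win/2 .1 zero    (s≤s z≤n) = refl
  win/2 o  (suc p) o≤1       = trans (m/n≡1+[m∸n]/n {win o (suc p)} {2} (s≤s (s≤s z≤n))) (cong suc (win/2 o p o≤1))

  suc-win/2 : ∀ o p → o ≤ 1 → suc (win o p) / 2 ≡ p + o
  suc-win/2 .0 p z≤n       = trans (cong (_/ 2) (sym (win-suc 0 p))) (trans (win/2 1 p ≤-refl) (sym (+-identityʳ p)))
  suc-win/2 .1 p (s≤s z≤n) = trans (cong (λ k → suc k / 2) (win-suc 0 p)) (trans (win/2 0 (suc p) z≤n) (+-comm 1 p))

  win-surjective : ∀ t → ∃₂ λ o p → o ≤ 1 × t ≡ win o p
  win-surjective 0 = 0 , 0 , z≤n , refl
  win-surjective 1 = 1 , 0 , ≤-refl , refl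
  win-surjective (suc (suc t)) with o , p , o≤1 , eq ← win-surjective t = o , suc p , o≤1 , cong (suc ∘ suc) eq

  p≤win : ∀ o p → p ≤ win o p
  p≤win o zero    = z≤n
  p≤win o (suc p) = s≤s (m≤n⇒m≤1+n (p≤win o p))

  -- Pairs the outermost terms, which is the recursion of `win`; the `o` middle terms are left over.
  sum-win : ∀ (g : ℕ → ℕ) o p →
    sum (applyUpTo g (win o p)) ≡ sum (applyUpTo (λ i → g i + g (win o p ∸ suc i)) p) + sum (applyUpTo (λ i → g (p + i)) o)
  sum-win g o zero    = refl
  sum-win g o (suc p) = begin
    g 0 + sum (applyUpTo (g ∘ suc) (suc n))                      ≡⟨ cong (λ z → g 0 + z) (sum-∷ʳ (g ∘ suc) n) ⟩
    g 0 + (g (suc n) + sum (applyUpTo (g ∘ suc) n))              ≡⟨ sym (+-assoc (g 0) _ _) ⟩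
    g 0 + g (suc n) + sum (applyUpTo (g ∘ suc) n)                ≡⟨ cong (λ z → g 0 + g (suc n) + z) (sum-win (g ∘ suc) o p) ⟩
    g 0 + g (suc n) + (sum (applyUpTo (λ i → g (suc i) + g (suc (n ∸ suc i))) p) + M)
      ≡⟨ cong (λ s → g 0 + g (suc n) + (s + M)) (sum-cong p (λ i i<p → cong (λ k → g (suc i) + g k) (sym (∸-suc (≤-trans i<p (p≤win o p)))))) ⟩
    g 0 + g (suc n) + (sum (applyUpTo (λ i → g (suc i) + g (n ∸ i)) p) + M)
      ≡⟨ sym (+-assoc (g 0 + g (suc n)) _ M) ⟩
    g 0 + g (suc n) + sum (applyUpTo (λ i → g (suc i) + g (n ∸ i)) p) + M ∎
    where
    open ≡-Reasoning
    n M : ℕ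
    n = win o p
    M = sum (applyUpTo (λ i → g (suc (p + i))) o)

  prodℤ-signs : ∀ (a : ℕ → ℕ) (f : ℕ → ℤ) n →
    prodℤ (applyUpTo (λ i → signℕ (a i) ℤ.* f i) n) ≡ signℕ (sum (applyUpTo a n)) ℤ.* prodℤ (applyUpTo f n)
  prodℤ-signs a f zero    = refl
  prodℤ-signs a f (suc n) = begin
    (signℕ (a 0) ℤ.* f 0) ℤ.* prodℤ (applyUpTo (λ i → signℕ (a (suc i)) ℤ.* f (suc i)) n)
      ≡⟨ cong ((signℕ (a 0) ℤ.* f 0) ℤ.*_) (prodℤ-signs (a ∘ suc) (f ∘ suc) n) ⟩
    (signℕ (a 0) ℤ.* f 0) ℤ.* (signℕ S ℤ.* P)
      ≡⟨ interchange (signℕ (a 0)) (f 0) (signℕ S) P ⟩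
    (signℕ (a 0) ℤ.* signℕ S) ℤ.* (f 0 ℤ.* P)
      ≡⟨ cong (ℤ._* (f 0 ℤ.* P)) (sym (signℕ-+ (a 0) S)) ⟩
    signℕ (a 0 + S) ℤ.* (f 0 ℤ.* P) ∎
    where
    open ≡-Reasoning
    open import Algebra.Properties.CommutativeSemigroup ℤₚ.*-commutativeSemigroup using (interchange)
    S : ℕ
    S = sum (applyUpTo (a ∘ suc) n)
    P : ℤ
    P = prodℤ (applyUpTo (f ∘ suc) n)

  sumℤ-pos : ∀ (f : ℕ → ℕ) n → sumℤ (applyUpTo (λ i → + f i) n) ≡ + sum (applyUpTo f n)
  sumℤ-pos f zero    = refl
  sumℤ-pos f (suc n) = cong (λ z → + f 0 ℤ.+ z) (sumℤ-pos (f ∘ suc) n)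

  -- Parity ignores the sign of a summand, so the negative sum of binomial coefficients in the
  -- exponent may be made positive.
  signℤ-diff : ∀ a b → signℤ (ℤ.- (+ a) ℤ.+ + b) ≡ signℕ (a + b)
  signℤ-diff a b = trans (cong signℤ (trans (ℤₚ.+-comm (ℤ.- (+ a)) (+ b)) (ℤₚ.m-n≡m⊖n b a))) (go a b)
    where
    go : ∀ a b → signℤ (b ℤ.⊖ a) ≡ signℕ (a + b)
    go zero    b       = refl
    go (suc a) zero    = cong signℕ (cong suc (sym (+-identityʳ a)))
    go (suc a) (suc b) = trans (cong signℤ (ℤₚ.[1+m]⊖[1+n]≡m⊖n b a)) (trans (go a b) (cong (λ k → signℕ (suc k)) (sym (+-suc a b))))

  signℕ-square : ∀ n → signℕ n ℤ.* signℕ n ≡ + 1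
  signℕ-square zero          = refl
  signℕ-square (suc zero)    = refl
  signℕ-square (suc (suc n)) = signℕ-square n

  signℕ≢0 : ∀ n → signℕ n ≢ + 0
  signℕ≢0 (suc (suc n)) eq = signℕ≢0 n eq

  *≢0 : ∀ {i j} → i ≢ + 0 → j ≢ + 0 → i ℤ.* j ≢ + 0
  *≢0 {i} p q eq with ℤₚ.i*j≡0⇒i≡0∨j≡0 i eq
  ... | inj₁ z = p z
  ... | inj₂ z = q z

  prodℤ≢0 : ∀ (f : ℕ → ℤ) n → (∀ i → i < n → f i ≢ + 0) → prodℤ (applyUpTo f n) ≢ + 0
  prodℤ≢0 f zero    nz ()
  prodℤ≢0 f (suc n) nz = *≢0 (nz 0 z<s) (prodℤ≢0 (f ∘ suc) n (λ i i<n → nz (suc i) (s<s i<n)))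

open Combinatorics

-- The integers inside a commutative ring.

module IntegerEmbedding {c ℓ : Level} (R : CommutativeRing c ℓ) where
  open CommutativeRing R hiding (zero)
  open RingDefs R
  open import Algebra.Properties.Ring ring using (-‿distribˡ-*; -0#≈0#; -‿involutive; -‿+-comm)
  open import Relation.Binary.Reasoning.Setoid setoid

  fromℕ-+ : ∀ m n → fromℕ (m ℕ.+ n) ≈ fromℕ m + fromℕ n
  fromℕ-+ zero    n = sym (+-identityˡ _)
  fromℕ-+ (suc m) n = trans (+-congˡ (fromℕ-+ m n)) (sym (+-assoc _ _ _))

  fromℕ-* : ∀ m n → fromℕ (m ℕ.* n) ≈ fromℕ m * fromℕ n
  fromℕ-* zero    n = sym (zeroˡ _)
  fromℕ-* (suc m) n = begin
    fromℕ (n ℕ.+ m ℕ.* n)              ≈⟨ fromℕ-+ n (m ℕ.* n) ⟩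
    fromℕ n + fromℕ (m ℕ.* n)          ≈⟨ +-cong (sym (*-identityˡ _)) (fromℕ-* m n) ⟩
    1# * fromℕ n + fromℕ m * fromℕ n   ≈⟨ sym (distribʳ _ _ _) ⟩
    (1# + fromℕ m) * fromℕ n           ∎

  fromℤ-neg : ∀ i → fromℤ (ℤ.- i) ≈ - fromℤ i
  fromℤ-neg (+ zero)    = sym -0#≈0#
  fromℤ-neg (+ suc n)   = refl
  fromℤ-neg -[1+ n ]    = sym (-‿involutive _)

  fromℤ-⊖ : ∀ m n → fromℤ (m ℤ.⊖ n) ≈ fromℕ m - fromℕ n
  fromℤ-⊖ m       zero    = sym (trans (+-congˡ -0#≈0#) (+-identityʳ _))
  fromℤ-⊖ zero    (suc n) = sym (+-identityˡ _)
  fromℤ-⊖ (suc m) (suc n) = begin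
    fromℤ (suc m ℤ.⊖ suc n)                   ≡⟨ ≡.cong fromℤ (ℤₚ.[1+m]⊖[1+n]≡m⊖n m n) ⟩
    fromℤ (m ℤ.⊖ n)                           ≈⟨ fromℤ-⊖ m n ⟩
    fromℕ m - fromℕ n                         ≈⟨ +-congˡ (sym (+-identityˡ _)) ⟩
    fromℕ m + (0# - fromℕ n)                  ≈⟨ +-congˡ (+-congʳ (sym (-‿inverseʳ 1#))) ⟩
    fromℕ m + ((1# - 1#) - fromℕ n)           ≈⟨ +-congˡ (+-assoc _ _ _) ⟩
    fromℕ m + (1# + (- 1# - fromℕ n))         ≈⟨ sym (+-assoc _ _ _) ⟩
    (fromℕ m + 1#) + (- 1# - fromℕ n)         ≈⟨ +-cong (+-comm _ _) (-‿+-comm _ _) ⟩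
    fromℕ (suc m) - fromℕ (suc n)             ∎

  fromℤ-+ : ∀ i j → fromℤ (i ℤ.+ j) ≈ fromℤ i + fromℤ j
  fromℤ-+ (+ m)    (+ n)    = fromℕ-+ m n
  fromℤ-+ (+ m)    -[1+ n ] = fromℤ-⊖ m (suc n)
  fromℤ-+ -[1+ m ] (+ n)    = trans (fromℤ-⊖ n (suc m)) (+-comm _ _)
  fromℤ-+ -[1+ m ] -[1+ n ] = begin
    - fromℕ (suc (suc (m ℕ.+ n)))      ≡⟨ ≡.cong (λ k → - fromℕ (suc k)) (≡.sym (ℕₚ.+-suc m n)) ⟩
    - fromℕ (suc m ℕ.+ suc n)          ≈⟨ -‿cong (fromℕ-+ (suc m) (suc n)) ⟩
    - (fromℕ (suc m) + fromℕ (suc n))  ≈⟨ sym (-‿+-comm _ _) ⟩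
    - fromℕ (suc m) - fromℕ (suc n)    ∎

  fromℤ-*⁺ : ∀ m j → fromℤ (+ m ℤ.* j) ≈ fromℕ m * fromℤ j
  fromℤ-*⁺ m (+ n)    = trans (reflexive (≡.cong fromℤ (≡.sym (ℤₚ.pos-* m n)))) (fromℕ-* m n)
  fromℤ-*⁺ m -[1+ n ] = begin
    fromℤ (+ m ℤ.* ℤ.- (+ suc n))     ≡⟨ ≡.cong fromℤ (≡.sym (ℤₚ.neg-distribʳ-* (+ m) (+ suc n))) ⟩
    fromℤ (ℤ.- (+ m ℤ.* + suc n))     ≈⟨ fromℤ-neg (+ m ℤ.* + suc n) ⟩
    - fromℤ (+ m ℤ.* + suc n)         ≈⟨ -‿cong (fromℤ-*⁺ m (+ suc n)) ⟩
    - (fromℕ m * fromℕ (suc n))       ≈⟨ -‿cong (*-comm _ _) ⟩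
    - (fromℕ (suc n) * fromℕ m)       ≈⟨ -‿distribˡ-* _ _ ⟩
    - fromℕ (suc n) * fromℕ m         ≈⟨ *-comm _ _ ⟩
    fromℕ m * - fromℕ (suc n)         ∎

  fromℤ-* : ∀ i j → fromℤ (i ℤ.* j) ≈ fromℤ i * fromℤ j
  fromℤ-* (+ m)    j = fromℤ-*⁺ m j
  fromℤ-* -[1+ m ] j = begin
    fromℤ (ℤ.- (+ suc m) ℤ.* j)       ≡⟨ ≡.cong fromℤ (≡.sym (ℤₚ.neg-distribˡ-* (+ suc m) j)) ⟩
    fromℤ (ℤ.- (+ suc m ℤ.* j))       ≈⟨ fromℤ-neg (+ suc m ℤ.* j) ⟩
    - fromℤ (+ suc m ℤ.* j)           ≈⟨ -‿cong (fromℤ-*⁺ (suc m) j) ⟩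
    - (fromℕ (suc m) * fromℤ j)       ≈⟨ -‿distribˡ-* _ _ ⟩
    - fromℕ (suc m) * fromℤ j         ∎

  fromℤ-1 : fromℤ (+ 1) ≈ 1#
  fromℤ-1 = +-identityʳ 1#

  fromℤ-injective₀ : CharZero → ∀ i → fromℤ i ≈ 0# → i ≡ + 0
  fromℤ-injective₀ ch (+ zero)  _ = ≡.refl
  fromℤ-injective₀ ch (+ suc n) p with () ← ch n p
  fromℤ-injective₀ ch -[1+ n ]  p with () ← ch n (trans (sym (-‿involutive _)) (trans (-‿cong p) -0#≈0#))

  private
    ℤ-morphism : ℤ.+-*-rawRing ACR.-Raw-AlmostCommutative⟶ ACR.fromCommutativeRing R
    ℤ-morphism = record
      { ⟦_⟧ = fromℤ ; +-homo = fromℤ-+ ; *-homo = fromℤ-* ; -‿homo = fromℤ-neg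
      ; 0-homo = refl ; 1-homo = fromℤ-1 }

    -- The carrier need not have decidable equality; comparing the integer coefficients is all that
    -- the solver asks for.
    weak≟ : ∀ i j → Maybe (fromℤ i ≈ fromℤ j)
    weak≟ i j with i ℤ.≟ j
    ... | yes ≡.refl = just refl
    ... | no  _      = nothing

  module Solver = Algebra.Solver.Ring ℤ.+-*-rawRing (ACR.fromCommutativeRing R) ℤ-morphism weak≟

-- Generating functions of complete homogeneous polynomials.

module CompleteHomogeneous {c ℓ : Level} (R : CommutativeRing c ℓ) where
  open CommutativeRing R hiding (zero)
  open RingDefs R
  open IntegerEmbedding R
  open import Algebra.Properties.Ring ring using (-1*x≈-x)
  open import Algebra.Properties.Group +-group using (x∙y⁻¹≈ε⇒x≈y)
  open import Relation.Binary.Reasoning.Setoid setoid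

  Series : Set c
  Series = ℕ → Carrier

  δ₀ : Series
  δ₀ zero    = 1#
  δ₀ (suc _) = 0#

  -- Multiplication of a power series by 1 − x q.
  M : Carrier → Series → Series
  M x s zero    = s zero
  M x s (suc k) = s (suc k) - x * s k

  M* : List Carrier → Series → Series
  M* xs s = foldr M s xs

  M-cong : ∀ {x y s u} → x ≈ y → (∀ k → s k ≈ u k) → ∀ k → M x s k ≈ M y u k
  M-cong p q zero    = q zero
  M-cong p q (suc k) = +-cong (q (suc k)) (-‿cong (*-cong p (q k)))

  M-comm : ∀ x y s k → M x (M y s) k ≈ M y (M x s) k
  M-comm x y s zero          = refl
  M-comm x y s (suc zero)    = Solver.solve 4 (λ x y a b →
      let open Solver in (b :- y :* a) :- x :* a := (b :- x :* a) :- y :* a) refl x y (s 0) (s 1)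
  M-comm x y s (suc (suc k)) = Solver.solve 5 (λ x y a b d →
      let open Solver in (d :- y :* b) :- x :* (b :- y :* a) := (d :- x :* b) :- y :* (b :- x :* a))
      refl x y (s k) (s (suc k)) (s (suc (suc k)))

  M*-∷ʳ : ∀ xs x s k → M* (xs ∷ʳ x) s k ≈ M* (x ∷ xs) s k
  M*-∷ʳ []       x s k = refl
  M*-∷ʳ (y ∷ xs) x s k = trans (M-cong refl (M*-∷ʳ xs x s) k) (M-comm y x (M* xs s) k)

  conv : Series → Series → Series
  conv e s zero    = e zero * s zero
  conv e s (suc k) = e zero * s (suc k) + conv (e ∘ suc) s k

  conv-cong : ∀ {e f s u} → (∀ k → e k ≈ f k) → (∀ k → s k ≈ u k) → ∀ k → conv e s k ≈ conv f u k
  conv-cong p q zero    = *-cong (p 0) (q 0)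
  conv-cong p q (suc k) = +-cong (*-cong (p 0) (q (suc k))) (conv-cong (p ∘ suc) q k)

  conv-linear : ∀ e f x s k → conv (λ i → e i - x * f i) s k ≈ conv e s k - x * conv f s k
  conv-linear e f x s zero    = Solver.solve 4 (λ e f x s →
      let open Solver in (e :- x :* f) :* s := e :* s :- x :* (f :* s)) refl (e 0) (f 0) x (s 0)
  conv-linear e f x s (suc k) = trans (+-congˡ (conv-linear (e ∘ suc) (f ∘ suc) x s k))
    (Solver.solve 6 (λ e f x s a b → let open Solver in
        (e :- x :* f) :* s :+ (a :- x :* b) := (e :* s :+ a) :- x :* (f :* s :+ b))
      refl (e 0) (f 0) x (s (suc k)) (conv (e ∘ suc) s k) (conv (f ∘ suc) s k))

  conv-M : ∀ x e s k → conv (M x e) s k ≈ M x (conv e s) k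
  conv-M x e s zero    = refl
  conv-M x e s (suc k) = trans (+-congˡ (conv-linear (e ∘ suc) e x s k)) (sym (+-assoc _ _ _))

  conv-zero : ∀ {e} s → (∀ k → e k ≈ 0#) → ∀ k → conv e s k ≈ 0#
  conv-zero s p zero    = trans (*-congʳ (p 0)) (zeroˡ _)
  conv-zero s p (suc k) = trans (+-cong (trans (*-congʳ (p 0)) (zeroˡ _)) (conv-zero s (p ∘ suc) k)) (+-identityʳ 0#)

  conv-δ₀ : ∀ s k → conv δ₀ s k ≈ s k
  conv-δ₀ s zero    = *-identityˡ _
  conv-δ₀ s (suc k) = trans (+-cong (*-identityˡ _) (conv-zero s (λ _ → refl) k)) (+-identityʳ _)

  -- Applying the factors 1 - xq one by one agrees with multiplying by their expanded product; thus
  -- a list of roots may be replaced by the coefficients of its polynomial.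
  conv-M* : ∀ xs s k → conv (M* xs δ₀) s k ≈ M* xs s k
  conv-M* []       s k = conv-δ₀ s k
  conv-M* (x ∷ xs) s k = trans (conv-M x (M* xs δ₀) s k) (M-cong refl (conv-M* xs s) k)

  conv-below : ∀ n {e} s → (∀ i → i ℕ.< n → e i ≈ 0#) → ∀ k → k ℕ.< n → conv e s k ≈ 0#
  conv-below (suc n) s p zero    _           = trans (*-congʳ (p 0 ℕ.z<s)) (zeroˡ _)
  conv-below (suc n) s p (suc k) (ℕ.s<s k<n) = trans
    (+-cong (trans (*-congʳ (p 0 ℕ.z<s)) (zeroˡ _)) (conv-below n s (λ i i<n → p (suc i) (ℕ.s<s i<n)) k k<n))
    (+-identityʳ 0#)

  conv-monomial : ∀ n {e a} s → (∀ i → i ℕ.< n → e i ≈ 0#) → e n ≈ a → (∀ i → n ℕ.< i → e i ≈ 0#) →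
                  ∀ k → conv e s (n ℕ.+ k) ≈ a * s k
  conv-monomial zero    s p q r zero    = *-congʳ q
  conv-monomial zero    s p q r (suc k) = trans
    (+-cong (*-congʳ q) (conv-zero s (λ i → r (suc i) ℕ.z<s) k)) (+-identityʳ _)
  conv-monomial (suc n) s p q r k = trans
    (+-cong (trans (*-congʳ (p 0 ℕ.z<s)) (zeroˡ _))
            (conv-monomial n s (λ i i<n → p (suc i) (ℕ.s<s i<n)) q (λ i n<i → r (suc i) (ℕ.s<s n<i)) k))
    (+-identityˡ _)

  sumR-applyUpTo-cong : ∀ {f g : Series} → (∀ k → f k ≈ g k) → ∀ n → sumR (applyUpTo f n) ≈ sumR (applyUpTo g n)
  sumR-applyUpTo-cong p zero    = refl
  sumR-applyUpTo-cong p (suc n) = +-cong (p 0) (sumR-applyUpTo-cong (p ∘ suc) n)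

  sumR-applyUpTo-* : ∀ x (f : Series) n → sumR (applyUpTo (λ k → x * f k) n) ≈ x * sumR (applyUpTo f n)
  sumR-applyUpTo-* x f zero    = sym (zeroʳ x)
  sumR-applyUpTo-* x f (suc n) = trans (+-congˡ (sumR-applyUpTo-* x (f ∘ suc) n)) (sym (distribˡ _ _ _))

  h-∷ : ∀ k x xs → h k (x ∷ xs) ≡ sumR (applyUpTo (λ a → pow x a * h (k ℕ.∸ a) xs) (suc k))
  h-∷ zero    x xs = ≡.refl
  h-∷ (suc k) x xs = ≡.cong sumR (Listₚ.map-upTo (λ a → pow x a * h (suc k ℕ.∸ a) xs) (suc (suc k)))

  h-zero : ∀ x xs → h 0 (x ∷ xs) ≈ h 0 xs
  h-zero x xs = trans (+-identityʳ _) (*-identityˡ _)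

  -- Monomials of degree `suc k` either omit `x` or contain it; in the second case one factor `x` is
  -- taken out.
  h-suc : ∀ k x xs → h (suc k) (x ∷ xs) ≈ h (suc k) xs + x * h k (x ∷ xs)
  h-suc k x xs = begin
    h (suc k) (x ∷ xs)
      ≡⟨ h-∷ (suc k) x xs ⟩
    1# * h (suc k) xs + sumR (applyUpTo (λ a → (x * pow x a) * h (k ℕ.∸ a) xs) (suc k))
      ≈⟨ +-cong (*-identityˡ _) (sumR-applyUpTo-cong (λ a → *-assoc x (pow x a) (h (k ℕ.∸ a) xs)) (suc k)) ⟩
    h (suc k) xs + sumR (applyUpTo (λ a → x * (pow x a * h (k ℕ.∸ a) xs)) (suc k))
      ≈⟨ +-congˡ (sumR-applyUpTo-* x (λ a → pow x a * h (k ℕ.∸ a) xs) (suc k)) ⟩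
    h (suc k) xs + x * sumR (applyUpTo (λ a → pow x a * h (k ℕ.∸ a) xs) (suc k))
      ≡⟨ ≡.cong (λ z → h (suc k) xs + x * z) (≡.sym (h-∷ k x xs)) ⟩
    h (suc k) xs + x * h k (x ∷ xs) ∎

  -- The generating function of the `h i` is the product of the 1/(1 - xq), and one factor is
  -- cancelled.
  M-h : ∀ x xs k → M x (λ i → h i (x ∷ xs)) k ≈ h k xs
  M-h x xs zero    = h-zero x xs
  M-h x xs (suc k) = trans (+-congʳ (h-suc k x xs))
    (Solver.solve 2 (λ a b → let open Solver in (a :+ b) :- b := a) refl (h (suc k) xs) (x * h k (x ∷ xs)))

  M*-cong : ∀ xs {s u} → (∀ k → s k ≈ u k) → ∀ k → M* xs s k ≈ M* xs u k
  M*-cong []       p = p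
  M*-cong (x ∷ xs) p = M-cong refl (M*-cong xs p)

  M-M*-comm : ∀ x xs s k → M x (M* xs s) k ≈ M* xs (M x s) k
  M-M*-comm x []       s k = refl
  M-M*-comm x (y ∷ xs) s k = trans (M-comm x y (M* xs s) k) (M-cong refl (M-M*-comm x xs s) k)

  M*-h : ∀ xs ys k → M* xs (λ i → h i (xs ++ ys)) k ≈ h k ys
  M*-h []       ys k = refl
  M*-h (x ∷ xs) ys k = trans (M-M*-comm x xs (λ i → h i (x ∷ xs ++ ys)) k)
    (trans (M*-cong xs (M-h x (xs ++ ys)) k) (M*-h xs ys k))

  -- The coefficients of ∏ (1 − x q) over the x in the list.
  E : List Carrier → Series
  E xs = M* xs δ₀

  E-zero : ∀ xs → E xs 0 ≈ 1#
  E-zero []       = refl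
  E-zero (x ∷ xs) = E-zero xs

  E-large : ∀ xs k → length xs ℕ.< k → E xs k ≈ 0#
  E-large []       (suc k) _           = refl
  E-large (x ∷ xs) (suc k) (ℕ.s<s l<k) = begin
    E xs (suc k) - x * E xs k  ≈⟨ +-cong (E-large xs (suc k) (ℕₚ.m<n⇒m<1+n l<k)) (-‿cong (*-congˡ (E-large xs k l<k))) ⟩
    0# - x * 0#                ≈⟨ +-congˡ (-‿cong (zeroʳ x)) ⟩
    0# - 0#                    ≈⟨ -‿inverseʳ 0# ⟩
    0#                         ∎

  E-scale : ∀ ω xs k → E (map (ω *_) xs) k ≈ pow ω k * E xs k
  E-scale ω []       zero    = sym (*-identityˡ _)
  E-scale ω []       (suc k) = sym (zeroʳ _)
  E-scale ω (x ∷ xs) zero    = E-scale ω xs zero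
  E-scale ω (x ∷ xs) (suc k) = trans
    (+-cong (E-scale ω xs (suc k)) (-‿cong (*-congˡ (E-scale ω xs k))))
    (Solver.solve 5 (λ w x p a b → let open Solver in
        (w :* p) :* b :- (w :* x) :* (p :* a) := (w :* p) :* (b :- x :* a))
      refl ω x (pow ω k) (E xs k) (E xs (suc k)))

  -- The binomial coefficient C(q+1, 2). Argument 0 gives 0, the value that also serves for negative
  -- degrees.
  triangular : ℕ → Carrier
  triangular zero    = 0#
  triangular (suc q) = fromℕ (suc q) + triangular q

  -- Evaluation at the roots of unity.

  module _ (dom : IntegralDomain) (n : ℕ) (ω : Carrier) (prim : PrimitiveRoot (suc n) ω) where

    private
      t : ℕ
      t = suc n
      powers : List Carrier
      powers = applyUpTo (pow ω ∘ suc) n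
      roots  : List Carrier
      roots  = applyUpTo (pow ω) t

    -- Since the `t`-th power of `ω` is 1, the list is only shifted cyclically, and the order of the
    -- factors does not matter.
    E-rotate : ∀ k → E (applyUpTo (pow ω ∘ suc) t) k ≈ E roots k
    E-rotate k = begin
      E (applyUpTo (pow ω ∘ suc) t) k  ≡⟨ ≡.cong (λ z → E z k) (≡.sym (Listₚ.applyUpTo-∷ʳ (pow ω ∘ suc) n)) ⟩
      E (powers ∷ʳ pow ω t) k          ≈⟨ M*-∷ʳ powers (pow ω t) δ₀ k ⟩
      E (pow ω t ∷ powers) k           ≈⟨ M-cong (proj₁ prim) (λ _ → refl) k ⟩
      E (1# ∷ powers) k                ∎

    -- Multiplying all roots by ω permutes them, so (ω^k − 1) E_k = 0.
    E-roots-middle : ∀ k → 0 ℕ.< k → k ℕ.< t → E roots k ≈ 0#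
    E-roots-middle k 0<k k<t with dom (pow ω k - 1#) (E roots k) eq
      where
      eq : (pow ω k - 1#) * E roots k ≈ 0#
      eq = begin
        (pow ω k - 1#) * E roots k
          ≈⟨ trans (distribʳ _ _ _) (+-congˡ (-1*x≈-x _)) ⟩
        pow ω k * E roots k - E roots k
          ≈⟨ +-congʳ (sym (E-scale ω roots k)) ⟩
        E (map (ω *_) roots) k - E roots k
          ≡⟨ ≡.cong (λ z → E z k - E roots k) (Listₚ.map-applyUpTo (pow ω) (ω *_) t) ⟩
        E (applyUpTo (pow ω ∘ suc) t) k - E roots k
          ≈⟨ +-congʳ (E-rotate k) ⟩
        E roots k - E roots k
          ≈⟨ -‿inverseʳ _ ⟩
        0# ∎
    ... | inj₂ z = z
    ... | inj₁ z = contradiction (x∙y⁻¹≈ε⇒x≈y _ _ z) (proj₂ prim k 0<k k<t)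

    -- Removing the factor 1 - q of the root 1 leaves 1 + q + ... + q^n: the vanishing middle
    -- coefficients of the full product force neighbouring coefficients of the quotient to agree.
    E-powers : ∀ k → k ℕ.≤ n → E powers k ≈ 1#
    E-powers zero    _   = E-zero powers
    E-powers (suc k) k<n = begin
      E powers (suc k)  ≈⟨ x∙y⁻¹≈ε⇒x≈y _ _ (E-roots-middle (suc k) ℕ.z<s (ℕ.s<s k<n)) ⟩
      1# * E powers k   ≈⟨ *-identityˡ _ ⟩
      E powers k        ≈⟨ E-powers k (ℕₚ.<⇒≤ k<n) ⟩
      1#                ∎

    -- Only the factor 1 - q of the root 1 reaches degree `t`: it takes the top coefficient 1 of the
    -- remaining product to -1.
    E-roots-top : E roots t ≈ - 1#
    E-roots-top = begin
      E powers t - 1# * E powers n  ≈⟨ +-cong (E-large powers t (ℕ.s≤s (ℕₚ.≤-reflexive (Listₚ.length-applyUpTo (pow ω ∘ suc) n))))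
                                              (-‿cong (trans (*-identityˡ _) (E-powers n ℕₚ.≤-refl))) ⟩
      0# - 1#                       ≈⟨ +-identityˡ _ ⟩
      - 1#                          ∎

    E-roots-large : ∀ k → t ℕ.< k → E roots k ≈ 0#
    E-roots-large k t<k = E-large roots k (≡.subst (ℕ._< k) (≡.sym (Listₚ.length-applyUpTo (pow ω) t)) t<k)

    -- Prepending `xs`, whose factors multiply to 1 - q^t, divides the generating function by 1 -
    -- q^t, which is a recursion in steps of `t`. It serves once for the inverses and once for the
    -- roots.
    module Recurrence (xs ys : List Carrier) (E-xs : ∀ k → E xs k ≈ E roots k) where
      private
        s : Series
        s i = h i (xs ++ ys)

        conv≈ : ∀ k → conv (E roots) s k ≈ h k ys
        conv≈ k = trans (conv-cong (λ i → sym (E-xs i)) (λ _ → refl) k) (trans (conv-M* xs s k) (M*-h xs ys k))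

      h-below : ∀ k → k ℕ.< t → h k (xs ++ ys) ≈ h k ys
      h-below zero    _           = trans (sym (trans (*-congʳ (E-zero roots)) (*-identityˡ _))) (conv≈ 0)
      h-below (suc k) (ℕ.s<s k<n) = begin
        s (suc k)                                    ≈⟨ sym (trans (+-cong (trans (*-congʳ (E-zero roots)) (*-identityˡ _))
                                                          (conv-below n s (λ i i<n → E-roots-middle (suc i) ℕ.z<s (ℕ.s<s i<n)) k k<n))
                                                          (+-identityʳ _)) ⟩
        conv (E roots) s (suc k)                     ≈⟨ conv≈ (suc k) ⟩
        h (suc k) ys                                 ∎

      h-step : ∀ k → h (t ℕ.+ k) (xs ++ ys) ≈ h (t ℕ.+ k) ys + h k (xs ++ ys)
      h-step k = begin
        s (t ℕ.+ k)                               ≈⟨ Solver.solve 2 (λ a b → let open Solver in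
                                                       a := (a :+ (:- b)) :+ b) refl (s (t ℕ.+ k)) (s k) ⟩
        (s (t ℕ.+ k) + - s k) + s k               ≈⟨ +-congʳ (sym step) ⟩
        conv (E roots) s (t ℕ.+ k) + s k          ≈⟨ +-congʳ (conv≈ (t ℕ.+ k)) ⟩
        h (t ℕ.+ k) ys + s k                      ∎
        where
        step : conv (E roots) s (t ℕ.+ k) ≈ s (t ℕ.+ k) + - s k
        step = +-cong (trans (*-congʳ (E-zero roots)) (*-identityˡ _))
          (trans (conv-monomial n s (λ i i<n → E-roots-middle (suc i) ℕ.z<s (ℕ.s<s i<n)) E-roots-top
                   (λ i n<i → E-roots-large (suc i) (ℕ.s<s n<i)) k)
                 (-1*x≈-x _))

    private
      inverses : List Carrier
      inverses = applyUpTo (λ j → pow ω (t ℕ.∸ j)) t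

      -- The exponents run from `m` down to 1, so this is the other list reversed.
      E-inverses : ∀ m k → E (applyUpTo (λ j → pow ω (m ℕ.∸ j)) m) k ≈ E (applyUpTo (pow ω ∘ suc) m) k
      E-inverses zero    k = refl
      E-inverses (suc m) k = begin
        M (pow ω (suc m)) (E (applyUpTo (λ j → pow ω (m ℕ.∸ j)) m)) k  ≈⟨ M-cong refl (E-inverses m) k ⟩
        E (pow ω (suc m) ∷ applyUpTo (pow ω ∘ suc) m) k               ≈⟨ sym (M*-∷ʳ (applyUpTo (pow ω ∘ suc) m) _ δ₀ k) ⟩
        E (applyUpTo (pow ω ∘ suc) m ∷ʳ pow ω (suc m)) k              ≡⟨ ≡.cong (λ z → E z k) (Listₚ.applyUpTo-∷ʳ (pow ω ∘ suc) m) ⟩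
        E (applyUpTo (pow ω ∘ suc) (suc m)) k                         ∎

      h-one : ∀ k → h k [ 1# ] ≈ 1#
      h-one zero    = h-zero 1# []
      h-one (suc k) = trans (h-suc k 1# []) (trans (+-identityˡ _) (trans (*-identityˡ _) (h-one k)))

      module I = Recurrence inverses [ 1# ] (λ k → trans (E-inverses t k) (E-rotate k))
      module V = Recurrence roots (inverses ++ [ 1# ]) (λ _ → refl)

      swap-t : ∀ r q → r ℕ.+ (t ℕ.+ q) ≡ t ℕ.+ (r ℕ.+ q)
      swap-t r q = ≡.trans (≡.sym (ℕₚ.+-assoc r t q)) (≡.trans (≡.cong (ℕ._+ q) (ℕₚ.+-comm r t)) (ℕₚ.+-assoc t r q))

      -- These are the coefficients of 1/((1 - z)(1 - z^t)): each full period adds 1.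
      h-inverses : ∀ q r → r ℕ.< t → h (r ℕ.+ q ℕ.* t) (inverses ++ [ 1# ]) ≈ fromℕ (suc q)
      h-inverses zero r r<t rewrite ℕₚ.+-identityʳ r = trans (I.h-below r r<t) (trans (h-one r) (sym (+-identityʳ _)))
      h-inverses (suc q) r r<t rewrite swap-t r (q ℕ.* t) =
        trans (I.h-step (r ℕ.+ q ℕ.* t)) (+-cong (h-one (t ℕ.+ (r ℕ.+ q ℕ.* t))) (h-inverses q r r<t))

    -- One more factor 1/(1 - z^t) sums the values 1, ..., q+1 along the residue class.
    h-roots : ∀ q r → r ℕ.< t → h (r ℕ.+ q ℕ.* t) (roots ++ inverses ++ [ 1# ]) ≈ triangular (suc q)
    h-roots zero r r<t = trans (reflexive (≡.cong (λ k → h k (roots ++ inverses ++ [ 1# ])) (ℕₚ.+-identityʳ r)))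
      (trans (V.h-below r r<t) (trans (reflexive (≡.cong (λ k → h k (inverses ++ [ 1# ])) (≡.sym (ℕₚ.+-identityʳ r))))
      (trans (h-inverses 0 r r<t) (sym (+-identityʳ _)))))
    h-roots (suc q) r r<t = begin
      h (r ℕ.+ (t ℕ.+ q ℕ.* t)) (roots ++ inverses ++ [ 1# ])
        ≡⟨ ≡.cong (λ k → h k (roots ++ inverses ++ [ 1# ])) (swap-t r (q ℕ.* t)) ⟩
      h (t ℕ.+ (r ℕ.+ q ℕ.* t)) (roots ++ inverses ++ [ 1# ])
        ≈⟨ V.h-step (r ℕ.+ q ℕ.* t) ⟩
      h (t ℕ.+ (r ℕ.+ q ℕ.* t)) (inverses ++ [ 1# ]) + h (r ℕ.+ q ℕ.* t) (roots ++ inverses ++ [ 1# ])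
        ≈⟨ +-cong (trans (reflexive (≡.cong (λ k → h k (inverses ++ [ 1# ])) (≡.sym (swap-t r (q ℕ.* t))))) (h-inverses (suc q) r r<t))
                  (h-roots q r r<t) ⟩
      fromℕ (suc (suc q)) + triangular (suc q) ∎

    vars≡ : vars t ω ≡ roots ++ inverses ++ [ 1# ]
    vars≡ = ≡.cong₂ (λ xs ys → xs ++ ys ++ [ 1# ]) (Listₚ.map-upTo (pow ω) t) (Listₚ.map-upTo (λ j → pow ω (t ℕ.∸ j)) t)

    -- Indices in the determinant may go down to -2t, so the quotient is taken after adding 2t. The
    -- true quotient is q - 2 and the value `triangular (q ∸ 1)`; truncation makes this 0 for q = 0
    -- and q = 1, as it must be in negative degree.
    hℤ-vars : ∀ z q r → r ℕ.< t → z ℤ.+ + (t ℕ.+ t) ≡ + (r ℕ.+ q ℕ.* t) → hℤ z (vars t ω) ≈ triangular (q ℕ.∸ 1)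
    hℤ-vars (+ k) zero r r<t eq = contradiction
      (≡.subst (ℕ._< t) (≡.sym (≡.trans (ℤₚ.+-injective eq) (ℕₚ.+-identityʳ r))) r<t)
      (ℕₚ.≤⇒≯ (ℕₚ.≤-trans (ℕₚ.m≤m+n t t) (ℕₚ.m≤n+m (t ℕ.+ t) k)))
    hℤ-vars (+ k) (suc zero) r r<t eq = contradiction
      (≡.subst (ℕ._< t ℕ.+ t) (≡.sym (≡.trans (ℤₚ.+-injective eq) (≡.cong (r ℕ.+_) (ℕₚ.*-identityˡ t)))) (ℕₚ.+-monoˡ-< t r<t))
      (ℕₚ.≤⇒≯ (ℕₚ.m≤n+m (t ℕ.+ t) k))
    hℤ-vars (+ k) (suc (suc q)) r r<t eq = trans (reflexive (≡.cong₂ h k≡ vars≡)) (h-roots q r r<t)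
      where
      k≡ : k ≡ r ℕ.+ q ℕ.* t
      k≡ = ℕₚ.+-cancelʳ-≡ (t ℕ.+ t) k _ (≡.trans (ℤₚ.+-injective eq)
        (NatSolver.solve 3 (λ r t qt → let open NatSolver in r :+ (t :+ (t :+ qt)) := (r :+ qt) :+ (t :+ t)) ≡.refl r t (q ℕ.* t)))
    hℤ-vars -[1+ k ] zero          r r<t eq = refl
    hℤ-vars -[1+ k ] (suc zero)    r r<t eq = refl
    hℤ-vars -[1+ k ] (suc (suc q)) r r<t eq = contradiction small (ℕₚ.≤⇒≯ large)
      where
      small : r ℕ.+ suc (suc q) ℕ.* t ℕ.< t ℕ.+ t
      small = ≡.subst (r ℕ.+ suc (suc q) ℕ.* t ℕ.<_)
        (ℤₚ.+-injective (≡.trans (≡.cong (ℤ._+ + suc k) (≡.sym eq))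
          (IntSolver.solve 2 (λ a b → let open IntSolver in ((:- a) :+ b) :+ a := b) ≡.refl (+ suc k) (+ (t ℕ.+ t)))))
        (ℕₚ.m<m+n (r ℕ.+ suc (suc q) ℕ.* t) ℕ.z<s)
      large : t ℕ.+ t ℕ.≤ r ℕ.+ suc (suc q) ℕ.* t
      large = ℕₚ.≤-trans (ℕₚ.+-monoʳ-≤ t (ℕₚ.m≤m+n t (q ℕ.* t))) (ℕₚ.m≤n+m _ r)

-- Alternating forms on lists of rows, and determinants.

module AlternatingForms {c ℓ : Level} (R : CommutativeRing c ℓ) where
  open CommutativeRing R hiding (zero)
  open RingDefs R
  open IntegerEmbedding R
  open import Algebra.Properties.Ring ring using (-0#≈0#; -‿distribˡ-*)
  open import Algebra.Properties.Group +-group using (inverseˡ-unique)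
  open import Relation.Binary.Reasoning.Setoid setoid

  Row : Set c
  Row = ℕ → Carrier

  σ : ℕ → Carrier
  σ n = fromℤ (signℕ n)

  σ-suc : ∀ n → σ (suc n) ≈ - σ n
  σ-suc n = trans (reflexive (≡.cong fromℤ (signℕ-suc n))) (fromℤ-neg (signℕ n))

  σ-+ : ∀ m n → σ (m ℕ.+ n) ≈ σ m * σ n
  σ-+ m n = trans (reflexive (≡.cong fromℤ (signℕ-+ m n))) (fromℤ-* (signℕ m) (signℕ n))

  -- Forms on lists of rows, so that inner rows can be replaced inside a fixed context. `linear`
  -- takes the decomposition of a row pointwise; compatibility with pointwise equality of rows is
  -- thereby included.
  record IsAlternating (F : List Row → Carrier) : Set (c Level.⊔ ℓ) where
    field
      linear : ∀ p q {ρ σ₁ σ₂ : Row} a b → (∀ x → ρ x ≈ a * σ₁ x + b * σ₂ x) →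
               F (p ++ ρ ∷ q) ≈ a * F (p ++ σ₁ ∷ q) + b * F (p ++ σ₂ ∷ q)
      alternating : ∀ p q ρ → F (p ++ ρ ∷ ρ ∷ q) ≈ 0#

  open IsAlternating

  alternating-context : ∀ {F} → IsAlternating F → ∀ l r → IsAlternating (λ m → F (l ++ m ++ r))
  alternating-context {F} alt l r = record
    { linear = λ p q a b eq → trans (reflexive (F-assoc p _ q)) (trans (linear alt (l ++ p) (q ++ r) a b eq)
        (sym (+-cong (*-congˡ (reflexive (F-assoc p _ q))) (*-congˡ (reflexive (F-assoc p _ q))))))
    ; alternating = λ p q ρ → trans (reflexive (F-assoc p ρ (ρ ∷ q))) (alternating alt (l ++ p) (q ++ r) ρ) }
    where
    F-assoc : ∀ p ρ q → F (l ++ (p ++ ρ ∷ q) ++ r) ≡ F ((l ++ p) ++ ρ ∷ q ++ r)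
    F-assoc p ρ q = ≡.cong F (≡.trans (≡.cong (l ++_) (Listₚ.++-assoc p (ρ ∷ q) r)) (≡.sym (Listₚ.++-assoc l p (ρ ∷ q ++ r))))

  alternating-∷ : ∀ {F} → IsAlternating F → ∀ ρ → IsAlternating (λ m → F (ρ ∷ m))
  alternating-∷ alt ρ = record
    { linear = λ p → linear alt (ρ ∷ p) ; alternating = λ p → alternating alt (ρ ∷ p) }

  private
    -- Polarisation: the form vanishes on the sum `s` repeated twice, and two of the four terms of
    -- its expansion vanish as well.
    bilinear-swap : ∀ (G : Row → Row → Carrier) →
      (∀ {ρ σ₁ σ₂} τ a b → (∀ x → ρ x ≈ a * σ₁ x + b * σ₂ x) → G ρ τ ≈ a * G σ₁ τ + b * G σ₂ τ) →
      (∀ {ρ σ₁ σ₂} τ a b → (∀ x → ρ x ≈ a * σ₁ x + b * σ₂ x) → G τ ρ ≈ a * G τ σ₁ + b * G τ σ₂) →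
      (∀ ρ → G ρ ρ ≈ 0#) → ∀ ρ τ → G ρ τ ≈ - G τ ρ
    bilinear-swap G linˡ linʳ alt ρ τ = inverseˡ-unique _ _ (begin
      G ρ τ + G τ ρ
        ≈⟨ sym (+-cong (+-identityˡ _) (+-identityʳ _)) ⟩
      (0# + G ρ τ) + (G τ ρ + 0#)
        ≈⟨ sym (+-cong (+-congʳ (alt ρ)) (+-congˡ (alt τ))) ⟩
      (G ρ ρ + G ρ τ) + (G τ ρ + G τ τ)
        ≈⟨ sym (+-cong (one+ (G ρ ρ) (G ρ τ)) (one+ (G τ ρ) (G τ τ))) ⟩
      (1# * G ρ ρ + 1# * G ρ τ) + (1# * G τ ρ + 1# * G τ τ)
        ≈⟨ sym (+-cong (linʳ ρ 1# 1# (λ _ → refl)) (linʳ τ 1# 1# (λ _ → refl))) ⟩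
      G ρ s + G τ s
        ≈⟨ sym (one+ (G ρ s) (G τ s)) ⟩
      1# * G ρ s + 1# * G τ s
        ≈⟨ sym (linˡ s 1# 1# (λ _ → refl)) ⟩
      G s s
        ≈⟨ alt s ⟩
      0# ∎)
      where
      s : Row
      s x = 1# * ρ x + 1# * τ x
      one+ : ∀ a b → 1# * a + 1# * b ≈ a + b
      one+ a b = +-cong (*-identityˡ a) (*-identityˡ b)

  swap-head : ∀ {F} → IsAlternating F → ∀ ρ τ q → F (ρ ∷ τ ∷ q) ≈ - F (τ ∷ ρ ∷ q)
  swap-head {F} alt ρ τ q = bilinear-swap (λ ρ τ → F (ρ ∷ τ ∷ q))
    (λ τ → linear alt [] (τ ∷ q)) (λ τ → linear alt [ τ ] q) (alternating alt [] q) ρ τ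

  move : ∀ {F} → IsAlternating F → ∀ ρ m q → F (ρ ∷ m ++ q) ≈ σ (length m) * F (m ++ ρ ∷ q)
  move alt ρ []       q = sym (trans (*-congʳ fromℤ-1) (*-identityˡ _))
  move {F} alt ρ (τ ∷ m) q = begin
    F (ρ ∷ τ ∷ m ++ q)                           ≈⟨ swap-head alt ρ τ (m ++ q) ⟩
    - F (τ ∷ ρ ∷ m ++ q)                         ≈⟨ -‿cong (move (alternating-∷ alt τ) ρ m q) ⟩
    - (σ (length m) * F (τ ∷ m ++ ρ ∷ q))        ≈⟨ -‿distribˡ-* _ _ ⟩
    - σ (length m) * F (τ ∷ m ++ ρ ∷ q)          ≈⟨ *-congʳ (sym (σ-suc (length m))) ⟩
    σ (suc (length m)) * F (τ ∷ m ++ ρ ∷ q)      ∎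

  repeated : ∀ {F} → IsAlternating F → ∀ ρ m q → F (ρ ∷ m ++ ρ ∷ q) ≈ 0#
  repeated {F} alt ρ m q = trans (move alt ρ m (ρ ∷ q)) (trans (*-congˡ (alternating alt m q ρ)) (zeroʳ _))

  swap-apart : ∀ {F} → IsAlternating F → ∀ ρ τ m q → F (ρ ∷ m ++ τ ∷ q) ≈ - F (τ ∷ m ++ ρ ∷ q)
  swap-apart {F} alt ρ τ m q = bilinear-swap (λ ρ τ → F (ρ ∷ m ++ τ ∷ q))
    (λ τ → linear alt [] (m ++ τ ∷ q)) (λ τ → linear alt (τ ∷ m) q) (λ ρ → repeated alt ρ m q) ρ τ

  two-by-two : ∀ {F} → IsAlternating F → ∀ m q {ρ₁ ρ₂ e f} a b d g →
    (∀ x → ρ₁ x ≈ a * e x + b * f x) → (∀ x → ρ₂ x ≈ d * e x + g * f x) →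
    F (ρ₁ ∷ m ++ ρ₂ ∷ q) ≈ (a * g - b * d) * F (e ∷ m ++ f ∷ q)
  two-by-two {F} alt m q {ρ₁} {ρ₂} {e} {f} a b d g eq₁ eq₂ = begin
    F (ρ₁ ∷ m ++ ρ₂ ∷ q)
      ≈⟨ linear alt [] (m ++ ρ₂ ∷ q) a b eq₁ ⟩
    a * F (e ∷ m ++ ρ₂ ∷ q) + b * F (f ∷ m ++ ρ₂ ∷ q)
      ≈⟨ +-cong (*-congˡ (linear alt (e ∷ m) q d g eq₂)) (*-congˡ (linear alt (f ∷ m) q d g eq₂)) ⟩
    a * (d * F (e ∷ m ++ e ∷ q) + g * X) + b * (d * F (f ∷ m ++ e ∷ q) + g * F (f ∷ m ++ f ∷ q))
      ≈⟨ +-cong (*-congˡ (+-congʳ (*-congˡ (repeated alt e m q))))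
                (*-congˡ (+-cong (*-congˡ (swap-apart alt f e m q)) (*-congˡ (repeated alt f m q)))) ⟩
    a * (d * 0# + g * X) + b * (d * - X + g * 0#)
      ≈⟨ Solver.solve 5 (λ a b d g x → let open Solver in
           a :* (d :* con (+ 0) :+ g :* x) :+ b :* (d :* (:- x) :+ g :* con (+ 0)) := (a :* g :- b :* d) :* x)
           refl a b d g X ⟩
    (a * g - b * d) * X ∎
    where
    X : Carrier
    X = F (e ∷ m ++ f ∷ q)

  -- Once the first two rows have been replaced by `e` and `f`, every term of the third repeats one
  -- of them.
  three-dependent : ∀ {F} → IsAlternating F → ∀ q {ρ₁ ρ₂ ρ₃ e f} a₁ b₁ a₂ b₂ a₃ b₃ →
    (∀ x → ρ₁ x ≈ a₁ * e x + b₁ * f x) → (∀ x → ρ₂ x ≈ a₂ * e x + b₂ * f x) → (∀ x → ρ₃ x ≈ a₃ * e x + b₃ * f x) →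
    F (ρ₁ ∷ ρ₂ ∷ ρ₃ ∷ q) ≈ 0#
  three-dependent {F} alt q {ρ₁} {ρ₂} {ρ₃} {e} {f} a₁ b₁ a₂ b₂ a₃ b₃ eq₁ eq₂ eq₃ = begin
    F (ρ₁ ∷ ρ₂ ∷ ρ₃ ∷ q)
      ≈⟨ two-by-two alt [] (ρ₃ ∷ q) a₁ b₁ a₂ b₂ eq₁ eq₂ ⟩
    Δ * F (e ∷ f ∷ ρ₃ ∷ q)
      ≈⟨ *-congˡ (linear alt (e ∷ [ f ]) q a₃ b₃ eq₃) ⟩
    Δ * (a₃ * F (e ∷ f ∷ e ∷ q) + b₃ * F (e ∷ f ∷ f ∷ q))
      ≈⟨ *-congˡ (+-cong (*-congˡ (repeated alt e [ f ] q)) (*-congˡ (alternating alt [ e ] q f))) ⟩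
    Δ * (a₃ * 0# + b₃ * 0#)
      ≈⟨ *-congˡ (trans (+-cong (zeroʳ _) (zeroʳ _)) (+-identityʳ 0#)) ⟩
    Δ * 0#
      ≈⟨ zeroʳ _ ⟩
    0# ∎
    where
    Δ : Carrier
    Δ = a₁ * b₂ - b₁ * a₂

  -- The plane degenerates to a line when its two spanning rows coincide, that is at the middle
  -- residue of an odd `t`; hence the coordinates with `e` written twice.
  two-dependent : ∀ {F} → IsAlternating F → ∀ q {ρ₁ ρ₂ e} a₁ b₁ a₂ b₂ →
    (∀ x → ρ₁ x ≈ a₁ * e x + b₁ * e x) → (∀ x → ρ₂ x ≈ a₂ * e x + b₂ * e x) → F (ρ₁ ∷ ρ₂ ∷ q) ≈ 0#
  two-dependent {F} alt q {e = e} a₁ b₁ a₂ b₂ eq₁ eq₂ =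
    trans (two-by-two alt [] q a₁ b₁ a₂ b₂ eq₁ eq₂) (trans (*-congˡ (alternating alt [] q e)) (zeroʳ _))

  module _ {A : Set} (label : A → ℕ) (row : A → Row) where

    private
      smaller : A → List A → ℕ
      smaller x xs = length (filter (ℕ._<? label x) (map label xs))

      ε : List A → Carrier
      ε xs = σ (inversions (map label xs))

      ε-∷ : ∀ x xs → ε (x ∷ xs) ≈ σ (smaller x xs) * ε xs
      ε-∷ x xs = σ-+ (smaller x xs) (inversions (map label xs))

      smaller-↭ : ∀ x {xs ys} → xs ↭ ys → smaller x xs ≡ smaller x ys
      smaller-↭ x p = Permₚ.↭-length (Permₚ.filter-↭ (ℕ._<? label x) (Permₚ.map⁺ label p))

      ε-∷∷ : ∀ x y xs → ε (x ∷ y ∷ xs) ≈ σ (inv? (label x) (label y)) * (σ (smaller x xs) * (σ (smaller y xs) * ε xs))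
      ε-∷∷ x y xs = begin
        ε (x ∷ y ∷ xs)
          ≈⟨ ε-∷ x (y ∷ xs) ⟩
        σ (smaller x (y ∷ xs)) * ε (y ∷ xs)
          ≡⟨ ≡.cong (λ k → σ k * ε (y ∷ xs)) (count-<-∷ (label x) (label y) (map label xs)) ⟩
        σ (inv? (label x) (label y) ℕ.+ smaller x xs) * ε (y ∷ xs)
          ≈⟨ *-cong (σ-+ (inv? (label x) (label y)) (smaller x xs)) (ε-∷ y xs) ⟩
        (σ (inv? (label x) (label y)) * σ (smaller x xs)) * (σ (smaller y xs) * ε xs)
          ≈⟨ *-assoc _ _ _ ⟩
        σ (inv? (label x) (label y)) * (σ (smaller x xs) * (σ (smaller y xs) * ε xs)) ∎

    -- Each side carries its own sign, so the claim composes along a derivation of `xs ↭ ys` without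
    -- defining the sign of the permutation itself. An adjacent swap changes one inversion, because
    -- the labels are distinct, and `F` by a sign.
    permutation-sign : ∀ {F} → IsAlternating F → ∀ {xs ys} → xs ↭ ys → AllPairs (λ x y → label x ≢ label y) xs →
                       σ (inversions (map label xs)) * F (map row xs) ≈ σ (inversions (map label ys)) * F (map row ys)
    permutation-sign alt Perm.refl _ = refl
    permutation-sign {F} alt {x ∷ xs} {_ ∷ ys} (Perm.prep _ p) (_ ∷ u) = begin
      ε (x ∷ xs) * F (row x ∷ map row xs)                     ≈⟨ trans (*-congʳ (ε-∷ x xs)) (*-assoc _ _ _) ⟩
      σ (smaller x xs) * (ε xs * F (row x ∷ map row xs))        ≈⟨ *-cong (reflexive (≡.cong σ (smaller-↭ x p)))
                                                                         (permutation-sign (alternating-∷ alt (row x)) p u) ⟩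
      σ (smaller x ys) * (ε ys * F (row x ∷ map row ys))        ≈⟨ sym (trans (*-congʳ (ε-∷ x ys)) (*-assoc _ _ _)) ⟩
      ε (x ∷ ys) * F (row x ∷ map row ys)                     ∎
    permutation-sign {F} alt {x ∷ y ∷ xs} {_ ∷ _ ∷ ys} (Perm.swap _ _ p) ((x≢y ∷ _) ∷ (_ ∷ u)) = begin
      ε (x ∷ y ∷ xs) * F (row x ∷ row y ∷ map row xs)
        ≈⟨ *-cong (ε-∷∷ x y xs) (swap-head alt (row x) (row y) (map row xs)) ⟩
      (σ (inv? (label x) (label y)) * (σ (smaller x xs) * (σ (smaller y xs) * ε xs))) * - F (row y ∷ row x ∷ map row xs)
        ≈⟨ *-congʳ (*-cong (trans (reflexive (≡.cong fromℤ (signℕ-inv? (label x) (label y) x≢y))) (fromℤ-neg (signℕ (inv? (label y) (label x)))))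
             (*-cong (reflexive (≡.cong σ (smaller-↭ x p))) (*-congʳ (reflexive (≡.cong σ (smaller-↭ y p)))))) ⟩
      (- i * (cx * (cy * ε xs))) * - F (row y ∷ row x ∷ map row xs)
        ≈⟨ Solver.solve 5 (λ i cx cy e f → let open Solver in
             ((:- i) :* (cx :* (cy :* e))) :* (:- f) := (i :* (cy :* cx)) :* (e :* f))
             refl i cx cy (ε xs) (F (row y ∷ row x ∷ map row xs)) ⟩
      (i * (cy * cx)) * (ε xs * F (row y ∷ row x ∷ map row xs))
        ≈⟨ *-congˡ (permutation-sign (alternating-∷ (alternating-∷ alt (row y)) (row x)) p u) ⟩
      (i * (cy * cx)) * (ε ys * F (row y ∷ row x ∷ map row ys))
        ≈⟨ Solver.solve 5 (λ i cx cy e f → let open Solver in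
             (i :* (cy :* cx)) :* (e :* f) := (i :* (cy :* (cx :* e))) :* f)
             refl i cx cy (ε ys) (F (row y ∷ row x ∷ map row ys)) ⟩
      (i * (cy * (cx * ε ys))) * F (row y ∷ row x ∷ map row ys)
        ≈⟨ *-congʳ (sym (ε-∷∷ y x ys)) ⟩
      ε (y ∷ x ∷ ys) * F (row y ∷ row x ∷ map row ys) ∎
      where
      i cx cy : Carrier
      i  = σ (inv? (label y) (label x))
      cx = σ (smaller x ys)
      cy = σ (smaller y ys)
    permutation-sign alt (Perm.trans p q) u =
      trans (permutation-sign alt p u) (permutation-sign alt q (AllPairs-resp-↭ (λ ne eq → ne (≡.sym eq)) p u))

  -- The contraction of a function on column lists by a row; first-row Laplace expansion is
  -- such a contraction, and contractions anticommute.
  contract : Row → (List ℕ → Carrier) → List ℕ → Carrier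
  contract ρ f []       = 0#
  contract ρ f (x ∷ xs) = ρ x * f xs - contract ρ (λ ys → f (x ∷ ys)) xs

  -- The minor with rows `ρs` and columns `xs`; it is 0 when the numbers of rows and columns differ.
  D : List Row → List ℕ → Carrier
  D []       []      = 1#
  D []       (_ ∷ _) = 0#
  D (ρ ∷ ρs) xs      = contract ρ (D ρs) xs

  contract-linearˡ : ∀ {ρ σ₁ σ₂} a b f → (∀ x → ρ x ≈ a * σ₁ x + b * σ₂ x) →
                     ∀ xs → contract ρ f xs ≈ a * contract σ₁ f xs + b * contract σ₂ f xs
  contract-linearˡ a b f eq []       = sym (trans (+-cong (zeroʳ a) (zeroʳ b)) (+-identityʳ 0#))
  contract-linearˡ {ρ} {σ₁} {σ₂} a b f eq (x ∷ xs) = trans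
    (+-cong (*-congʳ (eq x)) (-‿cong (contract-linearˡ a b (f ∘ (x ∷_)) eq xs)))
    (Solver.solve 7 (λ a b s₁ s₂ f k₁ k₂ → let open Solver in
       (a :* s₁ :+ b :* s₂) :* f :- (a :* k₁ :+ b :* k₂) := a :* (s₁ :* f :- k₁) :+ b :* (s₂ :* f :- k₂))
       refl a b (σ₁ x) (σ₂ x) (f xs) (contract σ₁ (f ∘ (x ∷_)) xs) (contract σ₂ (f ∘ (x ∷_)) xs))

  contract-linearʳ : ∀ ρ a b {f g₁ g₂ : List ℕ → Carrier} → (∀ xs → f xs ≈ a * g₁ xs + b * g₂ xs) →
                     ∀ xs → contract ρ f xs ≈ a * contract ρ g₁ xs + b * contract ρ g₂ xs
  contract-linearʳ ρ a b eq []       = sym (trans (+-cong (zeroʳ a) (zeroʳ b)) (+-identityʳ 0#))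
  contract-linearʳ ρ a b {f} {g₁} {g₂} eq (x ∷ xs) = trans
    (+-cong (*-congˡ (eq xs)) (-‿cong (contract-linearʳ ρ a b (λ ys → eq (x ∷ ys)) xs)))
    (Solver.solve 7 (λ a b r g₁ g₂ k₁ k₂ → let open Solver in
       r :* (a :* g₁ :+ b :* g₂) :- (a :* k₁ :+ b :* k₂) := a :* (r :* g₁ :- k₁) :+ b :* (r :* g₂ :- k₂))
       refl a b (ρ x) (g₁ xs) (g₂ xs) (contract ρ (g₁ ∘ (x ∷_)) xs) (contract ρ (g₂ ∘ (x ∷_)) xs))

  contract-zero : ∀ ρ {f : List ℕ → Carrier} → (∀ xs → f xs ≈ 0#) → ∀ xs → contract ρ f xs ≈ 0#
  contract-zero ρ eq []       = refl
  contract-zero ρ eq (x ∷ xs) = trans (+-cong (trans (*-congˡ (eq xs)) (zeroʳ _))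
    (trans (-‿cong (contract-zero ρ (λ ys → eq (x ∷ ys)) xs)) -0#≈0#)) (+-identityʳ 0#)

  -- If the first column is used by exactly one of the two contractions, the two possibilities
  -- cancel; if by neither, the claim for the shorter column list applies.
  contract² : ∀ ρ f xs → contract ρ (contract ρ f) xs ≈ 0#
  contract² ρ f []       = refl
  contract² ρ f (x ∷ xs) = begin
    ρ x * k - contract ρ (λ ys → ρ x * f ys - contract ρ (f ∘ (x ∷_)) ys) xs
      ≈⟨ +-congˡ (-‿cong (contract-linearʳ ρ (ρ x) (- 1#)
           (λ ys → +-congˡ (sym (trans (sym (-‿distribˡ-* 1# _)) (-‿cong (*-identityˡ _))))) xs)) ⟩
    ρ x * k - (ρ x * k + - 1# * contract ρ (contract ρ (f ∘ (x ∷_))) xs)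
      ≈⟨ +-congˡ (-‿cong (+-congˡ (*-congˡ (contract² ρ (f ∘ (x ∷_)) xs)))) ⟩
    ρ x * k - (ρ x * k + - 1# * 0#)
      ≈⟨ +-congˡ (-‿cong (trans (+-congˡ (zeroʳ _)) (+-identityʳ _))) ⟩
    ρ x * k - ρ x * k
      ≈⟨ -‿inverseʳ _ ⟩
    0# ∎
    where
    k : Carrier
    k = contract ρ f xs

  D-alternating : ∀ xs → IsAlternating (λ ρs → D ρs xs)
  D-alternating xs = record { linear = λ p q a b eq → D-linear p q a b eq xs ; alternating = λ p q ρ → D-alt p q ρ xs }
    where
    D-linear : ∀ p q {ρ σ₁ σ₂ : Row} a b → (∀ x → ρ x ≈ a * σ₁ x + b * σ₂ x) →
               ∀ xs → D (p ++ ρ ∷ q) xs ≈ a * D (p ++ σ₁ ∷ q) xs + b * D (p ++ σ₂ ∷ q) xs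
    D-linear []      q a b eq = contract-linearˡ a b (D q) eq
    D-linear (τ ∷ p) q a b eq = contract-linearʳ τ a b (D-linear p q a b eq)
    D-alt : ∀ p q ρ xs → D (p ++ ρ ∷ ρ ∷ q) xs ≈ 0#
    D-alt []      q ρ = contract² ρ (D q)
    D-alt (τ ∷ p) q ρ = contract-zero τ (D-alt p q ρ)

  contract-tabulate : ∀ n ρ f (col : Fin (suc n) → ℕ) →
    contract ρ f (tabulate col) ≈
    sumR (tabulate (λ j → σ (toℕ j) * (ρ (col j) * f (tabulate (col ∘ punchIn j)))))
  contract-tabulate zero    ρ f col = +-cong (sym (trans (*-congʳ fromℤ-1) (*-identityˡ _))) -0#≈0#
  contract-tabulate (suc n) ρ f col = +-cong (sym (trans (*-congʳ fromℤ-1) (*-identityˡ _)))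
    (trans (-‿cong (contract-tabulate n ρ (f ∘ (col Fin.zero ∷_)) (col ∘ Fin.suc)))
           (negate (suc n) (λ j → toℕ j) (λ j → ρ (col (Fin.suc j)) * f (col Fin.zero ∷ tabulate (col ∘ Fin.suc ∘ punchIn j)))))
    where
    negate : ∀ m (k : Fin m → ℕ) (g : Fin m → Carrier) →
             - sumR (tabulate (λ j → σ (k j) * g j)) ≈ sumR (tabulate (λ j → σ (suc (k j)) * g j))
    negate zero    k g = -0#≈0#
    negate (suc m) k g = begin
      - (σ (k Fin.zero) * g Fin.zero + S)
        ≈⟨ Solver.solve 3 (λ a b s → let open Solver in :- (a :* b :+ s) := (:- a) :* b :+ (:- s)) refl (σ (k Fin.zero)) (g Fin.zero) S ⟩
      - σ (k Fin.zero) * g Fin.zero - S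
        ≈⟨ +-cong (*-congʳ (sym (σ-suc (k Fin.zero)))) (negate m (k ∘ Fin.suc) (g ∘ Fin.suc)) ⟩
      σ (suc (k Fin.zero)) * g Fin.zero + sumR (tabulate (λ j → σ (suc (k (Fin.suc j))) * g (Fin.suc j))) ∎
      where
      S : Carrier
      S = sumR (tabulate (λ j → σ (k (Fin.suc j)) * g (Fin.suc j)))

  sumR-tabulate-cong : ∀ {n} {f g : Fin n → Carrier} → (∀ i → f i ≈ g i) → sumR (tabulate f) ≈ sumR (tabulate g)
  sumR-tabulate-cong {zero}  eq = refl
  sumR-tabulate-cong {suc n} eq = +-cong (eq Fin.zero) (sumR-tabulate-cong (eq ∘ Fin.suc))

  det≈D : ∀ n (m : Fin n → Fin n → Carrier) (ρ : Fin n → Row) (col : Fin n → ℕ) →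
          (∀ i j → m i j ≈ ρ i (col j)) → det n m ≈ D (tabulate ρ) (tabulate col)
  det≈D zero    m ρ col eq = refl
  det≈D (suc n) m ρ col eq = begin
    det (suc n) m
      ≡⟨ ≡.cong sumR (Listₚ.map-tabulate {n = suc n} id term) ⟩
    sumR (tabulate term)
      ≈⟨ sumR-tabulate-cong {f = term} (λ j → *-congˡ (*-cong (eq Fin.zero j)
           (det≈D n (λ r s → m (Fin.suc r) (punchIn j s)) (ρ ∘ Fin.suc) (col ∘ punchIn j)
                  (λ r s → eq (Fin.suc r) (punchIn j s))))) ⟩
    sumR (tabulate (λ j → σ (toℕ j) * (ρ Fin.zero (col j) * D (tabulate (ρ ∘ Fin.suc)) (tabulate (col ∘ punchIn j)))))
      ≈⟨ sym (contract-tabulate n (ρ Fin.zero) (D (tabulate (ρ ∘ Fin.suc))) col) ⟩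
    D (tabulate ρ) (tabulate col) ∎
    where
    term : Fin (suc n) → Carrier
    term j = σ (toℕ j) * (m Fin.zero j * det n (λ r s → m (Fin.suc r) (punchIn j s)))

  -- The unitriangular rows.

  u : ℕ → Row
  u s x = if does (s ℕ.≤? x) then 1# else 0#

  D-zero-column : ∀ {ρs} x → All (λ ρ → ρ x ≈ 0#) ρs → ∀ xs → D ρs (x ∷ xs) ≈ 0#
  D-zero-column x []       xs = refl
  D-zero-column {ρ ∷ _} x (z ∷ zs) xs = trans
    (+-cong (trans (*-congʳ z) (zeroˡ _)) (trans (-‿cong (contract-zero ρ (D-zero-column x zs) xs)) -0#≈0#))
    (+-identityʳ 0#)

  u-≤ : ∀ {s x} → s ℕ.≤ x → u s x ≈ 1#
  u-≤ {s} {x} s≤x rewrite dec-true (s ℕ.≤? x) s≤x = refl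

  u-> : ∀ {s x} → x ℕ.< s → u s x ≈ 0#
  u-> {s} {x} x<s rewrite dec-false (s ℕ.≤? x) (ℕₚ.<⇒≱ x<s) = refl

  -- The value 1 normalises the form. Deleting the first row and column replaces `k` by `suc k`, and
  -- the terms from the other columns vanish because all later rows are zero in column `k`.
  D-unitriangular : ∀ n k → D (applyUpTo (u ∘ (k ℕ.+_)) n) (applyUpTo (k ℕ.+_) n) ≈ 1#
  D-unitriangular zero    k = refl
  D-unitriangular (suc n) k = begin
    u (k ℕ.+ 0) (k ℕ.+ 0) * D rows cols - contract (u (k ℕ.+ 0)) (λ ys → D rows (k ℕ.+ 0 ∷ ys)) cols
      ≈⟨ +-cong (*-cong (u-≤ (ℕₚ.≤-refl {k ℕ.+ 0})) (trans (reflexive (≡.cong₂ D (shift u) (shift id))) (D-unitriangular n (suc k))))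
                (-‿cong (contract-zero (u (k ℕ.+ 0)) (D-zero-column (k ℕ.+ 0) (zeros n (λ i → k ℕ.+ suc i) (λ i → ℕₚ.+-monoʳ-< k ℕ.z<s))) cols)) ⟩
    1# * 1# - 0#
      ≈⟨ +-cong (*-identityˡ 1#) -0#≈0# ⟩
    1# + 0#
      ≈⟨ +-identityʳ 1# ⟩
    1# ∎
    where
    rows : List Row
    rows = applyUpTo (λ i → u (k ℕ.+ suc i)) n
    cols : List ℕ
    cols = applyUpTo (λ i → k ℕ.+ suc i) n
    shift : ∀ {a} {A : Set a} (g : ℕ → A) → applyUpTo (λ i → g (k ℕ.+ suc i)) n ≡ applyUpTo (λ i → g (suc k ℕ.+ i)) n
    shift g = applyUpTo-cong (λ i → ≡.cong g (ℕₚ.+-suc k i)) n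
    zeros : ∀ n (f : ℕ → ℕ) → (∀ i → k ℕ.+ 0 ℕ.< f i) → All (λ ρ → ρ (k ℕ.+ 0) ≈ 0#) (applyUpTo (u ∘ f) n)
    zeros zero    f lt = []
    zeros (suc n) f lt = u-> (lt 0) ∷ zeros n (f ∘ suc) (lt ∘ suc)

-- The rows of the determinant.

module Entries {c ℓ : Level} (R : CommutativeRing c ℓ) where
  open CommutativeRing R hiding (zero)
  open RingDefs R
  open IntegerEmbedding R
  open CompleteHomogeneous R
  open AlternatingForms R
  open import Algebra.Properties.Ring ring using (-0#≈0#)
  open import Relation.Binary.Reasoning.Setoid setoid

  row : ℕ → ℕ → Row
  row t x j = fromℕ (suc (quo t x)) * u (t ℕ.∸ suc (res t x)) j + fromℕ (quo t x) * u (res t x) j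

  triangular-pred : ∀ c → triangular c ≈ fromℕ c + triangular (c ℕ.∸ 1)
  triangular-pred zero    = sym (+-identityʳ 0#)
  triangular-pred (suc c) = refl

  module _ (dom : IntegralDomain) (n : ℕ) (ω : Carrier) (prim : PrimitiveRoot (suc n) ω) where
    private
      t : ℕ
      t = suc n

    -- With x = r + qt, the two indices are x - t ± (j+1). Going up passes one more multiple of `t`
    -- exactly when `t ∸ suc r ≤ j`, which adds `suc q` to `T`; going down passes one more exactly
    -- when `r ≤ j`, which subtracts `q` from `T`. The common `T` cancels.
    entry≈row : ∀ l i j → i ℕ.< t → j ℕ.< t →
      hℤ (+ l ℤ.- + suc i ℤ.+ + suc j) (vars t ω) - hℤ (+ l ℤ.- + suc i ℤ.- + suc j) (vars t ω)
      ≈ row t (l ℕ.+ (t ℕ.∸ suc i)) j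
    entry≈row l i j i<t j<t = begin
      hℤ (X ℤ.+ + suc j) (vars t ω) - hℤ (X ℤ.- + suc j) (vars t ω)
        ≈⟨ +-cong upper (-‿cong lower) ⟩
      (a + T) - (T - b)
        ≈⟨ Solver.solve 3 (λ a b T → let open Solver in (a :+ T) :- (T :- b) := a :+ b) refl a b T ⟩
      a + b ∎
      where
      x r q : ℕ
      x = l ℕ.+ (t ℕ.∸ suc i)
      r = x % t
      q = x / t
      X : ℤ
      X = + l ℤ.- + suc i
      a b T : Carrier
      a = fromℕ (suc q) * u (t ℕ.∸ suc r) j
      b = fromℕ q * u r j
      T = triangular q
      r<t : r ℕ.< t
      r<t = m%n<n x t
      x≡ : x ≡ r ℕ.+ q ℕ.* t
      x≡ = m≡m%n+[m/n]*n x t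

      X+t : X ℤ.+ + t ≡ + x
      X+t = ≡.trans (IntSolver.solve 3 (λ l i t → let open IntSolver in (l :- i) :+ t := (l :+ t) :- i) ≡.refl (+ l) (+ suc i) (+ t))
        (≡.trans (≡.cong (λ k → + k ℤ.- + suc i) l+t≡)
          (IntSolver.solve 2 (λ x i → let open IntSolver in (x :+ i) :- i := x) ≡.refl (+ x) (+ suc i)))
        where
        l+t≡ : l ℕ.+ t ≡ x ℕ.+ suc i
        l+t≡ = ≡.sym (≡.trans (ℕₚ.+-assoc l _ _) (≡.cong (l ℕ.+_) (ℕₚ.m∸n+n≡m i<t)))

      shift⁺ : ∀ y → x ℕ.+ suc j ℕ.+ t ≡ y → (X ℤ.+ + suc j) ℤ.+ + (t ℕ.+ t) ≡ + y
      shift⁺ y eq = ≡.trans (IntSolver.solve 3 (λ X j t → let open IntSolver in (X :+ j) :+ (t :+ t) := ((X :+ t) :+ j) :+ t) ≡.refl X (+ suc j) (+ t))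
        (≡.trans (≡.cong (λ k → (k ℤ.+ + suc j) ℤ.+ + t) X+t) (≡.cong +_ eq))

      shift⁻ : ∀ y → y ℕ.+ suc j ≡ x ℕ.+ t → (X ℤ.- + suc j) ℤ.+ + (t ℕ.+ t) ≡ + y
      shift⁻ y eq = ≡.trans (IntSolver.solve 3 (λ X j t → let open IntSolver in (X :- j) :+ (t :+ t) := ((X :+ t) :+ t) :- j) ≡.refl X (+ suc j) (+ t))
        (≡.trans (≡.cong (λ k → (k ℤ.+ + t) ℤ.- + suc j) X+t) (≡.trans (≡.cong (λ k → + k ℤ.- + suc j) (≡.sym eq))
          (IntSolver.solve 2 (λ x i → let open IntSolver in (x :+ i) :- i := x) ≡.refl (+ y) (+ suc j))))

      upper : hℤ (X ℤ.+ + suc j) (vars t ω) ≈ a + T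
      upper with r ℕ.+ suc j ℕ.<? t
      ... | yes lt = trans (hℤ-vars dom n ω prim (X ℤ.+ + suc j) (suc q) (r ℕ.+ suc j) lt (shift⁺ _ eq))
                       (sym (trans (+-congʳ (trans (*-congˡ (u-> j<)) (zeroʳ _))) (+-identityˡ _)))
        where
        eq : x ℕ.+ suc j ℕ.+ t ≡ r ℕ.+ suc j ℕ.+ suc q ℕ.* t
        eq = ≡.trans (≡.cong (λ k → k ℕ.+ suc j ℕ.+ t) x≡)
          (NatSolver.solve 4 (λ r qt j t → let open NatSolver in ((r :+ qt) :+ j) :+ t := (r :+ j) :+ (t :+ qt)) ≡.refl r (q ℕ.* t) (suc j) t)
        j< : j ℕ.< t ℕ.∸ suc r
        j< = ℕₚ.m+n≤o⇒m≤o∸n (suc j) (≡.subst (ℕ._≤ t) (≡.trans (≡.sym (ℕₚ.+-suc r (suc j))) (≡.trans (ℕₚ.+-comm r _) (≡.sym (ℕₚ.+-suc (suc j) r)))) lt)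
      ... | no nlt = trans (hℤ-vars dom n ω prim (X ℤ.+ + suc j) (suc (suc q)) r′ r′<t (shift⁺ _ eq))
                       (+-congʳ (sym (trans (*-congˡ (u-≤ ≤j)) (*-identityʳ _))))
        where
        r′ : ℕ
        r′ = r ℕ.+ suc j ℕ.∸ t
        r′+t : r′ ℕ.+ t ≡ r ℕ.+ suc j
        r′+t = ℕₚ.m∸n+n≡m (ℕₚ.≮⇒≥ nlt)
        r′<t : r′ ℕ.< t
        r′<t = ℕₚ.+-cancelʳ-< t r′ t (≡.subst (ℕ._< t ℕ.+ t) (≡.sym r′+t) (ℕₚ.+-mono-<-≤ r<t j<t))
        eq : x ℕ.+ suc j ℕ.+ t ≡ r′ ℕ.+ suc (suc q) ℕ.* t
        eq = ≡.trans (≡.cong (λ k → k ℕ.+ suc j ℕ.+ t) x≡)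
          (≡.trans (NatSolver.solve 4 (λ r qt j t → let open NatSolver in ((r :+ qt) :+ j) :+ t := (r :+ j) :+ (t :+ qt)) ≡.refl r (q ℕ.* t) (suc j) t)
          (≡.trans (≡.cong (ℕ._+ (t ℕ.+ q ℕ.* t)) (≡.sym r′+t)) (ℕₚ.+-assoc r′ t _)))
        ≤j : t ℕ.∸ suc r ℕ.≤ j
        ≤j = ℕₚ.m≤n+o⇒m∸n≤o t (suc r) (ℕₚ.≤-trans (ℕₚ.≮⇒≥ nlt) (ℕₚ.≤-reflexive (ℕₚ.+-suc r j)))

      lower : hℤ (X ℤ.- + suc j) (vars t ω) ≈ T - b
      lower with r ℕ.≤? j
      ... | no r≰j = trans (hℤ-vars dom n ω prim (X ℤ.- + suc j) (suc q) r′ (ℕₚ.≤-<-trans (ℕₚ.m∸n≤m r (suc j)) r<t) (shift⁻ _ eq))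
                       (sym (trans (+-congˡ (trans (-‿cong (trans (*-congˡ (u-> (ℕₚ.≰⇒> r≰j))) (zeroʳ _))) -0#≈0#)) (+-identityʳ _)))
        where
        r′ : ℕ
        r′ = r ℕ.∸ suc j
        eq : r′ ℕ.+ suc q ℕ.* t ℕ.+ suc j ≡ x ℕ.+ t
        eq = ≡.trans (NatSolver.solve 4 (λ r qt j t → let open NatSolver in (r :+ (t :+ qt)) :+ j := ((r :+ j) :+ qt) :+ t) ≡.refl r′ (q ℕ.* t) (suc j) t)
          (≡.cong (ℕ._+ t) (≡.trans (≡.cong (ℕ._+ q ℕ.* t) (ℕₚ.m∸n+n≡m (ℕₚ.≰⇒> r≰j))) (≡.sym x≡)))
      ... | yes r≤j = trans (hℤ-vars dom n ω prim (X ℤ.- + suc j) q r′ r′<t (shift⁻ _ eq)) (begin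
          triangular (q ℕ.∸ 1)
            ≈⟨ Solver.solve 2 (λ a b → let open Solver in a := (b :+ a) :- b) refl (triangular (q ℕ.∸ 1)) (fromℕ q) ⟩
          (fromℕ q + triangular (q ℕ.∸ 1)) - fromℕ q
            ≈⟨ +-cong (sym (triangular-pred q)) (-‿cong (sym (trans (*-congˡ (u-≤ r≤j)) (*-identityʳ _)))) ⟩
          T - b ∎)
        where
        r′ : ℕ
        r′ = t ℕ.+ r ℕ.∸ suc j
        r′+j : r′ ℕ.+ suc j ≡ t ℕ.+ r
        r′+j = ℕₚ.m∸n+n≡m (ℕₚ.≤-trans j<t (ℕₚ.m≤m+n t r))
        r′<t : r′ ℕ.< t
        r′<t = ℕₚ.+-cancelʳ-< (suc j) r′ t (≡.subst (ℕ._< t ℕ.+ suc j) (≡.sym r′+j) (ℕₚ.+-monoʳ-< t (ℕ.s≤s r≤j)))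
        eq : r′ ℕ.+ q ℕ.* t ℕ.+ suc j ≡ x ℕ.+ t
        eq = ≡.trans (NatSolver.solve 3 (λ r qt j → let open NatSolver in (r :+ qt) :+ j := (r :+ j) :+ qt) ≡.refl r′ (q ℕ.* t) (suc j))
          (≡.trans (≡.cong (ℕ._+ q ℕ.* t) r′+j) (≡.trans
            (NatSolver.solve 3 (λ t r qt → let open NatSolver in (t :+ r) :+ qt := (r :+ qt) :+ t) ≡.refl t r (q ℕ.* t))
            (≡.cong (ℕ._+ t) (≡.sym x≡))))

-- The factor and the sign of a pair of runners.

quotientOf : ℕ → List ℕ → List ℕ
quotientOf t xs = map (λ jx → quo t (proj₂ jx) ℕ.+ proj₁ jx ℕ.∸ length xs) (indexed xs)

factorOf : ℕ → List ℕ → List ℕ → ℤ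
factorOf t xs ys = + part (quotientOf t xs) 1 ℤ.+ + part (quotientOf t ys) 1
                   ℤ.- + part (quotientOf t xs) 2 ℤ.- + part (quotientOf t ys) 2 ℤ.+ + 1

-- For `(a , b)` equal to `(2 , 0)`, `(1 , 1)`, `(0 , 2)` the binomial is 0, 1, 3 and gives the sign
-- of the 2×2 determinant. The truncated sum is 1 when both beads share a runner and 0 otherwise: it
-- counts the row carried across the middle, and `o` is the parity of that distance.
exponent : ℕ → ℕ → ℕ → ℕ
exponent o a b = choose2 (b ℕ.+ 1) ℕ.+ o ℕ.* ((a ℕ.∸ 1) ℕ.+ (b ℕ.∸ 1))

quo-< : ∀ n {x y} → res (suc n) x ≡ res (suc n) y → y ℕ.< x → quo (suc n) y ℕ.< quo (suc n) x
quo-< n {x} {y} eq y<x = ℕₚ.≰⇒> (λ qx≤qy → ℕₚ.<⇒≱ y<x (ℕₚ.≤-trans (ℕₚ.≤-reflexive (m≡m%n+[m/n]*n x (suc n)))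
  (ℕₚ.≤-trans (ℕₚ.+-mono-≤ (ℕₚ.≤-reflexive eq) (ℕₚ.*-monoˡ-≤ (suc n) qx≤qy)) (ℕₚ.≤-reflexive (≡.sym (m≡m%n+[m/n]*n y (suc n)))))))

part₁-one : ∀ t x → part (quotientOf t [ x ]) 1 ≡ quo t x
part₁-one t x = ℕₚ.m+n∸n≡m (quo t x) 1

part₁-two : ∀ t x y {a} → quo t x ≡ suc a → part (quotientOf t (x ∷ [ y ])) 1 ≡ a
part₁-two t x y {a} eq = ≡.trans (≡.cong (λ k → k ℕ.+ 1 ℕ.∸ 2) eq) (ℕₚ.m+n∸n≡m a 1)

part₂-two : ∀ t x y → part (quotientOf t (x ∷ [ y ])) 2 ≡ quo t y
part₂-two t x y = ℕₚ.m+n∸n≡m (quo t y) 2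

factorOf-20 : ∀ t x y {a} → quo t x ≡ suc a → factorOf t (x ∷ [ y ]) [] ≡ + a ℤ.- + quo t y ℤ.+ + 1
factorOf-20 t x y {a} eq rewrite part₁-two t x y eq | part₂-two t x y =
  IntSolver.solve 2 (λ a b → let open IntSolver in a :+ con (+ 0) :- b :- con (+ 0) :+ con (+ 1) := a :- b :+ con (+ 1)) ≡.refl (+ a) (+ quo t y)

factorOf-02 : ∀ t x y {a} → quo t x ≡ suc a → factorOf t [] (x ∷ [ y ]) ≡ + a ℤ.- + quo t y ℤ.+ + 1
factorOf-02 t x y {a} eq rewrite part₁-two t x y eq | part₂-two t x y =
  IntSolver.solve 2 (λ a b → let open IntSolver in con (+ 0) :+ a :- con (+ 0) :- b :+ con (+ 1) := a :- b :+ con (+ 1)) ≡.refl (+ a) (+ quo t y)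

factorOf-11 : ∀ t x y → factorOf t [ x ] [ y ] ≡ + quo t x ℤ.+ + quo t y ℤ.+ + 1
factorOf-11 t x y rewrite part₁-one t x | part₁-one t y =
  IntSolver.solve 2 (λ a b → let open IntSolver in a :+ b :- con (+ 0) :- con (+ 0) :+ con (+ 1) := a :+ b :+ con (+ 1)) ≡.refl (+ quo t x) (+ quo t y)

record Runner (t i : ℕ) (xs : List ℕ) : Set where
  field
    residues   : All (λ x → res t x ≡ i) xs
    decreasing : StrictlyDecreasing xs

-- The upper of two beads on a runner is at a positive level, so the first part of the quotient, its
-- level minus 1, involves no truncation.
top-quotient : ∀ n {i x y} → Runner (suc n) i (x ∷ [ y ]) → ∃ λ a → quo (suc n) x ≡ suc a × quo (suc n) y ℕ.≤ a
top-quotient n {x = x} {y} r = go (quo (suc n) x) ≡.refl (quo-< n (≡.trans rx (≡.sym ry)) y<x)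
  where
  rx = All.head (Runner.residues r)
  ry = All.head (All.tail (Runner.residues r))
  y<x = All.head (AllPairs.head (Runner.decreasing r))
  go : ∀ k → quo (suc n) x ≡ k → quo (suc n) y ℕ.< k → ∃ λ a → quo (suc n) x ≡ suc a × quo (suc n) y ℕ.≤ a
  go (suc a) eq lt = a , eq , ℕ.s≤s⁻¹ lt

gap≢0 : ∀ {a b} → b ℕ.≤ a → + a ℤ.- + b ℤ.+ + 1 ≢ + 0
gap≢0 {a} {b} b≤a eq with () ← ≡.trans (≡.sym (≡.trans (≡.cong (ℤ._+ + 1) (≡.trans (ℤₚ.m-n≡m⊖n a b) (ℤₚ.⊖-≥ b≤a))) (≡.cong +_ (ℕₚ.+-comm (a ℕ.∸ b) 1)))) eq

factorOf≢0 : ∀ n {i i′ xs ys} → Runner (suc n) i xs → Runner (suc n) i′ ys → length xs ℕ.+ length ys ≡ 2 →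
             factorOf (suc n) xs ys ≢ + 0
factorOf≢0 n {xs = x ∷ y ∷ []} {[]} rx ry len eq with a , q≡ , le ← top-quotient n rx =
  gap≢0 le (≡.trans (≡.sym (factorOf-20 (suc n) x y q≡)) eq)
factorOf≢0 n {xs = x ∷ []} {y ∷ []} rx ry len eq with () ← ≡.trans (≡.cong +_ (ℕₚ.+-comm 1 (quo (suc n) x ℕ.+ quo (suc n) y)))
  (≡.trans (≡.sym (factorOf-11 (suc n) x y)) eq)
factorOf≢0 n {xs = []} {x ∷ y ∷ []} rx ry len eq with a , q≡ , le ← top-quotient n ry =
  gap≢0 le (≡.trans (≡.sym (factorOf-02 (suc n) x y q≡)) eq)
factorOf≢0 n {xs = x ∷ y ∷ []} {z ∷ ys} rx ry () eq
factorOf≢0 n {xs = x ∷ y ∷ z ∷ xs} rx ry () eq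

-- Evaluation of the form on pairs of runners.

module Evaluation {c ℓ : Level} (R : CommutativeRing c ℓ) where
  open CommutativeRing R hiding (zero)
  open RingDefs R
  open IntegerEmbedding R
  open AlternatingForms R
  open Entries R
  open import Relation.Binary.Reasoning.Setoid setoid

  -- The inner rows are replaced first, so that the number of rows between the outer pair of
  -- blocks is known modulo 2 when a row has to be moved across them.
  window : ∀ o p (B : ℕ → List Row) (e : ℕ → Row) (w : ℕ → ℤ) (v : ℤ) →
    (∀ i → i ℕ.< p → ∀ {G} → IsAlternating G → ∀ m → signℕ (length m) ≡ signℕ o →
       G (B i ++ m ++ B (win o p ℕ.∸ suc i)) ≈ fromℤ (w i) * G (e i ∷ m ++ [ e (win o p ℕ.∸ suc i) ])) →
    (∀ {G} → IsAlternating G →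
       G (concat (applyUpTo (λ i → B (p ℕ.+ i)) o)) ≈ fromℤ v * G (applyUpTo (λ i → e (p ℕ.+ i)) o)) →
    ∀ {F} → IsAlternating F →
    F (concat (applyUpTo B (win o p))) ≈ fromℤ (prodℤ (applyUpTo w p) ℤ.* v) * F (applyUpTo e (win o p))
  window o zero    B e w v pairs mid {F} alt = trans (mid alt) (*-congʳ (reflexive (≡.cong fromℤ (≡.sym (ℤₚ.*-identityˡ v)))))
  window o (suc p) B e w v pairs mid {F} alt = begin
    F (B 0 ++ concat (applyUpTo (B ∘ suc) (suc n)))
      ≡⟨ ≡.cong (λ l → F (B 0 ++ l)) split ⟩
    F (B 0 ++ concat (applyUpTo (B ∘ suc) n) ++ B (suc n))
      ≈⟨ window o p (B ∘ suc) (e ∘ suc) (w ∘ suc) v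
           inner mid
           (alternating-context alt (B 0) (B (suc n))) ⟩
    fromℤ (W ℤ.* v) * F (B 0 ++ applyUpTo (e ∘ suc) n ++ B (suc n))
      ≈⟨ *-congˡ (pairs 0 ℕ.z<s alt (applyUpTo (e ∘ suc) n)
           (≡.trans (≡.cong signℕ (Listₚ.length-applyUpTo (e ∘ suc) n)) (signℕ-win o p))) ⟩
    fromℤ (W ℤ.* v) * (fromℤ (w 0) * F (e 0 ∷ applyUpTo (e ∘ suc) n ++ [ e (suc n) ]))
      ≈⟨ trans (sym (*-assoc _ _ _)) (*-cong
           (trans (sym (fromℤ-* (W ℤ.* v) (w 0))) (reflexive (≡.cong fromℤ (≡.trans (ℤₚ.*-comm (W ℤ.* v) (w 0)) (≡.sym (ℤₚ.*-assoc (w 0) W v))))))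
           (reflexive (≡.cong (λ l → F (e 0 ∷ l)) (Listₚ.applyUpTo-∷ʳ (e ∘ suc) n)))) ⟩
    fromℤ ((w 0 ℤ.* W) ℤ.* v) * F (e 0 ∷ applyUpTo (e ∘ suc) (suc n)) ∎
    where
    n : ℕ
    n = win o p
    W : ℤ
    W = prodℤ (applyUpTo (w ∘ suc) p)
    split : concat (applyUpTo (B ∘ suc) (suc n)) ≡ concat (applyUpTo (B ∘ suc) n) ++ B (suc n)
    split = ≡.trans (≡.cong concat (≡.sym (Listₚ.applyUpTo-∷ʳ (B ∘ suc) n)))
      (≡.trans (≡.sym (Listₚ.concat-++ (applyUpTo (B ∘ suc) n) [ B (suc n) ])) (≡.cong (concat (applyUpTo (B ∘ suc) n) ++_) (Listₚ.++-identityʳ (B (suc n)))))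
    inner : ∀ i → i ℕ.< p → ∀ {G} → IsAlternating G → ∀ m → signℕ (length m) ≡ signℕ o →
      G (B (suc i) ++ m ++ B (suc (n ℕ.∸ suc i))) ≈ fromℤ (w (suc i)) * G (e (suc i) ∷ m ++ [ e (suc (n ℕ.∸ suc i)) ])
    inner i i<p {G} alt′ m s = ≡.subst
      (λ k → G (B (suc i) ++ m ++ B k) ≈ fromℤ (w (suc i)) * G (e (suc i) ∷ m ++ [ e k ]))
      (∸-suc (ℕₚ.≤-trans i<p (p≤win o p))) (pairs (suc i) (ℕ.s<s i<p) alt′ m s)

  fromℤ-det : ∀ a b d g → fromℤ a * fromℤ g - fromℤ b * fromℤ d ≈ fromℤ (a ℤ.* g ℤ.- b ℤ.* d)
  fromℤ-det a b d g = sym (trans (fromℤ-+ (a ℤ.* g) (ℤ.- (b ℤ.* d)))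
    (+-cong (fromℤ-* a g) (trans (fromℤ-neg (b ℤ.* d)) (-‿cong (fromℤ-* b d)))))

  σ-square : ∀ n → σ n * σ n ≈ 1#
  σ-square n = trans (sym (fromℤ-* (signℕ n) (signℕ n))) (trans (reflexive (≡.cong fromℤ (signℕ-square n))) fromℤ-1)

  row-left : ∀ t x {i i′} → t ℕ.∸ suc i ≡ i′ → res t x ≡ i →
             ∀ j → row t x j ≈ fromℤ (+ quo t x) * u i j + fromℤ (+ suc (quo t x)) * u i′ j
  row-left t x ≡.refl ≡.refl j = +-comm _ _

  row-right : ∀ t x {i i′} → t ℕ.∸ suc i′ ≡ i → res t x ≡ i′ →
              ∀ j → row t x j ≈ fromℤ (+ suc (quo t x)) * u i j + fromℤ (+ quo t x) * u i′ j
  row-right t x ≡.refl ≡.refl j = refl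

  -- With both beads on one runner a row crosses `m`, at the cost of `signℕ o`, and the determinant
  -- is plus or minus the difference of the levels; with one bead on each runner it is minus the sum
  -- of the levels and 1. `factorOf` has the same absolute values, because in a quotient with two
  -- parts the first level is lowered by 1.
  pair : ∀ n o {i i′ xs ys} → suc n ℕ.∸ suc i ≡ i′ → suc n ℕ.∸ suc i′ ≡ i →
    Runner (suc n) i xs → Runner (suc n) i′ ys → length xs ℕ.+ length ys ≡ 2 →
    ∀ {G} → IsAlternating G → ∀ m → signℕ (length m) ≡ signℕ o →
    G (map (row (suc n)) xs ++ m ++ map (row (suc n)) ys)
    ≈ fromℤ (signℕ (exponent o (length xs) (length ys)) ℤ.* factorOf (suc n) xs ys) * G (u i ∷ m ++ [ u i′ ])
  pair n o {i} {i′} {x ∷ y ∷ []} {[]} e₁ e₂ rx ry len {G} alt m sm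
    with a , q≡ , _ ← top-quotient n rx = begin
      G (ρ x ∷ ρ y ∷ m ++ [])
        ≈⟨ move (alternating-∷ alt (ρ x)) (ρ y) m [] ⟩
      σ (length m) * G (ρ x ∷ m ++ [ ρ y ])
        ≈⟨ *-cong (reflexive (≡.cong fromℤ sm)) (two-by-two alt m []
             (fromℤ (+ quo t x)) (fromℤ (+ suc (quo t x))) (fromℤ (+ quo t y)) (fromℤ (+ suc (quo t y)))
             (row-left t x e₁ (All.head (Runner.residues rx))) (row-left t y e₁ (All.head (All.tail (Runner.residues rx))))) ⟩
      σ o * (_ * G (u i ∷ m ++ [ u i′ ]))
        ≈⟨ trans (sym (*-assoc _ _ _)) (*-congʳ (trans (*-congˡ (fromℤ-det (+ quo t x) (+ suc (quo t x)) (+ quo t y) (+ suc (quo t y)))) (sym (fromℤ-* (signℕ o) _)))) ⟩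
      fromℤ (signℕ o ℤ.* (+ quo t x ℤ.* + suc (quo t y) ℤ.- + suc (quo t x) ℤ.* + quo t y)) * G (u i ∷ m ++ [ u i′ ])
        ≡⟨ ≡.cong (λ z → fromℤ z * G (u i ∷ m ++ [ u i′ ])) (≡.trans
             (≡.cong (λ k → signℕ o ℤ.* (+ k ℤ.* + suc (quo t y) ℤ.- + suc k ℤ.* + quo t y)) q≡)
             (≡.trans (IntSolver.solve 3 (λ s a b → let open IntSolver in
                s :* ((con (+ 1) :+ a) :* (con (+ 1) :+ b) :- (con (+ 1) :+ (con (+ 1) :+ a)) :* b) := s :* (a :- b :+ con (+ 1)))
                ≡.refl (signℕ o) (+ a) (+ quo t y))
             (≡.cong₂ ℤ._*_ (≡.cong signℕ (≡.sym (ℕₚ.*-identityʳ o))) (≡.sym (factorOf-20 t x y q≡))))) ⟩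
      fromℤ (signℕ (o ℕ.* 1) ℤ.* factorOf t (x ∷ [ y ]) []) * G (u i ∷ m ++ [ u i′ ]) ∎
    where
    t : ℕ
    t = suc n
    ρ : ℕ → Row
    ρ = row t
  pair n o {i} {i′} {x ∷ []} {y ∷ []} e₁ e₂ rx ry len {G} alt m sm = begin
      G (ρ x ∷ m ++ [ ρ y ])
        ≈⟨ two-by-two alt m []
             (fromℤ (+ quo t x)) (fromℤ (+ suc (quo t x))) (fromℤ (+ suc (quo t y))) (fromℤ (+ quo t y))
             (row-left t x e₁ (All.head (Runner.residues rx))) (row-right t y e₂ (All.head (Runner.residues ry))) ⟩
      _ * G (u i ∷ m ++ [ u i′ ])
        ≈⟨ *-congʳ (fromℤ-det (+ quo t x) (+ suc (quo t x)) (+ suc (quo t y)) (+ quo t y)) ⟩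
      fromℤ (+ quo t x ℤ.* + quo t y ℤ.- + suc (quo t x) ℤ.* + suc (quo t y)) * G (u i ∷ m ++ [ u i′ ])
        ≡⟨ ≡.cong (λ z → fromℤ z * G (u i ∷ m ++ [ u i′ ])) (≡.trans
             (IntSolver.solve 2 (λ a b → let open IntSolver in
                a :* b :- (con (+ 1) :+ a) :* (con (+ 1) :+ b) := con (ℤ.- (+ 1)) :* (a :+ b :+ con (+ 1)))
                ≡.refl (+ quo t x) (+ quo t y))
             (≡.cong₂ ℤ._*_ (≡.cong (λ k → signℕ (1 ℕ.+ k)) (≡.sym (ℕₚ.*-zeroʳ o))) (≡.sym (factorOf-11 t x y)))) ⟩
      fromℤ (signℕ (1 ℕ.+ o ℕ.* 0) ℤ.* factorOf t [ x ] [ y ]) * G (u i ∷ m ++ [ u i′ ]) ∎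
    where
    t : ℕ
    t = suc n
    ρ : ℕ → Row
    ρ = row t
  pair n o {i} {i′} {[]} {x ∷ y ∷ []} e₁ e₂ rx ry len {G} alt m sm
    with a , q≡ , _ ← top-quotient n ry = begin
      G (m ++ ρ x ∷ [ ρ y ])
        -- `move` carries a row only from the head to the right, so the inverse move is obtained by
        -- inserting the square of a sign.
        ≈⟨ sym (trans (*-congʳ (σ-square (length m))) (*-identityˡ _)) ⟩
      (σ (length m) * σ (length m)) * G (m ++ ρ x ∷ [ ρ y ])
        ≈⟨ trans (*-assoc _ _ _) (*-congˡ (sym (move alt (ρ x) m [ ρ y ]))) ⟩
      σ (length m) * G (ρ x ∷ m ++ [ ρ y ])
        ≈⟨ *-cong (reflexive (≡.cong fromℤ sm)) (two-by-two alt m []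
             (fromℤ (+ suc (quo t x))) (fromℤ (+ quo t x)) (fromℤ (+ suc (quo t y))) (fromℤ (+ quo t y))
             (row-right t x e₂ (All.head (Runner.residues ry))) (row-right t y e₂ (All.head (All.tail (Runner.residues ry))))) ⟩
      σ o * (_ * G (u i ∷ m ++ [ u i′ ]))
        ≈⟨ trans (sym (*-assoc _ _ _)) (*-congʳ (trans (*-congˡ (fromℤ-det (+ suc (quo t x)) (+ quo t x) (+ suc (quo t y)) (+ quo t y))) (sym (fromℤ-* (signℕ o) _)))) ⟩
      fromℤ (signℕ o ℤ.* (+ suc (quo t x) ℤ.* + quo t y ℤ.- + quo t x ℤ.* + suc (quo t y))) * G (u i ∷ m ++ [ u i′ ])
        ≡⟨ ≡.cong (λ z → fromℤ z * G (u i ∷ m ++ [ u i′ ])) (≡.trans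
             (≡.cong (λ k → signℕ o ℤ.* (+ suc k ℤ.* + quo t y ℤ.- + k ℤ.* + suc (quo t y))) q≡)
             (≡.trans (IntSolver.solve 3 (λ s a b → let open IntSolver in
                s :* ((con (+ 1) :+ (con (+ 1) :+ a)) :* b :- (con (+ 1) :+ a) :* (con (+ 1) :+ b)) := (:- s) :* (a :- b :+ con (+ 1)))
                ≡.refl (signℕ o) (+ a) (+ quo t y))
             -- The 3 is the reduced value of `choose2 (2 + 1)`.
             (≡.cong₂ ℤ._*_ (≡.trans (≡.sym (signℕ-suc o)) (≡.cong (λ k → signℕ (3 ℕ.+ k)) (≡.sym (ℕₚ.*-identityʳ o)))) (≡.sym (factorOf-02 t x y q≡))))) ⟩
      fromℤ (signℕ (3 ℕ.+ o ℕ.* 1) ℤ.* factorOf t [] (x ∷ [ y ])) * G (u i ∷ m ++ [ u i′ ]) ∎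
    where
    t : ℕ
    t = suc n
    ρ : ℕ → Row
    ρ = row t
  pair n o {xs = x ∷ y ∷ []} {z ∷ ys} e₁ e₂ rx ry ()
  pair n o {xs = x ∷ y ∷ z ∷ xs} e₁ e₂ rx ry ()

  -- Here both spanning rows are `u i`, so the coefficients c and c+1 add up to 2c+1.
  middle : ∀ t {i xs} → t ℕ.∸ suc i ≡ i → All (λ x → res t x ≡ i) xs → length xs ≡ 1 → ∀ {G} → IsAlternating G →
    G (map (row t) xs ++ []) ≈ fromℤ (+ 2 ℤ.* + part (quotientOf t xs) 1 ℤ.+ + 1) * G [ u i ]
  middle t {i} {x ∷ []} e (r ∷ []) len {G} alt = begin
    G [ row t x ]
      ≈⟨ linear alt [] [] (fromℤ (+ quo t x)) (fromℤ (+ suc (quo t x))) (row-left t x e r) ⟩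
    fromℤ (+ quo t x) * G [ u i ] + fromℤ (+ suc (quo t x)) * G [ u i ]
      ≈⟨ trans (sym (distribʳ _ _ _)) (*-congʳ (sym (fromℤ-+ (+ quo t x) (+ suc (quo t x))))) ⟩
    fromℤ (+ quo t x ℤ.+ + suc (quo t x)) * G [ u i ]
      ≡⟨ ≡.cong (λ z → fromℤ z * G [ u i ]) (≡.trans
           (IntSolver.solve 1 (λ a → let open IntSolver in a :+ (con (+ 1) :+ a) := con (+ 2) :* a :+ con (+ 1)) ≡.refl (+ quo t x))
           (≡.cong (λ k → + 2 ℤ.* + k ℤ.+ + 1) (≡.sym (part₁-one t x)))) ⟩
    fromℤ (+ 2 ℤ.* + part (quotientOf t [ x ]) 1 ℤ.+ + 1) * G [ u i ] ∎
    where open IsAlternating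

-- The vanishing criterion and the value.

module Theorem {c ℓ : Level} (R : CommutativeRing c ℓ)
  (dom : RingDefs.IntegralDomain R) (ch : RingDefs.CharZero R) (o p′ : ℕ) (o≤1 : o ℕ.≤ 1) (ω : CommutativeRing.Carrier R)
  (prim : RingDefs.PrimitiveRoot R (win o (suc p′)) ω)
  (lam : Fin (win o (suc p′)) → ℕ) (isPart : IsPartition (win o (suc p′)) lam) where

  open CommutativeRing R hiding (zero)
  open RingDefs R
  open IntegerEmbedding R
  open AlternatingForms R
  open Entries R
  open Evaluation R
  open import Relation.Binary.Reasoning.Setoid setoid

  private
    p t : ℕ
    p = suc p′
    t = win o p

    β : List ℕ
    β = beta t lam

    n : ℕ → ℕ
    n = nres t lam

    runner : ℕ → List ℕ
    runner i = resClass t i β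

    isRunner : ∀ i → Runner t i (runner i)
    isRunner i = record
      { residues   = Allₚ.all-filter (λ x → res t x ℕ.≟ i) β
      ; decreasing = AllPairsₚ.filter⁺ (λ x → res t x ℕ.≟ i) (beta-decreasing t lam isPart) }

    res<t : ∀ x → res t x ℕ.< t
    res<t x = m%n<n x t

    F : List Row → Carrier
    F ρs = D ρs (upTo t)

    F-alternating : IsAlternating F
    F-alternating = D-alternating (upTo t)

    oo : Carrier
    oo = ooAtRoots t lam ω

    oo≈F : oo ≈ F (map (row t) β)
    oo≈F = trans
      (det≈D t _ (λ i → row t (betaEntry t lam i)) toℕ
        (λ i j → entry≈row dom (suc (win o p′)) ω prim (lam i) (toℕ i) (toℕ j) (Finₚ.toℕ<n i) (Finₚ.toℕ<n j)))
      (reflexive (≡.cong₂ D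
        (≡.trans (≡.sym (Listₚ.map-tabulate (betaEntry t lam) (row t))) (≡.cong (map (row t)) (≡.sym (beta≡tabulate t lam))))
        (tabulate-toℕ id t)))

    sum-n : sum (applyUpTo n t) ≡ t
    sum-n = ≡.trans (≡.sym (length-concat runner t))
      (≡.trans (≡.sym (Permₚ.↭-length (buckets-↭ (res t) t β (All.universal res<t β)))) (length-beta t lam))

  open Core t n sum-n

  private
    sorted : List (ℕ × ℕ)
    sorted = concatMap (λ i → filter (λ q → res t (proj₂ q) ℕ.≟ i) (indexed β)) (upTo t)

    sorted≡ : sorted ≡ concat (applyUpTo (λ i → bucket (res t ∘ proj₂) i (indexed β)) t)
    sorted≡ = ≡.cong concat (Listₚ.map-upTo (λ i → bucket (res t ∘ proj₂) i (indexed β)) t)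

    map-sorted : map (row t ∘ proj₂) sorted ≡ concat (applyUpTo (λ i → map (row t) (runner i)) t)
    map-sorted = ≡R.begin
      map (row t ∘ proj₂) sorted
        ≡R.≡⟨ ≡.cong (map (row t ∘ proj₂)) sorted≡ ⟩
      map (row t ∘ proj₂) (concat (applyUpTo (λ i → bucket (res t ∘ proj₂) i (indexed β)) t))
        ≡R.≡⟨ ≡.sym (Listₚ.concat-map (applyUpTo (λ i → bucket (res t ∘ proj₂) i (indexed β)) t)) ⟩
      concat (map (map (row t ∘ proj₂)) (applyUpTo (λ i → bucket (res t ∘ proj₂) i (indexed β)) t))
        ≡R.≡⟨ ≡.cong concat (Listₚ.map-applyUpTo (λ i → bucket (res t ∘ proj₂) i (indexed β)) (map (row t ∘ proj₂)) t) ⟩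
      concat (applyUpTo (λ i → map (row t ∘ proj₂) (bucket (res t ∘ proj₂) i (indexed β))) t)
        ≡R.≡⟨ ≡.cong concat (applyUpTo-cong (λ i → ≡.trans (Listₚ.map-∘ (bucket (res t ∘ proj₂) i (indexed β))) (≡.cong (map (row t)) (runner≡ i))) t) ⟩
      concat (applyUpTo (λ i → map (row t) (runner i)) t) ≡R.∎
      where
      module ≡R = ≡.≡-Reasoning
      filter-map : ∀ i qs → map proj₂ (bucket (res t ∘ proj₂) i qs) ≡ resClass t i (map proj₂ qs)
      filter-map i []       = ≡.refl
      filter-map i (q ∷ qs) with does (res t (proj₂ q) ℕ.≟ i)
      ... | true  = ≡.cong (proj₂ q ∷_) (filter-map i qs)
      ... | false = filter-map i qs
      runner≡ : ∀ i → map proj₂ (bucket (res t ∘ proj₂) i (indexed β)) ≡ runner i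
      runner≡ i = ≡.trans (filter-map i (indexed β)) (≡.cong (resClass t i) (map-proj₂-indexed β))

    -- The positions in `indexed β` are increasing, and in `sorted` they form `sigma t lam`; with
    -- positions as labels, the sign of the reordering is `sgn (sigma t lam)` by definition.
    F-sorted : F (map (row t) β) ≈ fromℤ (sgn (sigma t lam)) * F (concat (applyUpTo (λ i → map (row t) (runner i)) t))
    F-sorted = begin
      F (map (row t) β)
        ≡⟨ ≡.cong (F ∘ map (row t)) (≡.sym (map-proj₂-indexed β)) ⟩
      F (map (row t) (map proj₂ (indexed β)))
        ≡⟨ ≡.cong F (≡.sym (Listₚ.map-∘ (indexed β))) ⟩
      F (map (row t ∘ proj₂) (indexed β))
        ≈⟨ sym (trans (*-congʳ fromℤ-1) (*-identityˡ _)) ⟩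
      σ 0 * F (map (row t ∘ proj₂) (indexed β))
        ≡⟨ ≡.cong (λ k → σ k * F (map (row t ∘ proj₂) (indexed β)))
             (≡.sym (inversions-increasing (AllPairsₚ.map⁺ (indexed-increasing β)))) ⟩
      σ (inversions (map proj₁ (indexed β))) * F (map (row t ∘ proj₂) (indexed β))
        ≈⟨ permutation-sign proj₁ (row t ∘ proj₂) F-alternating
             (≡.subst (indexed β ↭_) (≡.sym sorted≡) (buckets-↭ (res t ∘ proj₂) t (indexed β) (All.universal (λ q → res<t (proj₂ q)) (indexed β))))
             (AllPairs.map ℕₚ.<⇒≢ (indexed-increasing β)) ⟩
      fromℤ (sgn (sigma t lam)) * F (map (row t ∘ proj₂) sorted)
        ≡⟨ ≡.cong (λ l → fromℤ (sgn (sigma t lam)) * F l) map-sorted ⟩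
      fromℤ (sgn (sigma t lam)) * F (concat (applyUpTo (λ i → map (row t) (runner i)) t)) ∎

    reflect² : ∀ {i} → i ℕ.< t → t ℕ.∸ suc (t ℕ.∸ suc i) ≡ i
    reflect² i<t = ≡.trans (≡.cong (t ℕ.∸_) (≡.sym (∸-suc i<t))) (ℕₚ.m∸[m∸n]≡n (ℕₚ.<⇒≤ i<t))

    -- The rows of the crowded plane are brought to the front; the sign that this costs can be
    -- undone, as signs square to 1.
    crowded⇒zero : ∀ i → i ℕ.< t → 3 ℕ.≤ n i ℕ.+ n (t ℕ.∸ suc i) → F (map (row t) β) ≈ 0#
    crowded⇒zero i i<t crowded = begin
      F (map (row t) β)
        ≈⟨ sym (trans (*-congʳ (σ-square k)) (*-identityˡ _)) ⟩
      (σ k * σ k) * F (map (row t) β)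
        ≈⟨ *-assoc _ _ _ ⟩
      σ k * (σ k * F (map (row t) β))
        ≈⟨ *-congˡ (permutation-sign id (row t) F-alternating split (AllPairs.map (λ y<x eq → ℕₚ.<⇒≢ y<x (≡.sym eq)) (beta-decreasing t lam isPart))) ⟩
      σ k * (σ (inversions (map id (filter P? β ++ rest))) * F (map (row t) (filter P? β ++ rest)))
        ≈⟨ *-congˡ (trans (*-congˡ (vanish (filter P? β) (Allₚ.all-filter P? β) many)) (zeroʳ _)) ⟩
      σ k * 0#
        ≈⟨ zeroʳ _ ⟩
      0# ∎
      where
      i′ k : ℕ
      i′ = t ℕ.∸ suc i
      k = inversions (map id β)
      P : ℕ → Set
      P x = res t x ≡ i ⊎ res t x ≡ i′
      P? : ∀ x → Dec (P x)
      P? x = (res t x ℕ.≟ i) ⊎-dec (res t x ℕ.≟ i′)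
      rest : List ℕ
      rest = proj₁ (filter-split P? β)
      split : β ↭ filter P? β ++ rest
      split = proj₂ (filter-split P? β)
      coords : ∀ x → P x → ∃ λ a → ∃ λ b → ∀ j → row t x j ≈ a * u i j + b * u i′ j
      coords x (inj₁ eq) = _ , _ , row-left t x ≡.refl eq
      coords x (inj₂ eq) = _ , _ , row-right t x (reflect² i<t) eq
      -- At `i ≡ i′` the same runner is counted twice: the bound 3 guarantees only two rows, but
      -- these lie on one line.
      many : (i ≢ i′ × 3 ℕ.≤ length (filter P? β)) ⊎ (i ≡ i′ × 2 ℕ.≤ length (filter P? β))
      many with i ℕ.≟ i′
      ... | no i≢i′  = inj₁ (i≢i′ , ℕₚ.≤-trans crowded (ℕₚ.≤-reflexive (≡.sym (count-⊎ (res t) i i′ i≢i′ β))))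
      ... | yes i≡i′ = inj₂ (i≡i′ , ℕₚ.≤-trans (half (n i) (≡.subst (λ z → 3 ℕ.≤ n i ℕ.+ n z) (≡.sym i≡i′) crowded)) n≤)
        where
        half : ∀ a → 3 ℕ.≤ a ℕ.+ a → 2 ℕ.≤ a
        half (suc zero)    (ℕ.s≤s (ℕ.s≤s ()))
        half (suc (suc a)) _ = ℕ.s≤s (ℕ.s≤s ℕ.z≤n)
        n≤ : n i ℕ.≤ length (filter P? β)
        n≤ = go β
          where
          go : ∀ xs → count (λ x → res t x ℕ.≟ i) xs ℕ.≤ count P? xs
          go []       = ℕ.z≤n
          go (x ∷ xs) with does (res t x ℕ.≟ i) | does (res t x ℕ.≟ i′)
          ... | true  | _     = ℕ.s≤s (go xs)
          ... | false | true  = ℕₚ.m≤n⇒m≤1+n (go xs)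
          ... | false | false = go xs
      vanish : ∀ xs → All P xs → (i ≢ i′ × 3 ℕ.≤ length xs) ⊎ (i ≡ i′ × 2 ℕ.≤ length xs) → F (map (row t) (xs ++ rest)) ≈ 0#
      vanish (x ∷ y ∷ z ∷ xs) (px ∷ py ∷ pz ∷ _) (inj₁ _)
        with a₁ , b₁ , e₁ ← coords x px | a₂ , b₂ , e₂ ← coords y py | a₃ , b₃ , e₃ ← coords z pz =
        three-dependent F-alternating (map (row t) (xs ++ rest)) a₁ b₁ a₂ b₂ a₃ b₃ e₁ e₂ e₃
      vanish (x ∷ y ∷ xs) (px ∷ py ∷ _) (inj₂ (i≡i′ , _))
        with a₁ , b₁ , e₁ ← coords x px | a₂ , b₂ , e₂ ← coords y py =
        two-dependent F-alternating (map (row t) (xs ++ rest)) a₁ b₁ a₂ b₂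
          (≡.subst (λ z → ∀ j → row t x j ≈ a₁ * u i j + b₁ * u z j) (≡.sym i≡i′) e₁)
          (≡.subst (λ z → ∀ j → row t y j ≈ a₂ * u i j + b₂ * u z j) (≡.sym i≡i′) e₂)
      vanish (x ∷ y ∷ []) _ (inj₁ (_ , ℕ.s≤s (ℕ.s≤s ())))
      vanish (x ∷ [])     _ (inj₁ (_ , ℕ.s≤s ()))
      vanish (x ∷ [])     _ (inj₂ (_ , ℕ.s≤s ()))
      vanish []           _ (inj₁ (_ , ()))
      vanish []           _ (inj₂ (_ , ()))

  -- Decided by counting beads, so no test for zero in `R` is involved. The sum of all
  -- `n i + n (t ∸ suc i)` meets every runner twice and is 2t; if no term exceeds 2, all are equal
  -- to 2.
  paired∨zero : Paired ⊎ oo ≈ 0#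
  paired∨zero with ℕₚ.anyUpTo? (λ i → 3 ℕ.≤? n i ℕ.+ n (t ℕ.∸ suc i)) t
  ... | yes (i , i<t , crowded) = inj₂ (trans oo≈F (crowded⇒zero i i<t crowded))
  ... | no none = inj₁ (sum-saturated 2 (λ i → n i ℕ.+ n (t ℕ.∸ suc i)) t
          (λ i i<t → ℕ.s≤s⁻¹ (ℕₚ.≰⇒> (λ le → none (i , i<t , le)))) total)
    where
    total : sum (applyUpTo (λ i → n i ℕ.+ n (t ℕ.∸ suc i)) t) ≡ t ℕ.* 2
    total = ≡.trans (sum-+ n (λ i → n (t ℕ.∸ suc i)) t) (≡.trans
      (≡.cong₂ ℕ._+_ sum-n (≡.trans (≡.sym (sum-reverse n t)) sum-n))
      (≡.trans (≡.cong (t ℕ.+_) (≡.sym (ℕₚ.+-identityʳ t))) (ℕₚ.*-comm 2 t)))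

  private
    factor : ℕ → ℤ
    factor i = factorOf t (runner i) (runner (t ℕ.∸ suc i))

    weight : ℕ → ℤ
    weight i = signℕ (exponent o (n i) (n (t ℕ.∸ suc i))) ℤ.* factor i

    midFactor : ℤ
    midFactor = if does (res 2 t ℕ.≟ 1) then + 2 ℤ.* + part (quotientPart t lam ((t ℕ.∸ 1) / 2)) 1 ℤ.+ + 1 else + 1

    i<p⇒i<t : ∀ {i} → i ℕ.< p → i ℕ.< t
    i<p⇒i<t i<p = ℕₚ.≤-trans i<p (p≤win o p)

  module _ (paired : Paired) where

    private
      middle-data : o ≡ 1 → (p ℕ.< t) × (t ℕ.∸ suc p ≡ p) × (n p ≡ 1)
      middle-data o≡1 = p<t , refl-p , half (n p) (≡.trans (≡.cong (λ k → n p ℕ.+ n k) (≡.sym refl-p)) (paired p p<t))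
        where
        t≡ : t ≡ suc p ℕ.+ p
        t≡ = ≡.trans (win≡ o p) (≡.cong (ℕ._+ p) (≡.trans (≡.cong (p ℕ.+_) o≡1) (ℕₚ.+-comm p 1)))
        p<t : p ℕ.< t
        p<t = ≡.subst (p ℕ.<_) (≡.sym t≡) (ℕₚ.m≤m+n (suc p) p)
        refl-p : t ℕ.∸ suc p ≡ p
        refl-p = ≡.trans (≡.cong (ℕ._∸ suc p) t≡) (ℕₚ.m+n∸m≡n (suc p) p)
        half : ∀ a → a ℕ.+ a ≡ 2 → a ≡ 1
        half 1 _ = ≡.refl
        half (suc (suc zero)) ()
        half (suc (suc (suc a))) ()

      o-cases : o ≡ 0 ⊎ o ≡ 1
      o-cases = cases o≤1
        where
        cases : ∀ {o} → o ℕ.≤ 1 → o ≡ 0 ⊎ o ≡ 1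
        cases ℕ.z≤n         = inj₁ ≡.refl
        cases (ℕ.s≤s ℕ.z≤n) = inj₂ ≡.refl

      midFactor-even : o ≡ 0 → midFactor ≡ + 1
      midFactor-even o≡0 = ≡.cong (λ k → if does (k ℕ.≟ 1) then + 2 ℤ.* + part (quotientPart t lam ((t ℕ.∸ 1) / 2)) 1 ℤ.+ + 1 else + 1)
        (≡.trans (res2-win o p) (≡.cong (res 2) o≡0))

      midFactor-odd : o ≡ 1 → midFactor ≡ + 2 ℤ.* + part (quotientPart t lam p) 1 ℤ.+ + 1
      midFactor-odd o≡1 = ≡.cong₂ (λ k i → if does (k ℕ.≟ 1) then + 2 ℤ.* + part (quotientPart t lam i) 1 ℤ.+ + 1 else + 1)
        (≡.trans (res2-win o p) (≡.cong (res 2) o≡1))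
        (≡.trans (≡.cong (λ k → (k ℕ.∸ 1) / 2) (≡.trans (≡.cong (λ k → win k p) o≡1) (win-suc 0 p))) (win/2 0 p ℕ.z≤n))

      mid : ∀ {G} → IsAlternating G →
        G (concat (applyUpTo (λ i → map (row t) (runner (p ℕ.+ i))) o)) ≈ fromℤ midFactor * G (applyUpTo (λ i → u (p ℕ.+ i)) o)
      mid {G} alt with o-cases
      ... | inj₁ o≡0 = ≡.subst
        (λ k → G (concat (applyUpTo (λ i → map (row t) (runner (p ℕ.+ i))) k)) ≈ fromℤ midFactor * G (applyUpTo (λ i → u (p ℕ.+ i)) k))
        (≡.sym o≡0) (sym (trans (*-congʳ (trans (reflexive (≡.cong fromℤ (midFactor-even o≡0))) fromℤ-1)) (*-identityˡ _)))
      ... | inj₂ o≡1 with p<t , refl-p , n≡1 ← middle-data o≡1 = ≡.subst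
        (λ k → G (concat (applyUpTo (λ i → map (row t) (runner (p ℕ.+ i))) k)) ≈ fromℤ midFactor * G (applyUpTo (λ i → u (p ℕ.+ i)) k))
        (≡.sym o≡1) (≡.subst (λ z → G (map (row t) (runner z) ++ []) ≈ fromℤ midFactor * G [ u z ]) (≡.sym (ℕₚ.+-identityʳ p))
          (trans (middle t refl-p (Runner.residues (isRunner p)) n≡1 alt)
                 (*-congʳ (reflexive (≡.cong fromℤ (≡.sym (midFactor-odd o≡1)))))))

      midFactor≢0 : midFactor ≢ + 0
      midFactor≢0 eq with o-cases
      ... | inj₁ o≡0 = contradiction (≡.trans (≡.sym (midFactor-even o≡0)) eq) λ ()
      ... | inj₂ o≡1 = contradiction (≡.trans (≡.sym (≡.trans (midFactor-odd o≡1) (odd (part (quotientPart t lam p) 1)))) eq) λ ()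
        where
        odd : ∀ k → + 2 ℤ.* + k ℤ.+ + 1 ≡ + suc (2 ℕ.* k)
        odd k = ≡.trans (≡.cong (ℤ._+ + 1) (≡.sym (ℤₚ.pos-* 2 k))) (≡.cong +_ (ℕₚ.+-comm (2 ℕ.* k) 1))

      pairs : ∀ i → i ℕ.< p → ∀ {G} → IsAlternating G → ∀ m → signℕ (length m) ≡ signℕ o →
        G (map (row t) (runner i) ++ m ++ map (row t) (runner (t ℕ.∸ suc i))) ≈ fromℤ (weight i) * G (u i ∷ m ++ [ u (t ℕ.∸ suc i) ])
      pairs i i<p = pair (suc (win o p′)) o ≡.refl (reflect² (i<p⇒i<t i<p)) (isRunner i) (isRunner (t ℕ.∸ suc i)) (paired i (i<p⇒i<t i<p))

    -- The value in the shape in which the evaluation yields it, signs attached pair by pair;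
    -- `rhs≡value` collects them into the global exponent.
    value : ℤ
    value = sgn (sigma t lam) ℤ.* (prodℤ (applyUpTo weight p) ℤ.* midFactor)

    oo≈value : oo ≈ fromℤ value
    oo≈value = begin
      oo
        ≈⟨ trans oo≈F F-sorted ⟩
      fromℤ s * F (concat (applyUpTo (λ i → map (row t) (runner i)) t))
        ≈⟨ *-congˡ (window o p (λ i → map (row t) (runner i)) u weight midFactor pairs mid F-alternating) ⟩
      fromℤ s * (fromℤ (prodℤ (applyUpTo weight p) ℤ.* midFactor) * F (applyUpTo u t))
        ≈⟨ *-congˡ (trans (*-congˡ (D-unitriangular t 0)) (*-identityʳ _)) ⟩
      fromℤ s * fromℤ (prodℤ (applyUpTo weight p) ℤ.* midFactor)
        ≈⟨ sym (fromℤ-* s (prodℤ (applyUpTo weight p) ℤ.* midFactor)) ⟩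
      fromℤ value ∎
      where
      s : ℤ
      s = sgn (sigma t lam)

    value≢0 : value ≢ + 0
    value≢0 = *≢0 (signℕ≢0 (inversions (sigma t lam))) (*≢0
      (prodℤ≢0 weight p (λ i i<p → *≢0 (signℕ≢0 (exponent o (n i) (n (t ℕ.∸ suc i))))
        (factorOf≢0 (suc (win o p′)) (isRunner i) (isRunner (t ℕ.∸ suc i)) (paired i (i<p⇒i<t i<p)))))
      midFactor≢0)

    private
      a x : ℕ → ℕ
      a i = choose2 (n (t ℕ.∸ suc i) ℕ.+ 1)
      x i = (n i ℕ.∸ 1) ℕ.+ (n (t ℕ.∸ suc i) ℕ.∸ 1)

      S X : ℕ
      S = sum (applyUpTo a p)
      X = sum (applyUpTo x p)

      choose-sum : ℤ
      choose-sum = sumℤ (map (λ i → + choose2 (n i ℕ.+ 1)) (map (λ k → (suc t / 2) ℕ.+ k) (upTo (t ℕ.∸ suc t / 2))))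

      -- The upper half of the residues, starting at `p + o`, consists of the mirror images of the
      -- residues below `p`, in reverse order.
      choose-sum≡ : choose-sum ≡ + S
      choose-sum≡ = ≡R.begin
        choose-sum
          ≡R.≡⟨ ≡.cong₂ (λ q r → sumℤ (map f (map (q ℕ.+_) (upTo r)))) (suc-win/2 o p o≤1) len ⟩
        sumℤ (map f (map ((p ℕ.+ o) ℕ.+_) (upTo p)))
          ≡R.≡⟨ ≡.cong (sumℤ ∘ map f) (Listₚ.map-upTo ((p ℕ.+ o) ℕ.+_) p) ⟩
        sumℤ (map f (applyUpTo ((p ℕ.+ o) ℕ.+_) p))
          ≡R.≡⟨ ≡.cong sumℤ (Listₚ.map-applyUpTo ((p ℕ.+ o) ℕ.+_) f p) ⟩
        sumℤ (applyUpTo (λ k → f (p ℕ.+ o ℕ.+ k)) p)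
          ≡R.≡⟨ sumℤ-pos (λ k → choose2 (n (p ℕ.+ o ℕ.+ k) ℕ.+ 1)) p ⟩
        + sum (applyUpTo (λ k → choose2 (n (p ℕ.+ o ℕ.+ k) ℕ.+ 1)) p)
          ≡R.≡⟨ ≡.cong +_ (sum-reverse (λ k → choose2 (n (p ℕ.+ o ℕ.+ k) ℕ.+ 1)) p) ⟩
        + sum (applyUpTo (λ i → choose2 (n (p ℕ.+ o ℕ.+ (p ℕ.∸ suc i)) ℕ.+ 1)) p)
          ≡R.≡⟨ ≡.cong +_ (sum-cong p (λ i i<p → ≡.cong (λ k → choose2 (n k ℕ.+ 1)) (index i i<p))) ⟩
        + S ≡R.∎
        where
        module ≡R = ≡.≡-Reasoning
        f : ℕ → ℤ
        f i = + choose2 (n i ℕ.+ 1)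
        len : t ℕ.∸ suc t / 2 ≡ p
        len = ≡.trans (≡.cong₂ ℕ._∸_ (win≡ o p) (suc-win/2 o p o≤1)) (ℕₚ.m+n∸m≡n (p ℕ.+ o) p)
        index : ∀ i → i ℕ.< p → p ℕ.+ o ℕ.+ (p ℕ.∸ suc i) ≡ t ℕ.∸ suc i
        index i i<p = ≡.trans (≡.sym (ℕₚ.+-∸-assoc (p ℕ.+ o) i<p)) (≡.cong (ℕ._∸ suc i) (≡.sym (win≡ o p)))

      -- For odd `t` the middle runner holds one bead and adds nothing to the rank, which is
      -- therefore the sum `X` over the pairs; for even `t` the factor `o` is 0.
      rank-term : (if does (res 2 t ℕ.≟ 1) then + rank (core t lam) else + 0) ≡ + (o ℕ.* X)
      rank-term with o-cases
      ... | inj₁ o≡0 = ≡.trans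
        (≡.cong (λ k → if does (k ℕ.≟ 1) then + rank (core t lam) else + 0) (≡.trans (res2-win o p) (≡.cong (res 2) o≡0)))
        (≡.cong (λ k → + (k ℕ.* X)) (≡.sym o≡0))
      ... | inj₂ o≡1 = ≡.trans
        (≡.cong (λ k → if does (k ℕ.≟ 1) then + rank (core t lam) else + 0) (≡.trans (res2-win o p) (≡.cong (res 2) o≡1)))
        (≡.cong +_ (≡.trans rank≡ (≡.trans (≡.sym (ℕₚ.*-identityˡ X)) (≡.cong (ℕ._* X) (≡.sym o≡1)))))
        where
        rank≡ : rank (core t lam) ≡ X
        rank≡ = ≡.trans rank-coreOf (≡.trans (sum-win (λ i → n i ℕ.∸ 1) o p)
          (≡.trans (≡.cong (λ k → X ℕ.+ sum (applyUpTo (λ i → n (p ℕ.+ i) ℕ.∸ 1) k)) o≡1)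
          (≡.trans (≡.cong (λ k → X ℕ.+ ((n k ℕ.∸ 1) ℕ.+ 0)) (ℕₚ.+-identityʳ p))
          (≡.trans (≡.cong (λ k → X ℕ.+ ((k ℕ.∸ 1) ℕ.+ 0)) (proj₂ (proj₂ (middle-data o≡1)))) (ℕₚ.+-identityʳ X)))))

      signs : signℤ (ℤ.- choose-sum ℤ.+ (if does (res 2 t ℕ.≟ 1) then + rank (core t lam) else + 0))
              ≡ signℕ (sum (applyUpTo (λ i → exponent o (n i) (n (t ℕ.∸ suc i))) p))
      signs = ≡.trans (≡.cong₂ (λ y z → signℤ (ℤ.- y ℤ.+ z)) choose-sum≡ rank-term) (≡.trans (signℤ-diff S (o ℕ.* X))
        (≡.cong signℕ (≡.sym (≡.trans (sum-+ a (λ i → o ℕ.* x i) p) (≡.cong (S ℕ.+_) (sum-*ˡ o x p))))))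

    rhs≡value : rhs74 t lam ≡ value
    rhs≡value = ≡R.begin
      rhs74 t lam
        ≡R.≡⟨⟩
      signℤ (ℤ.- choose-sum ℤ.+ (if does (res 2 t ℕ.≟ 1) then + rank (core t lam) else + 0))
        ℤ.* s ℤ.* prodℤ (map factor (upTo (suc (win o p′ / 2)))) ℤ.* midFactor
        -- The number of factors is `p`, because t - 2 is `win o p′`, whose half is `p′`.
        ≡R.≡⟨ ≡.cong₂ (λ y z → y ℤ.* s ℤ.* z ℤ.* midFactor) signs
               (≡.cong prodℤ (≡.trans (≡.cong (λ k → map factor (upTo (suc k))) (win/2 o p′ o≤1)) (Listₚ.map-upTo factor p))) ⟩
      e ℤ.* s ℤ.* P ℤ.* midFactor
        ≡R.≡⟨ IntSolver.solve 4 (λ e s P m → let open IntSolver in e :* s :* P :* m := s :* (e :* P :* m)) ≡.refl e s P midFactor ⟩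
      s ℤ.* (e ℤ.* P ℤ.* midFactor)
        ≡R.≡⟨ ≡.cong (λ y → s ℤ.* (y ℤ.* midFactor)) (≡.sym (prodℤ-signs (λ i → exponent o (n i) (n (t ℕ.∸ suc i))) factor p)) ⟩
      value ≡R.∎
      where
      module ≡R = ≡.≡-Reasoning
      s e P : ℤ
      s = sgn (sigma t lam)
      e = signℕ (sum (applyUpTo (λ i → exponent o (n i) (n (t ℕ.∸ suc i))) p))
      P = prodℤ (applyUpTo factor p)

  private
    oo≢0 : Paired → ¬ (oo ≈ 0#)
    oo≢0 paired z = value≢0 paired (fromℤ-injective₀ ch (value paired) (trans (sym (oo≈value paired)) z))

  result : ((¬ (ooAtRoots t lam ω ≈ 0#)) ⇔ SelfConj (core t lam))
           × (SelfConj (core t lam) → ooAtRoots t lam ω ≈ fromℤ (rhs74 t lam))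
  result = mk⇔ nonzero⇒ (λ sc → oo≢0 (to selfConj⇔paired sc)) ,
    (λ sc → trans (oo≈value (to selfConj⇔paired sc)) (reflexive (≡.cong fromℤ (≡.sym (rhs≡value (to selfConj⇔paired sc))))))
    where
    open Equivalence using (to; from)
    nonzero⇒ : ¬ (oo ≈ 0#) → SelfConj (core t lam)
    nonzero⇒ nz with paired∨zero
    ... | inj₁ paired = from selfConj⇔paired paired
    ... | inj₂ z      = contradiction z nz

theorem7p4 : {c ℓ : Level} (R : CommutativeRing c ℓ) →
    let open CommutativeRing R in
    let open RingDefs R in
    IntegralDomain → CharZero →
    (t : ℕ) → 2 ≤ t → (ω : Carrier) → PrimitiveRoot t ω →
    (lam : Fin t → ℕ) → IsPartition t lam →
    ((¬ (ooAtRoots t lam ω ≈ 0#)) ⇔ SelfConj (core t lam))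
    × (SelfConj (core t lam) → ooAtRoots t lam ω ≈ fromℤ (rhs74 t lam))
theorem7p4 R dom ch t 2≤t ω prim lam isPart with win-surjective t
-- Positivity of the second component is the condition `2 ≤ t`; in this form `t` reduces to a
-- successor, on which `res` and `quo` compute.
... | o , suc p , o≤1 , ≡.refl = Theorem.result R dom ch o p o≤1 ω prim lam isPart
theorem7p4 R dom ch .0 () ω prim lam isPart | .0 , zero , ℕ.z≤n , ≡.refl
theorem7p4 R dom ch .1 (ℕ.s≤s ()) ω prim lam isPart | .1 , zero , ℕ.s≤s ℕ.z≤n , ≡.refl
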